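{- Let $\mathsf{N}_n$ be a uniformly random simplex tree-child network with $n$ taxa. On the event that $\mathsf{N}_n$ has at least one tree vertex, let $u_n$ be chosen uniformly at random among the tree vertices of $\mathsf{N}_n$ (on the complementary event $u_n$ is an arbitrary vertex). There exists a deterministic infinite rooted network $(\hat{\mathcal{L}},p_0)$, namely the one constructed in the context, such that $(\mathsf{N}_n,u_n)\xrightarrow{d}(\hat{\mathcal{L}},p_0)$ in the local weak sense as $n\to\infty$.
   Context: A simplex tree-child network on a finite set $X$ is a finite directed acyclic graph $N=(V,E)$ with a root $o$ and with leaves bijectively labelled by $X$, such that: the root has (indegree, outdegree) $=(0,1)$; every vertex is reachable from $o$ by a directed path; every leaf has degree $(1,0)$; every vertex that is neither the root nor a leaf is either a tree vertex, of degree $(1,2)$, or a reticulation vertex, of degree $(2,1)$; (tree-child) every non-leaf vertex has at least one child that is a tree vertex or a leaf; (one-component) the unique child of every reticulation vertex is a leaf. Networks are considered up to isomorphism preserving leaf labels. $\mathsf{N}_n$ is uniform on the finite set of simplex tree-child networks with leaf label set $[n]$. Local neighbourhoods: for a directed graph $N$ and $v\in V(N)$, $U_R(N,v)$ is the subgraph induced by the vertices at undirected graph distance at most $R$ from $v$, rooted at $v$. Each vertex carries a mark giving its type in $N$ (root, tree vertex, reticulation, or leaf); leaf labels are ignored. $\cong$ denotes isomorphism of rooted directed marked graphs, i.e. a bijection of vertex sets preserving root, marks, edges and edge orientations. Local weak convergence $(N_n,v_n)\xrightarrow{d}(N,v)$ means $\mathbb{P}(U_R(N_n,v_n)\cong G)\to\mathbb{P}(U_R(N,v)\cong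 G)$ for every fixed $R\ge0$ and every finite rooted directed marked graph $G$; for deterministic $(N,v)$ this is $\mathbb{P}(U_R(N_n,v_n)\cong U_R(N,v))\to1$ for every $R\ge0$. Construction. A bi-infinite spine is a bi-infinite directed path $\cdots\to x_{ -1}\to x_0\to x_1\to\cdots$ of tree vertices. To decorate a tree vertex $x$ means: give $x$ a new reticulation child $\rho(x)$; give $\rho(x)$ a new leaf child $\ell(x)$; and give $\rho(x)$ a second parent $w(x)$, which is a tree vertex on a new bi-infinite spine, all of whose vertices other than $w(x)$ are in turn decorated, recursively (the reticulation child of $w(x)$ is $\rho(x)$). All spines and vertices introduced at every level are pairwise distinct. The decorated chain $\hat{\mathcal{L}}$ is a bi-infinite spine $\cdots\to p_{ -1}\to p_0\to p_1\to\cdots$ all of whose vertices are decorated; it is rooted at $p_0$. -}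

module Defs where

open import Data.Bool.Base using (Bool; T; if_then_else_)
open import Data.Fin.Base using (Fin)
import Data.Fin.Properties as Fin
open import Data.Integer.Base as ℤ using (ℤ; 0ℤ)
open import Data.Irrelevant using (Irrelevant)
open import Data.List.Base using (List; []; _∷_; allFin; filter; foldr; length; map)
open import Data.List.Relation.Unary.AllPairs using (AllPairs)
open import Data.List.Relation.Unary.Any using (Any)
open import Data.Nat.Base as ℕ using (ℕ; zero; suc)
open import Data.Product using (_×_; _,_; ∃; ∃-syntax; proj₁; proj₂)
open import Data.Rational as ℚ using (ℚ; 0ℚ; 1ℚ)
open import Data.Refinement using (Refinement-syntax; value; proof; _,_)
open import Data.Sum.Base using (_⊎_; inj₁; inj₂)
open import Data.Unit.Base using (⊤)
open import Data.Vec.Base using (Vec; []; _∷_; lookup; tabulate)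
open import Data.Vec.Properties using (lookup∘tabulate)
open import Function.Base using (_∘_)
open import Function.Bundles using (_⇔_; _↔_; Inverse; Equivalence; mk⇔; mk↔ₛ′)
open import Level using (0ℓ)
open import Relation.Binary.Construct.Closure.ReflexiveTransitive using (Star)
open import Relation.Binary.Construct.Closure.Transitive using (TransClosure)
open import Relation.Binary.Core using (Rel)
open import Relation.Binary.Definitions using (DecidableEquality)
open import Relation.Binary.PropositionalEquality
  using (_≡_; _≢_; refl; sym; trans; cong; subst; subst₂)
open import Relation.Nullary.Decidable
  using (Dec; yes; no; does; T?; map′; recompute; _×-dec_; _⊎-dec_; _→-dec_)
open import Relation.Nullary.Negation using (¬_)
open import Relation.Unary using (Pred; Decidable)

------------------------------------------------------------------------
-- Marked directed graphs

data Mark : Set where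
  root tree reticulation leaf : Mark

record MarkedGraph : Set₁ where
  field
    Vertex : Set
    Edge   : Rel Vertex 0ℓ
    mark   : Vertex → Mark

record RootedMarkedGraph : Set₁ where
  field
    graph : MarkedGraph
  open MarkedGraph graph public
  field
    base : Vertex

-- Up to isomorphism, every finite graph without parallel edges has a
-- vertex set of the form Fin order. Tree-child networks never have
-- parallel edges: their tail would have a reticulation as only child.
record FiniteGraph : Set where
  field
    order : ℕ
    adj   : Fin order → Fin order → Bool
    mark  : Fin order → Mark

  Edge : Rel (Fin order) 0ℓ
  Edge u v = T (adj u v)

  edge? : ∀ u v → Dec (Edge u v)
  edge? u v = T? (adj u v)

  indegree outdegree : Fin order → ℕ
  indegree  v = length (filter (λ u → edge? u v) (allFin order))
  outdegree v = length (filter (λ w → edge? v w) (allFin order))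

  ⟦_⟧ : MarkedGraph
  ⟦_⟧ = record { Vertex = Fin order ; Edge = Edge ; mark = mark }

record FiniteRootedGraph : Set where
  field
    graph : FiniteGraph
  open FiniteGraph graph public hiding (⟦_⟧)
  field
    base : Fin order

  ⟦_⟧ : RootedMarkedGraph
  ⟦_⟧ = record { graph = FiniteGraph.⟦ graph ⟧ ; base = base }

infix 4 _≅_

record _≅_ (G H : RootedMarkedGraph) : Set where
  private
    module G = RootedMarkedGraph G
    module H = RootedMarkedGraph H
  field
    bijection : G.Vertex ↔ H.Vertex
  open Inverse bijection public using (to; from)
  field
    base-preserved : to G.base ≡ H.base
    mark-preserved : ∀ u → H.mark (to u) ≡ G.mark u
    edge-preserved : ∀ u v → G.Edge u v ⇔ H.Edge (to u) (to v)

------------------------------------------------------------------------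
-- Local neighbourhoods

-- Within N r v u: some walk in the underlying undirected graph of N
-- joins v to u in at most r steps.
data Within (N : MarkedGraph) : ℕ → Rel (MarkedGraph.Vertex N) 0ℓ where
  here : ∀ {r v} → Within N r v v
  step : ∀ {r v u w} → Within N r v u →
         MarkedGraph.Edge N u w ⊎ MarkedGraph.Edge N w u →
         Within N (suc r) v w

-- The distance bound is a proof-irrelevant component, so that vertices
-- of the ball are equal as soon as they are equal in N.
U : ℕ → (N : MarkedGraph) → MarkedGraph.Vertex N → RootedMarkedGraph
U R N v = record
  { graph = record
    { Vertex = [ u ∈ N.Vertex ∣ Within N R v u ]
    ; Edge   = λ x y → N.Edge (value x) (value y)
    ; mark   = λ x → N.mark (value x)
    }
  ; base = v , Data.Irrelevant.[ here ]
  }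
  where module N = MarkedGraph N

-- For a finite graph the event U_R(N,v) ≅ G is decidable: all maps from
-- the vertices of G to those of N are tried.
anyVec? : ∀ {k m} {P : Pred (Vec (Fin k) m) 0ℓ} → Decidable P → Dec (∃ P)
anyVec? {m = zero}  P? = map′ ([] ,_) (λ { ([] , p) → p }) (P? [])
anyVec? {m = suc m} P? =
  map′ (λ { (x , xs , p) → x ∷ xs , p }) (λ { (x ∷ xs , p) → x , xs , p })
       (Fin.any? λ x → anyVec? λ xs → P? (x ∷ xs))

relevant : {P : Set} → Dec P → Irrelevant P → P
relevant P? Data.Irrelevant.[ p ] = recompute P? p

_≟ᴹ_ : DecidableEquality Mark
root         ≟ᴹ root         = yes refl
root         ≟ᴹ tree         = no λ ()
root         ≟ᴹ reticulation = no λ ()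
root         ≟ᴹ leaf         = no λ ()
tree         ≟ᴹ root         = no λ ()
tree         ≟ᴹ tree         = yes refl
tree         ≟ᴹ reticulation = no λ ()
tree         ≟ᴹ leaf         = no λ ()
reticulation ≟ᴹ root         = no λ ()
reticulation ≟ᴹ tree         = no λ ()
reticulation ≟ᴹ reticulation = yes refl
reticulation ≟ᴹ leaf         = no λ ()
leaf         ≟ᴹ root         = no λ ()
leaf         ≟ᴹ tree         = no λ ()
leaf         ≟ᴹ reticulation = no λ ()
leaf         ≟ᴹ leaf         = yes refl

module _ (N : FiniteGraph) where
  open FiniteGraph N

  within? : ∀ r v w → Dec (Within ⟦_⟧ r v w)
  within? zero    v w = map′ (λ { refl → here }) (λ { here → refl }) (v Fin.≟ w)
  within? (suc r) v w =
    map′ (λ { (inj₁ refl) → here ; (inj₂ (u , p , e)) → step p e })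
         (λ { here → inj₁ refl ; (step p e) → inj₂ (_ , p , e) })
         (v Fin.≟ w ⊎-dec
          Fin.any? λ u → within? r v u ×-dec (edge? u w ⊎-dec edge? w u))

module _ (N : FiniteGraph) (R : ℕ) (v : Fin (FiniteGraph.order N))
         (G : FiniteRootedGraph) where
  private
    module N = FiniteGraph N
    module G = FiniteRootedGraph G

  record Embedding (f : Fin G.order → Fin N.order) : Set where
    field
      inside    : ∀ i → Within N.⟦_⟧ R v (f i)
      covers    : ∀ u → Within N.⟦_⟧ R v u → ∃[ i ] f i ≡ u
      injective : ∀ i j → f i ≡ f j → i ≡ j
      bases     : f G.base ≡ v
      marks     : ∀ i → N.mark (f i) ≡ G.mark i
      edges     : ∀ i j → (N.Edge (f i) (f j) → G.Edge i j)
                        × (G.Edge i j → N.Edge (f i) (f j))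

  embedding? : ∀ f → Dec (Embedding f)
  embedding? f =
    map′ (λ { (a , b , c , d , e , g) → record
              { inside = a ; covers = b ; injective = c
              ; bases = d ; marks = e ; edges = g } })
         (λ x → let open Embedding x in
                inside , covers , injective , bases , marks , edges)
         ( Fin.all? (λ i → within? N R v (f i))
     ×-dec Fin.all? (λ u → within? N R v u →-dec Fin.any? (λ i → f i Fin.≟ u))
     ×-dec Fin.all? (λ i → Fin.all? λ j → (f i Fin.≟ f j) →-dec (i Fin.≟ j))
     ×-dec f G.base Fin.≟ v
     ×-dec Fin.all? (λ i → N.mark (f i) ≟ᴹ G.mark i)
     ×-dec Fin.all? (λ i → Fin.all? λ j →
             (N.edge? (f i) (f j) →-dec G.edge? i j) ×-dec
             (G.edge? i j →-dec N.edge? (f i) (f j))))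

  embedding⇒≅ : ∀ {f} → Embedding f → U R N.⟦_⟧ v ≅ G.⟦_⟧
  embedding⇒≅ {f} x = record
    { bijection      = mk↔ₛ′ to from
        (λ i → injective _ _ (f∘to (from i)))
        (λ y → ball-≡ (f∘to y))
    ; base-preserved = injective _ _ (trans (f∘to (RootedMarkedGraph.base (U R N.⟦_⟧ v))) (sym bases))
    ; mark-preserved = λ y → trans (sym (marks (to y))) (cong N.mark (f∘to y))
    ; edge-preserved = λ y z → mk⇔
        (λ e → proj₁ (edges (to y) (to z))
                 (subst₂ N.Edge (sym (f∘to y)) (sym (f∘to z)) e))
        (λ e → subst₂ N.Edge (f∘to y) (f∘to z) (proj₂ (edges (to y) (to z)) e))
    }
    where
    open Embedding x
    Ball : Set
    Ball = RootedMarkedGraph.Vertex (U R N.⟦_⟧ v)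
    preimage : (y : Ball) → ∃[ i ] f i ≡ value y
    preimage y = covers (value y)
      (relevant (within? N R v (value y)) (proof y))
    to : Ball → Fin G.order
    to y = proj₁ (preimage y)
    f∘to : ∀ y → f (to y) ≡ value y
    f∘to y = proj₂ (preimage y)
    from : Fin G.order → Ball
    from i = f i , Data.Irrelevant.[ inside i ]
    ball-≡ : {y z : Ball} → value y ≡ value z → y ≡ z
    ball-≡ refl = refl

  ≅⇒embedding : U R N.⟦_⟧ v ≅ G.⟦_⟧ →
                ∃[ xs ] Embedding (lookup {n = G.order} xs)
  ≅⇒embedding φ = tabulate f , record
    { inside    = λ i → subst (Within N.⟦_⟧ R v) (sym (f≗ i))
                          (relevant (within? N R v (f i)) (proof (from i)))
    ; covers    = λ u p → to (u , Data.Irrelevant.[ p ]) ,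
                          trans (f≗ _) (cong value (strictlyInverseʳ _))
    ; injective = λ i j eq → trans (sym (strictlyInverseˡ i))
        (trans (cong to (ball-≡ (trans (sym (f≗ i)) (trans eq (f≗ j)))))
               (strictlyInverseˡ j))
    ; bases     = trans (f≗ _) (cong value
        (trans (cong from (sym base-preserved)) (strictlyInverseʳ _)))
    ; marks     = λ i → trans (cong N.mark (f≗ i))
        (trans (sym (mark-preserved (from i))) (cong G.mark (strictlyInverseˡ i)))
    ; edges     = λ i j →
        (λ e → subst₂ G.Edge (strictlyInverseˡ i) (strictlyInverseˡ j)
           (Equivalence.to (edge-preserved (from i) (from j))
             (subst₂ N.Edge (f≗ i) (f≗ j) e))) ,
        (λ e → subst₂ N.Edge (sym (f≗ i)) (sym (f≗ j))
           (Equivalence.from (edge-preserved (from i) (from j))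
             (subst₂ G.Edge (sym (strictlyInverseˡ i)) (sym (strictlyInverseˡ j)) e)))
    }
    where
    open _≅_ φ
    open Inverse bijection using (strictlyInverseˡ; strictlyInverseʳ)
    f : Fin G.order → Fin N.order
    f i = value (from i)
    f≗ : ∀ i → lookup (tabulate f) i ≡ f i
    f≗ = lookup∘tabulate f
    ball-≡ : {y z : RootedMarkedGraph.Vertex (U R N.⟦_⟧ v)} →
             value y ≡ value z → y ≡ z
    ball-≡ refl = refl

U≅? : ∀ R (N : FiniteGraph) v (G : FiniteRootedGraph) →
      Dec (U R FiniteGraph.⟦ N ⟧ v ≅ FiniteRootedGraph.⟦ G ⟧)
U≅? R N v G =
  map′ (embedding⇒≅ N R v G ∘ proj₂) (≅⇒embedding N R v G)
       (anyVec? (embedding? N R v G ∘ lookup))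

------------------------------------------------------------------------
-- Simplex tree-child networks on the leaf label set Fin n

degrees : Mark → ℕ × ℕ
degrees root         = 0 , 1
degrees tree         = 1 , 2
degrees reticulation = 2 , 1
degrees leaf         = 1 , 0

record Network (n : ℕ) : Set where
  field
    graph : FiniteGraph
  open FiniteGraph graph public
  field
    origin        : Fin order
    labelled      : Fin n → Fin order

    -- Forces the mark of a vertex to be its type.
    degree        : ∀ v → (indegree v , outdegree v) ≡ degrees (mark v)

    root-mark     : ∀ v → mark v ≡ root ⇔ v ≡ origin
    leaf-mark     : ∀ v → mark v ≡ leaf ⇔ (∃[ i ] labelled i ≡ v)
    label-inj     : ∀ i j → labelled i ≡ labelled j → i ≡ j

    acyclic       : ∀ v → ¬ TransClosure Edge v v
    reachable     : ∀ v → Star Edge origin v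
    tree-child    : ∀ v → mark v ≢ leaf →
                    ∃[ w ] (Edge v w × (mark w ≡ tree ⊎ mark w ≡ leaf))
    one-component : ∀ v w → mark v ≡ reticulation → Edge v w → mark w ≡ leaf

infix 4 _≈_

record _≈_ {n : ℕ} (M N : Network n) : Set where
  private
    module M = Network M
    module N = Network N
  field
    bijection       : Fin M.order ↔ Fin N.order
  open Inverse bijection public using (to; from)
  field
    edge-preserved  : ∀ u v → M.Edge u v ⇔ N.Edge (to u) (to v)
    label-preserved : ∀ i → to (M.labelled i) ≡ N.labelled i

-- One representative for each isomorphism class of networks.
record Representatives (n : ℕ) : Set where
  field
    networks : List (Network n)
    complete : ∀ N → Any (N ≈_) networks
    distinct : AllPairs (λ M N → ¬ M ≈ N) networks

------------------------------------------------------------------------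
-- Probabilities and local weak convergence

-- The average over a nonempty list; the value at [] is irrelevant.
mean : List ℚ → ℚ
mean []          = 0ℚ
mean qs@(_ ∷ rs) = foldr ℚ._+_ 0ℚ qs ℚ.* (ℤ.+ 1 ℚ./ suc (length rs))

indicator : {P : Set} → Dec P → ℚ
indicator P? = if does P? then 1ℚ else 0ℚ

_orElse_ : {A : Set} → List A → A → List A
[]       orElse a = a ∷ []
(b ∷ bs) orElse a = b ∷ bs

treeVertices : ∀ {n} (N : Network n) → List (Fin (Network.order N))
treeVertices N = filter (λ v → Network.mark N v ≟ᴹ tree) (allFin (Network.order N))

-- ℙ (U_R(N,u) ≅ G), where N is a uniformly chosen representative and u a
-- uniformly chosen tree vertex of N, or default N if there is none.
ballProbability : ∀ {n} → Representatives n →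
                  ((N : Network n) → Fin (Network.order N)) →
                  ℕ → FiniteRootedGraph → ℚ
ballProbability reps default R G =
  mean (map (λ N → mean (map (λ u → indicator (U≅? R (Network.graph N) u G))
                             (treeVertices N orElse default N)))
            (Representatives.networks reps))

_⟶_ : (ℕ → ℚ) → ℚ → Set
a ⟶ q = ∀ ε → 0ℚ ℚ.< ε → ∃[ n₀ ] (∀ n → n₀ ℕ.≤ n → ℚ.∣ a n ℚ.- q ∣ ℚ.< ε)

-- Local weak convergence to a deterministic limit (L , v), for which
-- ℙ (U_R(L,v) ≅ G) is 1 or 0 according to whether U_R(L,v) ≅ G.
LocallyConverges : (ℕ → ℕ → FiniteRootedGraph → ℚ) →
                   (L : MarkedGraph) → MarkedGraph.Vertex L → Set
LocallyConverges prob L v = ∀ R G →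
  (U R L v ≅ FiniteRootedGraph.⟦ G ⟧ → (λ n → prob n R G) ⟶ 1ℚ) ×
  (¬ (U R L v ≅ FiniteRootedGraph.⟦ G ⟧) → (λ n → prob n R G) ⟶ 0ℚ)

------------------------------------------------------------------------
-- The decorated chain

-- A spine is either the main one, or the one created when position i of
-- the spine s is decorated; w is at position 0 of a created spine, which
-- is the only position not decorated in its turn.
data Spine : Set
Decorated : Spine → ℤ → Set

data Spine where
  main    : Spine
  created : (s : Spine) (i : ℤ) → .(Decorated s i) → Spine

Decorated main            i = ⊤
Decorated (created _ _ _) i = i ≢ 0ℤ

data ChainVertex : Set where
  node : Spine → ℤ → ChainVertex
  ρ    : (s : Spine) (i : ℤ) → .(Decorated s i) → ChainVertex
  ℓ    : (s : Spine) (i : ℤ) → .(Decorated s i) → ChainVertex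

data ChainEdge : Rel ChainVertex 0ℓ where
  next   : ∀ s i → ChainEdge (node s i) (node s (ℤ.suc i))
  node→ρ : ∀ s i .(d : Decorated s i) → ChainEdge (node s i) (ρ s i d)
  w→ρ    : ∀ s i .(d : Decorated s i) → ChainEdge (node (created s i d) 0ℤ) (ρ s i d)
  ρ→ℓ    : ∀ s i .(d : Decorated s i) → ChainEdge (ρ s i d) (ℓ s i d)

𝓛̂ : MarkedGraph
𝓛̂ = record
  { Vertex = ChainVertex
  ; Edge   = ChainEdge
  ; mark   = λ { (node _ _) → tree ; (ρ _ _ _) → reticulation ; (ℓ _ _ _) → leaf }
  }

p₀ : MarkedGraph.Vertex 𝓛̂
p₀ = node main 0ℤ

{-# OPTIONS --safe #-}

-- A vertex is special if it is the root, a branching tree vertex (one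
-- without reticulation child), a leaf below no reticulation, or a tree
-- vertex whose edge to its reticulation child lies on a short cycle. Away
-- from special vertices, walking down and up the tree vertices and crossing
-- reticulations unfolds the network into the decorated chain, and this is
-- injective because there are no short cycles. It remains to see that
-- special vertices are rare, by double counting over isomorphism classes;
-- here networks have no automorphisms.
--
-- Let v be branching with children y and z, and a a leaf below no
-- reticulation, say not below z. Hanging a under a new reticulation with
-- parents v and a new vertex w on the edge that led to a, and z under w,
-- yields a network with the same labels, from which v, a, z can be
-- recovered given w. If m leaves lie below no reticulation, then there are
-- m - 1 branching vertices, so the mean of m (m - 1) is at most that of the
-- number of tree vertices, and the mean of m is O(sqrt n).
--
-- If u lies on a short cycle through its reticulation child, it can be
-- suppressed and reinserted above any tree vertex. The old place of u is
-- still near the new one, so it is recovered from boundedly many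
-- candidates, and the mean number of such u is bounded.

module Submission where

open import Defs
open import Algebra.Bundles using (CommutativeMonoid)
import Algebra.Properties.CommutativeMonoid.Sum as Sum
import Algebra.Properties.CommutativeSemigroup as CommutativeSemigroupProperties
open import Data.Bool.Base using (Bool; true; false; T; if_then_else_)
open import Data.Empty using (⊥; ⊥-elim; ⊥-elim-irr)
open import Data.Fin.Base as Fin using (Fin; zero; suc; toℕ)
import Data.Fin.Induction as Finᵢ
import Data.Fin.Properties as Finₚ
open import Data.Integer.Base as ℤ using (ℤ; 0ℤ)
import Data.Integer.Properties as ℤₚ
import Data.Irrelevant
open import Data.List.Base as List using (List; []; _∷_; _++_; allFin; cartesianProduct; concatMap; deduplicate; filter; foldr; length; map; tabulate)
import Data.List.Properties as Listₚ
open import Data.List.Membership.Propositional using (_∈_; lose)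
open import Data.List.Membership.Propositional.Properties using (∈-++⁺ˡ; ∈-++⁺ʳ; ∈-++⁻; ∈-map⁺; ∈-map⁻; ∈-filter⁺; ∈-filter⁻; ∈-allFin; ∈-lookup; ∈-cartesianProduct⁺; ∈-cartesianProductWith⁺; ∈-upTo⁺)
open import Data.List.Relation.Unary.All as All using (All; []; _∷_)
open import Data.List.Relation.Unary.AllPairs using (AllPairs; []; _∷_)
open import Data.List.Relation.Unary.Any as Any using (Any; here; there)
import Data.List.Relation.Unary.Any.Properties as Anyₚ
open import Data.List.Relation.Unary.Unique.Propositional using (Unique)
import Data.List.Relation.Unary.Unique.Propositional.Properties as Uniqueₚ
import Data.List.Relation.Unary.Unique.DecSetoid.Properties as UniqueDecₚ
open import Data.Nat.Base as ℕ using (ℕ; zero; suc; _+_; _*_; _∸_; _^_; _≤_; _<_; z≤n; s≤s; NonZero)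
open import Data.Nat.Induction using (<-rec)
import Data.Nat.ListAction as ListAction
import Data.Nat.Properties as ℕₚ
open import Data.Nat.Tactic.RingSolver using (solve-∀)
open import Data.Product using (_×_; _,_; Σ; ∃; ∃-syntax; Σ-syntax; proj₁; proj₂)
open import Data.Rational as ℚ using (ℚ; 0ℚ; 1ℚ)
import Data.Rational.Properties as ℚₚ
import Data.Rational.Unnormalised as ℚᵘ
import Data.Rational.Unnormalised.Properties as ℚᵘₚ
open import Data.Refinement using (value; proof; _,_)
open import Data.Sum.Base using (_⊎_; inj₁; inj₂; [_,_]′)
open import Data.Unit.Base using (tt)
open import Data.Vec.Base as Vec using (Vec; []; _∷_; lookup)
import Data.Vec.Properties as Vecₚ
open import Function.Base using (_∘_; id; flip; case_of_)
open import Function.Bundles using (_⇔_; Inverse; Equivalence; mk⇔; mk↔ₛ′)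
open import Induction.WellFounded using (WellFounded; module All)
open import Level using (0ℓ)
open import Relation.Binary.Bundles using (DecSetoid)
open import Relation.Binary.Construct.Closure.ReflexiveTransitive as Star using (Star; ε; _◅_; _◅◅_)
open import Relation.Binary.Construct.Closure.Transitive as Plus using (TransClosure; [_]; _∷_; _∷ʳ_)
open import Relation.Binary.Core using (Rel)
open import Relation.Binary.PropositionalEquality
open import Relation.Binary.Definitions using (tri<; tri≈; tri>)
open import Relation.Binary.Structures using (IsStrictPartialOrder)
open import Relation.Nullary.Decidable using (Dec; yes; no; does; map′; _×-dec_; _⊎-dec_; _→-dec_; ¬?; dec-true; dec-false; decidable-stable; toWitness)
open import Relation.Nullary.Negation using (¬_; contradiction)
open import Relation.Unary using (Pred; Decidable)
open Sum ℕₚ.+-0-commutativeMonoid using (sum; ∑-comm; sum-cong-≗; ∑-distrib-+)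

-- No asymptotic enumeration is needed: both estimates compare two sums over the same classes, with
-- the same n, through an injection. The obstacle is that a class has no vertices of its own. A
-- source is therefore a class with vertices of its representative, and the modified network is
-- identified only up to isomorphism. Injectivity is proved by turning an isomorphism between two
-- modified networks into one between the original networks; distinctness of the representatives
-- then identifies the classes, and only after that can vertices be compared. Cycles need control
-- only at edges into reticulations: a cycle of the underlying graph cannot be directed, so some
-- vertex of it is entered twice, and only reticulations have two parents. No square root occurs in
-- the computation. For a fixed weight s the bound s m ≤ s² + m (m - 1) makes the mean of m at most
-- s + 2 n / s, and a large constant s beats any given precision relative to the at least n - 1 tree
-- vertices.

variable
  n r : ℕ
  A B : Set

-- Finite counting

∈-remove : {y : B} {ys : List B} → y ∈ ys →
           ∃[ zs ] (length ys ≡ suc (length zs) × (∀ {z} → z ∈ ys → z ≢ y → z ∈ zs))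
∈-remove {ys = y ∷ ys} (here refl) = ys , refl , λ
  { (here refl) z≢y → contradiction refl z≢y ; (there z∈) _ → z∈ }
∈-remove {ys = y ∷ ys} (there p) with ∈-remove p
... | zs , eq , keep = y ∷ zs , cong suc eq , λ
  { (here refl) _ → here refl ; (there z∈) z≢ → there (keep z∈ z≢) }

-- `H` is a relation because the applications pair a source with images of vertices under some
-- isomorphism to a representative, and such isomorphisms enter only as witnesses.
length-injection : {xs : List A} (ys : List B) (H : A → B → Set) → Unique xs →
  (∀ {x} → x ∈ xs → ∃[ y ] (y ∈ ys × H x y)) →
  (∀ {x x′ y} → x ∈ xs → x′ ∈ xs → H x y → H x′ y → x ≡ x′) →
  length xs ≤ length ys
length-injection {xs = []} ys H _ total inj = z≤n
length-injection {xs = x ∷ xs} ys H (x∉ ∷ u) total inj with total (here refl)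
... | y , y∈ , h with ∈-remove y∈
... | zs , eq , keep rewrite eq = s≤s (length-injection zs H u total′
        (λ p q → inj (there p) (there q)))
  where
  total′ : ∀ {x} → x ∈ xs → ∃[ y ] (y ∈ zs × H x y)
  total′ p with total (there p)
  ... | y′ , y′∈ , h′ = y′ , keep y′∈ (λ { refl →
    All.lookup x∉ p (inj (here refl) (there p) h h′) }) , h′

length-⊆ : {xs ys : List A} → Unique xs → (∀ {x} → x ∈ xs → x ∈ ys) → length xs ≤ length ys
length-⊆ {ys = ys} u sub = length-injection ys _≡_ u (λ p → _ , sub p , refl) (λ { _ _ refl refl → refl })

-- The type of vertices depends on the network, so configurations over all classes are dependent
-- pairs, nested once more for pairs of vertices.
tagged : {A : Fin r → Set} → (∀ i → List (A i)) → List (Σ (Fin r) A)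
tagged {r = zero}  X = []
tagged {r = suc r} X = map (zero ,_) (X zero) ++ map (λ (i , x) → suc i , x) (tagged (λ i → X (suc i)))

length-tagged : {A : Fin r → Set} (X : ∀ i → List (A i)) → length (tagged X) ≡ sum (λ i → length (X i))
length-tagged {r = zero}  X = refl
length-tagged {r = suc r} X = trans (Listₚ.length-++ (map (zero ,_) (X zero)))
  (cong₂ _+_ (Listₚ.length-map _ (X zero)) (trans (Listₚ.length-map _ (tagged (λ i → X (suc i)))) (length-tagged (λ i → X (suc i)))))

∈-tagged⁺ : {A : Fin r → Set} (X : ∀ i → List (A i)) → ∀ i {x} → x ∈ X i → (i , x) ∈ tagged X
∈-tagged⁺ X zero    p = ∈-++⁺ˡ (∈-map⁺ _ p)
∈-tagged⁺ X (suc i) p = ∈-++⁺ʳ (map (zero ,_) (X zero)) (∈-map⁺ _ (∈-tagged⁺ (λ i → X (suc i)) i p))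

∈-tagged⁻ : {A : Fin r → Set} (X : ∀ i → List (A i)) → ∀ {i x} → (i , x) ∈ tagged X → x ∈ X i
∈-tagged⁻ {r = suc r} X p with ∈-++⁻ (map (zero ,_) (X zero)) p
... | inj₁ q with ∈-map⁻ _ q
...   | _ , x∈ , refl = x∈
∈-tagged⁻ {r = suc r} X p | inj₂ q with ∈-map⁻ _ q
...   | _ , x∈ , refl = ∈-tagged⁻ (λ i → X (suc i)) x∈

tagged-unique : {A : Fin r → Set} (X : ∀ i → List (A i)) → (∀ i → Unique (X i)) → Unique (tagged X)
tagged-unique {r = zero}  X u = []
tagged-unique {r = suc r} X u = Uniqueₚ.++⁺ (Uniqueₚ.map⁺ (λ { refl → refl }) (u zero))
  (Uniqueₚ.map⁺ (λ { refl → refl }) (tagged-unique _ (λ i → u (suc i))))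
  λ (p , q) → disjoint (∈-map⁻ _ p) (∈-map⁻ _ q)
  where
  disjoint : ∀ {v} → ∃[ x ] (x ∈ X zero × v ≡ (zero , x)) →
    ∃[ y ] (y ∈ tagged (λ i → X (suc i)) × v ≡ (suc (proj₁ y) , proj₂ y)) → ⊥
  disjoint (_ , _ , refl) (_ , _ , ())

sum-mono : {f g : Fin n → ℕ} → (∀ i → f i ≤ g i) → sum f ≤ sum g
sum-mono {n = zero}  le = z≤n
sum-mono {n = suc n} le = ℕₚ.+-mono-≤ (le zero) (sum-mono (λ i → le (suc i)))

sum-const : ∀ n c → sum {n} (λ _ → c) ≡ n * c
sum-const zero    c = refl
sum-const (suc n) c = cong (c +_) (sum-const n c)

sum-scale : ∀ c (f : Fin n → ℕ) → sum (λ i → c * f i) ≡ c * sum f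
sum-scale {n = zero}  c f = sym (ℕₚ.*-zeroʳ c)
sum-scale {n = suc n} c f = trans (cong (c * f zero +_) (sum-scale c (f ∘ suc))) (sym (ℕₚ.*-distribˡ-+ c (f zero) _))

select : {P : Pred (Fin n) 0ℓ} → Decidable P → List (Fin n)
select P? = filter P? (allFin _)

count : {P : Pred (Fin n) 0ℓ} → Decidable P → ℕ
count P? = length (select P?)

module _ {P : Pred (Fin n) 0ℓ} (P? : Decidable P) where

  ∈-select⁺ : ∀ {x} → P x → x ∈ select P?
  ∈-select⁺ {x} p = ∈-filter⁺ P? (∈-allFin x) p

  ∈-select⁻ : ∀ {x} → x ∈ select P? → P x
  ∈-select⁻ p = proj₂ (∈-filter⁻ P? {xs = allFin n} p)

  select-unique : Unique (select P?)
  select-unique = Uniqueₚ.filter⁺ P? (Uniqueₚ.allFin⁺ n)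

bit : {P : Set} → Dec P → ℕ
bit P? = if does P? then 1 else 0

count-sum : {P : Pred (Fin n) 0ℓ} (P? : Decidable P) → count P? ≡ sum (λ i → bit (P? i))
count-sum {P = P} P? = go _ id
  where
  go : ∀ k (f : Fin k → Fin _) → length (filter P? (tabulate f)) ≡ sum (λ i → bit (P? (f i)))
  go zero    f = refl
  go (suc k) f with does (P? (f zero))
  ... | true  = cong suc (go k (f ∘ suc))
  ... | false = go k (f ∘ suc)

bit-yes : {P : Set} (d : Dec P) → P → bit d ≡ 1
bit-yes d p = cong (λ b → if b then 1 else 0) (dec-true d p)

bit-no : {P : Set} (d : Dec P) → ¬ P → bit d ≡ 0
bit-no d p = cong (λ b → if b then 1 else 0) (dec-false d p)

double-count : ∀ {m n} {H : Fin m → Fin n → Set} (H? : ∀ u v → Dec (H u v)) →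
  sum (λ u → count (H? u)) ≡ sum (λ v → count (λ u → H? u v))
double-count {m} {n} H? = begin
  sum (λ u → count (H? u))                 ≡⟨ sum-cong-≗ {m} (λ u → count-sum (H? u)) ⟩
  sum (λ u → sum (λ v → bit (H? u v)))      ≡⟨ ∑-comm {m} {n} (λ u v → bit (H? u v)) ⟩
  sum (λ v → sum (λ u → bit (H? u v)))      ≡⟨ sum-cong-≗ {n} (λ v → sym (count-sum (λ u → H? u v))) ⟩
  sum (λ v → count (λ u → H? u v))         ∎
  where open ≡-Reasoning

count-mono : {P Q : Pred (Fin n) 0ℓ} (P? : Decidable P) (Q? : Decidable Q) →
  (∀ {x} → P x → Q x) → count P? ≤ count Q?
count-mono P? Q? sub = length-⊆ (select-unique P?) (λ p → ∈-select⁺ Q? (sub (∈-select⁻ P? p)))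

count-split : {P Q S : Pred (Fin n) 0ℓ} (P? : Decidable P) (Q? : Decidable Q) (S? : Decidable S) →
  (∀ {x} → P x → Q x ⊎ S x) → count P? ≤ count Q? + count S?
count-split P? Q? S? f = ℕₚ.≤-trans
  (length-⊆ {ys = select Q? ++ select S?} (select-unique P?) λ p → [ (λ q → ∈-++⁺ˡ (∈-select⁺ Q? q)) , (λ s → ∈-++⁺ʳ (select Q?) (∈-select⁺ S? s)) ]′ (f (∈-select⁻ P? p)))
  (ℕₚ.≤-reflexive (Listₚ.length-++ (select Q?)))

-- Degrees in a network are at most two. In terms of witnesses, degree conditions can be carried
-- along bijections and yield named parents and children.
Exactly : ℕ → (A → Set) → Set
Exactly 0 P = ∀ x → ¬ P x
Exactly 1 P = ∃[ a ] (P a × (∀ x → P x → x ≡ a))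
Exactly 2 P = ∃[ a ] ∃[ b ] (a ≢ b × P a × P b × (∀ x → P x → x ≡ a ⊎ x ≡ b))
Exactly _ P = ⊥

count≤2⇒exactly : {P : Pred (Fin n) 0ℓ} (P? : Decidable P) → ∀ k → k ≤ 2 → count P? ≡ k → Exactly k P
count≤2⇒exactly P? k k≤2 eq with select P? | ∈-select⁺ P? | ∈-select⁻ P? | select-unique P?
count≤2⇒exactly P? k k≤2 refl | [] | intro | elim | u = λ x p → case intro p of λ ()
count≤2⇒exactly P? k k≤2 refl | a ∷ [] | intro | elim | u =
  a , elim (here refl) , λ x p → case intro p of λ { (here e) → e }
count≤2⇒exactly P? k k≤2 refl | a ∷ b ∷ [] | intro | elim | (a≢ ∷ _) ∷ u =
  a , b , a≢ , elim (here refl) , elim (there (here refl)) , λ x p → case intro p of λ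
    { (here e) → inj₁ e ; (there (here e)) → inj₂ e }
count≤2⇒exactly P? k (s≤s (s≤s ())) refl | a ∷ b ∷ c ∷ xs | intro | elim | u

exactly⇒count : {P : Pred (Fin n) 0ℓ} (P? : Decidable P) → ∀ k → Exactly k P → count P? ≡ k
exactly⇒count {P = P} P? = go
  where
  via : ∀ xs → Unique xs → (∀ {x} → x ∈ xs → P x) → (∀ {x} → P x → x ∈ xs) → count P? ≡ length xs
  via xs u to from = ℕₚ.≤-antisym (length-⊆ (select-unique P?) (λ p → from (∈-select⁻ P? p)))
    (length-⊆ u (λ p → ∈-select⁺ P? (to p)))
  go : ∀ k → Exactly k P → count P? ≡ k
  go 0 none = via [] [] (λ ()) (λ {x} p → ⊥-elim (none x p))
  go 1 (a , pa , only) = via (a ∷ []) ([] ∷ []) (λ { (here refl) → pa }) (λ {x} p → here (only x p))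
  go 2 (a , b , a≢b , pa , pb , only) = via (a ∷ b ∷ []) ((a≢b ∷ []) ∷ [] ∷ [])
    (λ { (here refl) → pa ; (there (here refl)) → pb })
    (λ {x} p → case only x p of λ { (inj₁ e) → here e ; (inj₂ e) → there (here e) })

exactly-map : {P : A → Set} {Q : B → Set} (f : A → B) (g : B → A) → (∀ x → g (f x) ≡ x) → (∀ y → f (g y) ≡ y) →
  (∀ x → P x → Q (f x)) → (∀ y → Q y → P (g y)) → ∀ k → Exactly k P → Exactly k Q
exactly-map f g gf fg to from 0 none = λ y q → none (g y) (from y q)
exactly-map f g gf fg to from 1 (a , pa , only) = f a , to a pa , λ y q → trans (sym (fg y)) (cong f (only (g y) (from y q)))
exactly-map f g gf fg to from 2 (a , b , a≢b , pa , pb , only) =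
  f a , f b , (λ e → a≢b (trans (sym (gf a)) (trans (cong g e) (gf b)))) , to a pa , to b pb , λ y q →
  case only (g y) (from y q) of λ
    { (inj₁ e) → inj₁ (trans (sym (fg y)) (cong f e)) ; (inj₂ e) → inj₂ (trans (sym (fg y)) (cong f e)) }

exactly-≐ : {P Q : A → Set} → (∀ x → P x → Q x) → (∀ x → Q x → P x) → ∀ k → Exactly k P → Exactly k Q
exactly-≐ = exactly-map id id (λ _ → refl) (λ _ → refl)

-- Decidability of reachability

-- Via k u v: a nonempty walk from u to v whose interior vertices are
-- numbered below k (Floyd and Warshall).
module FloydWarshall {n : ℕ} {E : Rel (Fin n) 0ℓ} (E? : ∀ u v → Dec (E u v)) where

  Via : ∀ k → k ≤ n → Rel (Fin n) 0ℓ
  Via zero    _  u v = E u v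
  Via (suc k) lt u v = Via k (ℕₚ.<⇒≤ lt) u v ⊎
    (Via k (ℕₚ.<⇒≤ lt) u (Fin.fromℕ< lt) × Via k (ℕₚ.<⇒≤ lt) (Fin.fromℕ< lt) v)

  via? : ∀ k (le : k ≤ n) u v → Dec (Via k le u v)
  via? zero    le u v = E? u v
  via? (suc k) lt u v = via? k _ u v ⊎-dec (via? k _ u _ ×-dec via? k _ _ v)

  via-sound : ∀ k (le : k ≤ n) {u v} → Via k le u v → TransClosure E u v
  via-sound zero    le e = [ e ]
  via-sound (suc k) le (inj₁ p) = via-sound k _ p
  via-sound (suc k) le (inj₂ (p , q)) = via-sound k _ p Plus.++ via-sound k _ q

  to-pivot : ∀ k (lt : k < n) {u} → Via (suc k) lt u (Fin.fromℕ< lt) → Via k (ℕₚ.<⇒≤ lt) u (Fin.fromℕ< lt)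
  to-pivot k lt (inj₁ p) = p
  to-pivot k lt (inj₂ (p , _)) = p

  from-pivot : ∀ k (lt : k < n) {v} → Via (suc k) lt (Fin.fromℕ< lt) v → Via k (ℕₚ.<⇒≤ lt) (Fin.fromℕ< lt) v
  from-pivot k lt (inj₁ p) = p
  from-pivot k lt (inj₂ (_ , q)) = q

  via-trans : ∀ k (le : k ≤ n) {u m v} → toℕ m < k → Via k le u m → Via k le m v → Via k le u v
  via-trans (suc k) lt {u} {m} {v} (s≤s m≤k) p q with Finₚ._≟_ m (Fin.fromℕ< lt)
  ... | yes refl = inj₂ (to-pivot k lt p , from-pivot k lt q)
  ... | no m≢ = combine p q
    where
    m<k : toℕ m < k
    m<k = ℕₚ.≤∧≢⇒< m≤k (λ e → m≢ (Finₚ.toℕ-injective (trans e (sym (Finₚ.toℕ-fromℕ< lt)))))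
    combine : Via (suc k) lt u m → Via (suc k) lt m v → Via (suc k) lt u v
    combine (inj₁ p) (inj₁ q) = inj₁ (via-trans k _ m<k p q)
    combine (inj₁ p) (inj₂ (q , q′)) = inj₂ (via-trans k _ m<k p q , q′)
    combine (inj₂ (p , p′)) (inj₁ q) = inj₂ (p , via-trans k _ m<k p′ q)
    -- Both walks visit the pivot, and the closed walk between the two visits is dropped.
    combine (inj₂ (p , p′)) (inj₂ (q , q′)) = inj₂ (p , q′)

  via-weaken : ∀ k (le : k ≤ n) {u v} → E u v → Via k le u v
  via-weaken zero    le e = e
  via-weaken (suc k) le e = inj₁ (via-weaken k _ e)

  via-complete : ∀ {u v} → TransClosure E u v → Via n ℕₚ.≤-refl u v
  via-complete [ e ] = via-weaken n _ e
  via-complete (e ∷ p) = via-trans n ℕₚ.≤-refl (Finₚ.toℕ<n _) (via-weaken n _ e) (via-complete p)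

  plus? : ∀ u v → Dec (TransClosure E u v)
  plus? u v = map′ (via-sound n _) via-complete (via? n ℕₚ.≤-refl u v)

star⇒plus : {E : Rel A 0ℓ} {u v : A} → Star E u v → u ≡ v ⊎ TransClosure E u v
star⇒plus ε = inj₁ refl
star⇒plus (e ◅ p) with star⇒plus p
... | inj₁ refl = inj₂ [ e ]
... | inj₂ q = inj₂ (e ∷ q)

plus⇒star : {E : Rel A 0ℓ} {u v : A} → TransClosure E u v → Star E u v
plus⇒star [ e ] = e ◅ ε
plus⇒star (e ∷ p) = e ◅ plus⇒star p

star? : {E : Rel (Fin n) 0ℓ} → (∀ u v → Dec (E u v)) → ∀ u v → Dec (Star E u v)
star? E? u v = map′ (λ { (inj₁ refl) → ε ; (inj₂ p) → plus⇒star p }) star⇒plus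
  (u Finₚ.≟ v ⊎-dec FloydWarshall.plus? E? u v)

-- Elementary structure of networks

Plain : Mark → Set
Plain m = m ≡ tree ⊎ m ≡ leaf

plain? : ∀ m → Dec (Plain m)
plain? m = m ≟ᴹ tree ⊎-dec m ≟ᴹ leaf

plain-indegree : ∀ {m} → Plain m → proj₁ (degrees m) ≡ 1
plain-indegree (inj₁ refl) = refl
plain-indegree (inj₂ refl) = refl

indegree-bound : ∀ m → proj₁ (degrees m) ≤ 2
indegree-bound root         = z≤n
indegree-bound tree         = s≤s z≤n
indegree-bound reticulation = s≤s (s≤s z≤n)
indegree-bound leaf         = s≤s z≤n

outdegree-bound : ∀ m → proj₂ (degrees m) ≤ 2
outdegree-bound root         = s≤s z≤n
outdegree-bound tree         = s≤s (s≤s z≤n)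
outdegree-bound reticulation = s≤s z≤n
outdegree-bound leaf         = z≤n

plus-last : {E : Rel A 0ℓ} {u v : A} → TransClosure E u v → ∃[ q ] (Star E u q × E q v)
plus-last [ e ] = _ , ε , e
plus-last (e ∷ p) with plus-last p
... | q , s , e′ = q , e ◅ s , e′

star-edge : {E : Rel A 0ℓ} {u v w : A} → Star E u v → E v w → TransClosure E u w
star-edge ε e = [ e ]
star-edge (e′ ◅ s) e = e′ ∷ star-edge s e

count-+ : {P Q S : Pred (Fin n) 0ℓ} (P? : Decidable P) (Q? : Decidable Q) (S? : Decidable S) →
  (∀ x → bit (P? x) ≡ bit (Q? x) + bit (S? x)) → count P? ≡ count Q? + count S?
count-+ P? Q? S? eq = trans (count-sum P?) (trans (trans (sum-cong-≗ eq) (∑-distrib-+ (λ x → bit (Q? x)) (λ x → bit (S? x))))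
  (sym (cong₂ _+_ (count-sum Q?) (count-sum S?))))

module Structure {n : ℕ} (N : Network n) where
  open Network N public

  V : Set
  V = Fin order

  in-degree : ∀ v → Exactly (proj₁ (degrees (mark v))) (λ u → Edge u v)
  in-degree v = count≤2⇒exactly (λ u → edge? u v) _ (indegree-bound (mark v)) (cong proj₁ (degree v))

  out-degree : ∀ v → Exactly (proj₂ (degrees (mark v))) (λ w → Edge v w)
  out-degree v = count≤2⇒exactly (λ w → edge? v w) _ (outdegree-bound (mark v)) (cong proj₂ (degree v))

  parent-unique : ∀ {p q v} → Plain (mark v) → Edge p v → Edge q v → p ≡ q
  parent-unique {p} {q} {v} pl e f with subst (λ k → Exactly k (λ u → Edge u v)) (plain-indegree pl) (in-degree v)
  ... | _ , _ , only = trans (only p e) (sym (only q f))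

  target-not-root : ∀ {p v} → Edge p v → mark v ≢ root
  target-not-root {p} {v} e eq = subst (λ m → Exactly (proj₁ (degrees m)) _) eq (in-degree v) p e

  no-parent : ∀ {p v} → Edge p v → v ≢ origin
  no-parent e eq = target-not-root e (Equivalence.from (root-mark _) eq)

  leaf-no-child : ∀ {v w} → mark v ≡ leaf → ¬ Edge v w
  leaf-no-child {v} {w} eq = subst (λ m → Exactly (proj₂ (degrees m)) _) eq (out-degree v) w

  parent-exists : ∀ v → v ≢ origin → ∃[ p ] Edge p v
  parent-exists v v≢ with mark v in eq | in-degree v
  ... | root | _ = contradiction (Equivalence.to (root-mark v) eq) v≢
  ... | tree | p , e , _ = p , e
  ... | reticulation | p , _ , _ , e , _ = p , e
  ... | leaf | p , e , _ = p , e

  reticulation-parents : ∀ v → mark v ≡ reticulation → Exactly 2 (λ p → Edge p v)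
  reticulation-parents v eq = subst (λ m → Exactly (proj₁ (degrees m)) _) eq (in-degree v)

  root-child : ∀ {v} → mark v ≡ root → ∀ {w w′} → Edge v w → Edge v w′ → w ≡ w′
  root-child {v} eq {w} {w′} e f with subst (λ m → Exactly (proj₂ (degrees m)) _) eq (out-degree v)
  ... | _ , _ , only = trans (only w e) (sym (only w′ f))

  reticulation-child : ∀ v → mark v ≡ reticulation → Exactly 1 (λ w → Edge v w)
  reticulation-child v eq = subst (λ m → Exactly (proj₂ (degrees m)) _) eq (out-degree v)

  tree-children : ∀ v → mark v ≡ tree → Exactly 2 (λ w → Edge v w)
  tree-children v eq = subst (λ m → Exactly (proj₂ (degrees m)) _) eq (out-degree v)

  reticulation-not-plain : ∀ {m} → m ≡ reticulation → ¬ Plain m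
  reticulation-not-plain refl (inj₁ ())
  reticulation-not-plain refl (inj₂ ())

  reticulation-parent-tree : ∀ {p v} → Edge p v → mark v ≡ reticulation → mark p ≡ tree
  reticulation-parent-tree {p} {v} e eq with mark p in eqp
  ... | tree = refl
  ... | leaf = contradiction e (leaf-no-child eqp)
  ... | reticulation = case trans (sym eq) (one-component p v eqp e) of λ ()
  ... | root with tree-child p (λ e′ → case trans (sym eqp) e′ of λ ())
  ...   | w , f , pl = contradiction (subst (Plain ∘ mark) (root-child eqp f e) pl) (reticulation-not-plain eq)

  two-children : ∀ {v} → mark v ≡ tree → ∀ {a b c} → a ≢ b → Edge v a → Edge v b → Edge v c → c ≡ a ⊎ c ≡ b
  two-children {v} eq {a} {b} {c} a≢b ea eb ec with tree-children v eq
  ... | x , y , _ , _ , _ , only with only a ea | only b eb | only c ec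
  ... | inj₁ p | inj₁ q | _ = contradiction (trans p (sym q)) a≢b
  ... | inj₂ p | inj₂ q | _ = contradiction (trans p (sym q)) a≢b
  ... | inj₁ p | inj₂ q | inj₁ s = inj₁ (trans s (sym p))
  ... | inj₁ p | inj₂ q | inj₂ s = inj₂ (trans s (sym q))
  ... | inj₂ p | inj₁ q | inj₁ s = inj₂ (trans s (sym q))
  ... | inj₂ p | inj₁ q | inj₂ s = inj₁ (trans s (sym p))

  mark-≢ : ∀ {u v} → Plain (mark u) → mark v ≡ reticulation → u ≢ v
  mark-≢ pl eq refl = reticulation-not-plain eq pl

  -- A parent of a reticulation is a tree vertex, and the reticulation takes up one of its two
  -- children.
  plain-child-unique : ∀ {v ϱ} → Edge v ϱ → mark ϱ ≡ reticulation →
    ∀ {a b} → Edge v a → Edge v b → Plain (mark a) → Plain (mark b) → a ≡ b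
  plain-child-unique e eq ea eb pa pb
    with two-children (reticulation-parent-tree e eq) (mark-≢ pa eq) ea e eb
  ... | inj₁ b≡a = sym b≡a
  ... | inj₂ b≡ϱ = contradiction b≡ϱ (mark-≢ pb eq)

  not-leaf : ∀ {v w} → Edge v w → mark v ≢ leaf
  not-leaf e eq = leaf-no-child eq e

  -- By the tree-child condition one of the two children of `v` is plain.
  reticulation-unique : ∀ {v ϱ σ} → Edge v ϱ → Edge v σ → mark ϱ ≡ reticulation → mark σ ≡ reticulation → ϱ ≡ σ
  reticulation-unique {v} e f eq eq′ with tree-child v (not-leaf e)
  ... | y , ey , py with two-children (reticulation-parent-tree e eq) (mark-≢ py eq) ey e f
  ...   | inj₁ σ≡y = contradiction (sym σ≡y) (mark-≢ py eq′)
  ...   | inj₂ σ≡ϱ = sym σ≡ϱ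

  plain-or-reticulation : ∀ {p v} → Edge p v → Plain (mark v) ⊎ mark v ≡ reticulation
  plain-or-reticulation {p} {v} e with mark v in eq
  ... | root = contradiction eq (target-not-root e)
  ... | tree = inj₁ (inj₁ refl)
  ... | leaf = inj₁ (inj₂ refl)
  ... | reticulation = inj₂ refl

  -- Vertex counts

  Reticulated : Pred V 0ℓ
  Reticulated v = ∃[ ϱ ] (Edge v ϱ × mark ϱ ≡ reticulation)

  reticulated? : Decidable Reticulated
  reticulated? v = Finₚ.any? λ ϱ → edge? v ϱ ×-dec mark ϱ ≟ᴹ reticulation

  Branching : Pred V 0ℓ
  Branching v = mark v ≡ tree × ¬ Reticulated v

  branching? : Decidable Branching
  branching? v = mark v ≟ᴹ tree ×-dec ¬? (reticulated? v)

  HasReticulationParent : Pred V 0ℓ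
  HasReticulationParent v = ∃[ ϱ ] (Edge ϱ v × mark ϱ ≡ reticulation)

  reticulationParent? : Decidable HasReticulationParent
  reticulationParent? v = Finₚ.any? λ ϱ → edge? ϱ v ×-dec mark ϱ ≟ᴹ reticulation

  FreeLeaf : Pred V 0ℓ
  FreeLeaf v = mark v ≡ leaf × ¬ HasReticulationParent v

  freeLeaf? : Decidable FreeLeaf
  freeLeaf? v = mark v ≟ᴹ leaf ×-dec ¬? (reticulationParent? v)

  of-mark? : ∀ m → Decidable (λ v → mark v ≡ m)
  of-mark? m v = mark v ≟ᴹ m

  #tree #reticulation #leaf #branching #freeLeaf : ℕ
  #tree = count (of-mark? tree)
  #reticulation = count (of-mark? reticulation)
  #leaf = count (of-mark? leaf)
  #branching = count branching?
  #freeLeaf = count freeLeaf?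

  #root≡1 : count (of-mark? root) ≡ 1
  #root≡1 = exactly⇒count (of-mark? root) 1
    (origin , Equivalence.from (root-mark origin) refl , λ v eq → Equivalence.to (root-mark v) eq)

  #leaf≡n : #leaf ≡ n
  #leaf≡n = ℕₚ.≤-antisym
    (ℕₚ.≤-trans (length-injection (allFin n) (λ v i → labelled i ≡ v) (select-unique (of-mark? leaf))
      (λ p → case Equivalence.to (leaf-mark _) (∈-select⁻ (of-mark? leaf) p) of λ (i , eq) → i , ∈-allFin i , eq)
      (λ _ _ e e′ → trans (sym e) e′)) (ℕₚ.≤-reflexive length-allFin))
    (ℕₚ.≤-trans (ℕₚ.≤-reflexive (sym length-allFin))
      (length-injection (select (of-mark? leaf)) (λ i v → labelled i ≡ v) (Uniqueₚ.allFin⁺ n)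
      (λ {i} _ → labelled i , ∈-select⁺ (of-mark? leaf) (Equivalence.from (leaf-mark _) (i , refl)) , refl)
      (λ _ _ e e′ → label-inj _ _ (trans e (sym e′)))))
    where
    length-allFin : length (allFin n) ≡ n
    length-allFin = Listₚ.length-tabulate {n = n} id

  reticulated-plus-branching : #tree ≡ count reticulated? + #branching
  reticulated-plus-branching = count-+ (of-mark? tree) reticulated? branching? eq
    where
    eq : ∀ v → bit (of-mark? tree v) ≡ bit (reticulated? v) + bit (branching? v)
    eq v with reticulated? v
    ... | yes w@(_ , e , m) = trans (bit-yes (of-mark? tree v) (reticulation-parent-tree e m))
      (sym (cong suc (bit-no (of-mark? tree v ×-dec ¬? (yes w)) λ (_ , ¬r) → ¬r w)))
    ... | no ¬r with mark v ≟ᴹ tree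
    ...   | yes _ = refl
    ...   | no  _ = refl

  -- The edges into reticulations are counted from both ends: a reticulated vertex has one such
  -- edge, and a reticulation receives two.
  #reticulated : count reticulated? ≡ 2 * #reticulation
  #reticulated = trans (count-sum reticulated?) (trans (sum-cong-≗ row)
    (trans (double-count H?) (trans (sum-cong-≗ column) (trans (sum-scale 2 (λ v → bit (of-mark? reticulation v)))
      (cong (2 *_) (sym (count-sum (of-mark? reticulation))))))))
    where
    H? : ∀ u v → Dec (Edge u v × mark v ≡ reticulation)
    H? u v = edge? u v ×-dec mark v ≟ᴹ reticulation
    row : ∀ u → bit (reticulated? u) ≡ count (H? u)
    row u with reticulated? u
    ... | yes (ϱ , e , m) = sym (exactly⇒count (H? u) 1 (ϱ , (e , m) , λ σ (f , m′) → reticulation-unique f e m′ m))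
    ... | no ¬r = sym (exactly⇒count (H? u) 0 (λ σ p → ¬r (σ , p)))
    column : ∀ v → count (λ u → H? u v) ≡ 2 * bit (of-mark? reticulation v)
    column v with mark v ≟ᴹ reticulation
    ... | yes m = exactly⇒count (λ u → edge? u v ×-dec yes m) 2
      (exactly-≐ (λ _ e → e , m) (λ _ → proj₁) 2 (reticulation-parents v m))
    ... | no ¬m = exactly⇒count (λ u → edge? u v ×-dec no ¬m) 0 (λ u (_ , m) → ¬m m)

  -- The edges out of reticulations form a matching: each reticulation has one child, and this is a
  -- leaf, hence with one parent.
  #reticulation-leaves : #reticulation ≡ count reticulationParent?
  #reticulation-leaves = trans (count-sum (of-mark? reticulation)) (trans (sum-cong-≗ row)
    (trans (double-count H?) (trans (sum-cong-≗ column) (sym (count-sum reticulationParent?)))))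
    where
    H? : ∀ u v → Dec (Edge u v × mark u ≡ reticulation)
    H? u v = edge? u v ×-dec mark u ≟ᴹ reticulation
    row : ∀ u → bit (of-mark? reticulation u) ≡ count (H? u)
    row u with mark u ≟ᴹ reticulation
    ... | yes m = sym (exactly⇒count (λ v → edge? u v ×-dec yes m) 1
      (exactly-≐ (λ _ e → e , m) (λ _ → proj₁) 1 (reticulation-child u m)))
    ... | no ¬m = sym (exactly⇒count (λ v → edge? u v ×-dec no ¬m) 0 (λ _ (_ , m) → ¬m m))
    column : ∀ v → count (λ u → H? u v) ≡ bit (reticulationParent? v)
    column v with reticulationParent? v
    ... | yes (ϱ , e , m) = exactly⇒count (λ u → H? u v) 1
      (ϱ , (e , m) , λ u (f , _) → parent-unique (inj₂ (one-component ϱ v m e)) f e)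
    ... | no ¬r = exactly⇒count (λ u → H? u v) 0 (λ u p → ¬r (u , p))

  leaf-split : #leaf ≡ #reticulation + #freeLeaf
  leaf-split = trans (count-+ (of-mark? leaf) reticulationParent? freeLeaf? eq) (cong (_+ #freeLeaf) (sym #reticulation-leaves))
    where
    eq : ∀ v → bit (of-mark? leaf v) ≡ bit (reticulationParent? v) + bit (freeLeaf? v)
    eq v with reticulationParent? v
    ... | yes w@(ϱ , e , m) = trans (bit-yes (of-mark? leaf v) (one-component ϱ v m e))
      (sym (cong suc (bit-no (of-mark? leaf v ×-dec ¬? (yes w)) λ (_ , ¬r) → ¬r w)))
    ... | no ¬r with mark v ≟ᴹ leaf
    ...   | yes _ = refl
    ...   | no  _ = refl

  -- Used with `f` the outdegree and the indegree in the handshake identity, and with `f` constantly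
  -- one for the order of the graph.
  mark-sum : (f : Mark → ℕ) →
    sum (λ v → f (mark v)) ≡ f root + f tree * #tree + (f reticulation * #reticulation + f leaf * #leaf)
  mark-sum f = trans (trans (sum-cong-≗ pointwise)
    (∑-distrib-+ (λ v → f root * b root v + f tree * b tree v) (λ v → f reticulation * b reticulation v + f leaf * b leaf v)))
    (cong₂ _+_
      (trans (∑-distrib-+ (λ v → f root * b root v) (λ v → f tree * b tree v))
        (cong₂ _+_ (trans (part root) (trans (cong (f root *_) #root≡1) (ℕₚ.*-identityʳ (f root)))) (part tree)))
      (trans (∑-distrib-+ (λ v → f reticulation * b reticulation v) (λ v → f leaf * b leaf v)) (cong₂ _+_ (part reticulation) (part leaf))))
    where
    b : Mark → V → ℕ
    b m v = bit (of-mark? m v)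
    part : ∀ m → sum (λ v → f m * b m v) ≡ f m * count (of-mark? m)
    part m = trans (sum-scale (f m) (b m)) (cong (f m *_) (sym (count-sum (of-mark? m))))
    pointwise : ∀ v → f (mark v) ≡ (f root * b root v + f tree * b tree v) + (f reticulation * b reticulation v + f leaf * b leaf v)
    pointwise v with mark v
    ... | root = s4 (f root) (f tree) (f reticulation) (f leaf)
      where
      s4 : ∀ a b c d → a ≡ (a * 1 + b * 0) + (c * 0 + d * 0)
      s4 = solve-∀
    ... | tree = s4 (f root) (f tree) (f reticulation) (f leaf)
      where
      s4 : ∀ a b c d → b ≡ (a * 0 + b * 1) + (c * 0 + d * 0)
      s4 = solve-∀
    ... | reticulation = s4 (f root) (f tree) (f reticulation) (f leaf)
      where
      s4 : ∀ a b c d → c ≡ (a * 0 + b * 0) + (c * 1 + d * 0)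
      s4 = solve-∀
    ... | leaf = s4 (f root) (f tree) (f reticulation) (f leaf)
      where
      s4 : ∀ a b c d → d ≡ (a * 0 + b * 0) + (c * 0 + d * 1)
      s4 = solve-∀

  -- Handshake identity: both sums of degrees count the edges, and `#tree + #reticulation` cancels.
  #tree-formula : suc #tree ≡ #reticulation + n
  #tree-formula = ℕₚ.+-cancelʳ-≡ (#tree + #reticulation) _ _ (begin
    suc #tree + (#tree + #reticulation)                             ≡⟨ s1 #tree #reticulation #leaf ⟩
    1 + 2 * #tree + (1 * #reticulation + 0 * #leaf)                 ≡⟨ mark-sum (proj₂ ∘ degrees) ⟨
    sum (λ v → proj₂ (degrees (mark v)))                            ≡⟨ sum-cong-≗ (λ v → cong proj₂ (degree v)) ⟨
    sum outdegree                                                   ≡⟨ double-count edge? ⟩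
    sum indegree                                                    ≡⟨ sum-cong-≗ (λ v → cong proj₁ (degree v)) ⟩
    sum (λ v → proj₁ (degrees (mark v)))                            ≡⟨ mark-sum (proj₁ ∘ degrees) ⟩
    0 + 1 * #tree + (2 * #reticulation + 1 * #leaf)                 ≡⟨ s2 #tree #reticulation #leaf ⟩
    #reticulation + #leaf + (#tree + #reticulation)                 ≡⟨ cong (λ k → #reticulation + k + (#tree + #reticulation)) #leaf≡n ⟩
    #reticulation + n + (#tree + #reticulation)                     ∎)
    where
    open ≡-Reasoning
    s1 : ∀ t k l → suc t + (t + k) ≡ 1 + 2 * t + (1 * k + 0 * l)
    s1 = solve-∀
    s2 : ∀ t k l → 0 + 1 * t + (2 * k + 1 * l) ≡ k + l + (t + k)
    s2 = solve-∀

  #reticulation≤n : #reticulation ≤ n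
  #reticulation≤n = subst (#reticulation ≤_) (trans (sym leaf-split) #leaf≡n) (ℕₚ.m≤m+n _ _)

  n≤1+#tree : n ≤ suc #tree
  n≤1+#tree = subst (n ≤_) (sym #tree-formula) (ℕₚ.m≤n+m n _)

  #tree≤2n : #tree ≤ 2 * n
  #tree≤2n = ℕₚ.≤-trans (ℕₚ.n≤1+n _) (subst (_≤ 2 * n) (sym #tree-formula)
    (ℕₚ.+-mono-≤ #reticulation≤n (ℕₚ.≤-reflexive (sym (ℕₚ.+-identityʳ n)))))

  -- Reticulations have distinct leaves below them, so there are at most n, and the other counts
  -- follow. This makes the search for representatives finite.
  order≤4n : order ≤ 4 * n
  order≤4n = begin
    order                                                 ≡⟨ ℕₚ.*-identityʳ order ⟨
    order * 1                                             ≡⟨ sum-const order 1 ⟨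
    sum {order} (λ v → 1)                                 ≡⟨ mark-sum (λ _ → 1) ⟩
    1 + 1 * #tree + (1 * #reticulation + 1 * #leaf)       ≡⟨ s1 #tree #reticulation #leaf ⟩
    suc #tree + (#reticulation + #leaf)                   ≡⟨ cong₂ (λ a b → a + (#reticulation + b)) #tree-formula #leaf≡n ⟩
    (#reticulation + n) + (#reticulation + n)             ≤⟨ ℕₚ.+-mono-≤ bound bound ⟩
    (n + n) + (n + n)                                     ≡⟨ s2 n ⟩
    4 * n                                                 ∎
    where
    open ℕₚ.≤-Reasoning
    bound : #reticulation + n ≤ n + n
    bound = ℕₚ.+-monoˡ-≤ n #reticulation≤n
    s1 : ∀ t k l → 1 + 1 * t + (1 * k + 1 * l) ≡ suc t + (k + l)
    s1 = solve-∀
    s2 : ∀ n → (n + n) + (n + n) ≡ 4 * n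
    s2 = solve-∀

  -- Each reticulation accounts for two reticulated vertices and for one leaf that is not free. The
  -- identity turns `#branching * #freeLeaf` into a second moment of `#freeLeaf` alone.
  #branching-formula : suc #branching ≡ #freeLeaf
  #branching-formula = ℕₚ.+-cancelˡ-≡ (2 * #reticulation) _ _ (begin
    2 * #reticulation + suc #branching            ≡⟨ ℕₚ.+-suc _ _ ⟩
    suc (2 * #reticulation + #branching)          ≡⟨ cong (λ k → suc (k + #branching)) #reticulated ⟨
    suc (count reticulated? + #branching)         ≡⟨ cong suc reticulated-plus-branching ⟨
    suc #tree                                     ≡⟨ #tree-formula ⟩
    #reticulation + n                             ≡⟨ cong (#reticulation +_) (trans (sym #leaf≡n) leaf-split) ⟩
    #reticulation + (#reticulation + #freeLeaf)   ≡⟨ s1 #reticulation #freeLeaf ⟩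
    2 * #reticulation + #freeLeaf                 ∎)
    where
    open ≡-Reasoning
    s1 : ∀ k f → k + (k + f) ≡ 2 * k + f
    s1 = solve-∀

  plus-irrefl : ∀ {u v} → u ≡ v → ¬ TransClosure Edge u v
  plus-irrefl refl p = acyclic _ p

  descent-order : IsStrictPartialOrder _≡_ (TransClosure Edge)
  descent-order = record
    { isEquivalence = isEquivalence
    ; irrefl = plus-irrefl
    ; trans = Plus._++_
    ; <-resp-≈ = (λ { refl p → p }) , (λ { refl p → p }) }

  ancestors-wf : WellFounded (TransClosure Edge)
  ancestors-wf = Finᵢ.spo-wellFounded descent-order

  descendants-wf : WellFounded (flip (TransClosure Edge))
  descendants-wf = Finᵢ.spo-noetherian descent-order

-- Isomorphisms

module _ {n : ℕ} where

  ≈-refl : {N : Network n} → N ≈ N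
  ≈-refl = record
    { bijection = mk↔ₛ′ id id (λ _ → refl) (λ _ → refl)
    ; edge-preserved = λ _ _ → mk⇔ id id
    ; label-preserved = λ _ → refl }

  module Iso {M N : Network n} (φ : M ≈ N) where
    private
      module M = Network M
      module N = Network N
    open _≈_ φ public
    open Inverse bijection public using () renaming (strictlyInverseˡ to to∘from; strictlyInverseʳ to from∘to)

    to-edge : ∀ {u v} → M.Edge u v → N.Edge (to u) (to v)
    to-edge {u} {v} = Equivalence.to (edge-preserved u v)

    from-edge : ∀ {u v} → N.Edge (to u) (to v) → M.Edge u v
    from-edge {u} {v} = Equivalence.from (edge-preserved u v)

    edge-from : ∀ {u v} → N.Edge u v → M.Edge (from u) (from v)
    edge-from {u} {v} e = from-edge (subst₂ N.Edge (sym (to∘from u)) (sym (to∘from v)) e)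

    to-injective : ∀ {u v} → to u ≡ to v → u ≡ v
    to-injective {u} {v} eq = trans (sym (from∘to u)) (trans (cong from eq) (from∘to v))

  ≈-sym : {M N : Network n} → M ≈ N → N ≈ M
  ≈-sym {M} {N} φ = record
    { bijection = mk↔ₛ′ from to from∘to to∘from
    ; edge-preserved = λ u v → mk⇔ edge-from
        (λ e → subst₂ (Network.Edge N) (to∘from u) (to∘from v) (to-edge e))
    ; label-preserved = λ i → trans (cong from (sym (label-preserved i))) (from∘to _) }
    where open Iso {M} {N} φ

  ≈-trans : {L M N : Network n} → L ≈ M → M ≈ N → L ≈ N
  ≈-trans {L} {M} {N} φ ψ = record
    { bijection = mk↔ₛ′ (ψ.to ∘ φ.to) (φ.from ∘ ψ.from)
        (λ v → trans (cong ψ.to (φ.to∘from _)) (ψ.to∘from v))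
        (λ v → trans (cong φ.from (ψ.from∘to _)) (φ.from∘to v))
    ; edge-preserved = λ u v → mk⇔ (ψ.to-edge ∘ φ.to-edge) (φ.from-edge ∘ ψ.from-edge)
    ; label-preserved = λ i → trans (cong ψ.to (φ.label-preserved i)) (ψ.label-preserved i) }
    where
    module φ = Iso {L} {M} φ
    module ψ = Iso {M} {N} ψ

  degrees-injective : ∀ m m′ → degrees m ≡ degrees m′ → m ≡ m′
  degrees-injective root         root         _ = refl
  degrees-injective tree         tree         _ = refl
  degrees-injective reticulation reticulation _ = refl
  degrees-injective leaf         leaf         _ = refl

  module _ {M N : Network n} (φ : M ≈ N) where
    private
      module M = Structure M
      module N = Structure N
      module φ = Iso {M} {N} φ

    -- The definition of `_≈_` does not speak of marks, but they are determined by the degrees,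
    -- which an isomorphism preserves.
    ≈-mark : ∀ v → N.mark (φ.to v) ≡ M.mark v
    ≈-mark v = degrees-injective _ _ (sym (trans (sym (M.degree v)) (trans (cong₂ _,_ ins outs) (N.degree (φ.to v)))))
      where
      into : Exactly (proj₁ (degrees (M.mark v))) (λ u → N.Edge u (φ.to v))
      into = exactly-map φ.to φ.from φ.from∘to φ.to∘from (λ _ → φ.to-edge)
        (λ u e → φ.from-edge (subst (λ w → N.Edge w (φ.to v)) (sym (φ.to∘from u)) e)) _ (M.in-degree v)
      out-of : Exactly (proj₂ (degrees (M.mark v))) (λ w → N.Edge (φ.to v) w)
      out-of = exactly-map φ.to φ.from φ.from∘to φ.to∘from (λ _ → φ.to-edge)
        (λ w e → φ.from-edge (subst (N.Edge (φ.to v)) (sym (φ.to∘from w)) e)) _ (M.out-degree v)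
      ins : M.indegree v ≡ N.indegree (φ.to v)
      ins = trans (cong proj₁ (M.degree v)) (sym (exactly⇒count (λ u → N.edge? u (φ.to v)) _ into))
      outs : M.outdegree v ≡ N.outdegree (φ.to v)
      outs = trans (cong proj₂ (M.degree v)) (sym (exactly⇒count (λ w → N.edge? (φ.to v) w) _ out-of))

  -- Two isomorphisms agree at a vertex as soon as they agree at a child
  -- of indegree one, and every vertex has a descending path of such
  -- children ending at a labelled leaf.
  ≈-unique : {M N : Network n} (φ ψ : M ≈ N) → ∀ v → _≈_.to φ v ≡ _≈_.to ψ v
  ≈-unique {M} {N} φ ψ = All.wfRec M.descendants-wf 0ℓ (λ v → φ.to v ≡ ψ.to v) go
    where
    module M = Structure M
    module N = Structure N
    module φ = Iso {M} {N} φ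
    module ψ = Iso {M} {N} ψ
    go : ∀ v → (∀ {w} → TransClosure M.Edge v w → φ.to w ≡ ψ.to w) → φ.to v ≡ ψ.to v
    go v ih with M.mark v ≟ᴹ leaf
    ... | yes eq with Equivalence.to (M.leaf-mark v) eq
    ...   | i , refl = trans (φ.label-preserved i) (sym (ψ.label-preserved i))
    go v ih | no ¬leaf with M.tree-child v ¬leaf
    ...   | w , e , pl = N.parent-unique (subst Plain (sym (≈-mark φ w)) pl) (φ.to-edge e)
            (subst (N.Edge (ψ.to v)) (sym (ih [ e ])) (ψ.to-edge e))

-- A checkable criterion for networks

module _ {n : ℕ} where

  -- Acyclicity need not be asked for: it follows from reachability.
  record Valid (g : FiniteGraph) (origin : Fin (FiniteGraph.order g)) (labelled : Fin n → Fin (FiniteGraph.order g)) : Set where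
    open FiniteGraph g
    field
      ins           : ∀ v → Exactly (proj₁ (degrees (mark v))) (λ u → Edge u v)
      outs          : ∀ v → Exactly (proj₂ (degrees (mark v))) (λ w → Edge v w)
      root-mark     : ∀ v → mark v ≡ root ⇔ v ≡ origin
      leaf-mark     : ∀ v → mark v ≡ leaf ⇔ (∃[ i ] labelled i ≡ v)
      label-inj     : ∀ i j → labelled i ≡ labelled j → i ≡ j
      reachable     : ∀ v → Star Edge origin v
      tree-child    : ∀ v → mark v ≢ leaf → ∃[ w ] (Edge v w × (mark w ≡ tree ⊎ mark w ≡ leaf))
      one-component : ∀ v w → mark v ≡ reticulation → Edge v w → mark w ≡ leaf

  module _ {g : FiniteGraph} {origin : Fin (FiniteGraph.order g)} {labelled : Fin n → Fin (FiniteGraph.order g)}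
           (valid : Valid g origin labelled) where
    open FiniteGraph g
    open Valid valid

    private
      leaf-end : ∀ {v w} → mark v ≡ leaf → ¬ Edge v w
      leaf-end {v} {w} eq = subst (λ m → Exactly (proj₂ (degrees m)) (Edge v)) eq (outs v) w

      -- Nothing leads into a root, and a reticulation leads to a leaf, where every walk ends.
      cycle-tree : ∀ v → TransClosure Edge v v → mark v ≡ tree
      cycle-tree v p with mark v in eq
      ... | tree = refl
      ... | root with plus-last p
      ...   | q , _ , e = contradiction e (subst (λ m → Exactly (proj₁ (degrees m)) (λ u → Edge u v)) eq (ins v) q)
      cycle-tree v [ e ] | leaf = contradiction e (leaf-end eq)
      cycle-tree v (e ∷ _) | leaf = contradiction e (leaf-end eq)
      cycle-tree v [ e ] | reticulation = contradiction e (leaf-end (one-component v v eq e))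
      cycle-tree v (e ∷ [ e′ ]) | reticulation = contradiction e′ (leaf-end (one-component v _ eq e))
      cycle-tree v (e ∷ e′ ∷ _) | reticulation = contradiction e′ (leaf-end (one-component v _ eq e))

      -- A cycle consists of tree vertices, whose parents are unique, so
      -- it contains all ancestors of its vertices.
      cycle-up : ∀ {u v} → Star Edge u v → TransClosure Edge v v → TransClosure Edge u u
      cycle-up ε p = p
      cycle-up (_◅_ {i = u} {j = m} e s) p with cycle-up s p
      ... | c with plus-last c | cycle-tree m c
      ...   | q , s′ , e′ | eq with subst (λ k → Exactly (proj₁ (degrees k)) (λ u → Edge u m)) eq (ins m)
      ...     | _ , _ , only with trans (only u e) (sym (only q e′))
      ...       | refl with star⇒plus s′
      ...         | inj₁ refl = [ e ]
      ...         | inj₂ p′ = e ∷ p′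

      no-cycle : ∀ v → ¬ TransClosure Edge v v
      no-cycle v p with cycle-tree origin (cycle-up (reachable v) p)
      ... | eq = case trans (sym eq) (Equivalence.from (root-mark origin) refl) of λ ()

    network : Network n
    network = record
      { graph = g ; origin = origin ; labelled = labelled
      ; degree = λ v → cong₂ _,_ (exactly⇒count (λ u → edge? u v) _ (ins v)) (exactly⇒count (λ w → edge? v w) _ (outs v))
      ; root-mark = root-mark ; leaf-mark = leaf-mark ; label-inj = label-inj
      ; acyclic = no-cycle ; reachable = reachable ; tree-child = tree-child ; one-component = one-component }

-- Representatives

exactly? : {P : Pred (Fin n) 0ℓ} → Decidable P → ∀ k → k ≤ 2 → Dec (Exactly k P)
exactly? P? k k≤2 = map′ (count≤2⇒exactly P? k k≤2) (exactly⇒count P? k) (count P? ℕₚ.≟ k)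

_⇔-dec_ : {P Q : Set} → Dec P → Dec Q → Dec (P ⇔ Q)
P? ⇔-dec Q? = map′ (λ (f , g) → mk⇔ f g) (λ e → Equivalence.to e , Equivalence.from e) ((P? →-dec Q?) ×-dec (Q? →-dec P?))

module _ {n : ℕ} where

  valid? : ∀ g (origin : Fin (FiniteGraph.order g)) (labelled : Fin n → Fin (FiniteGraph.order g)) → Dec (Valid g origin labelled)
  valid? g origin labelled = map′
    (λ (a , b , c , d , e , f , g , h) → record
      { ins = a ; outs = b ; root-mark = c ; leaf-mark = d ; label-inj = e ; reachable = f ; tree-child = g ; one-component = h })
    (λ v → let open Valid v in ins , outs , root-mark , leaf-mark , label-inj , reachable , tree-child , one-component)
    (  Finₚ.all? (λ v → exactly? (λ u → edge? u v) _ (indegree-bound (mark v)))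
    ×-dec Finₚ.all? (λ v → exactly? (λ w → edge? v w) _ (outdegree-bound (mark v)))
    ×-dec Finₚ.all? (λ v → (mark v ≟ᴹ root) ⇔-dec (v Finₚ.≟ origin))
    ×-dec Finₚ.all? (λ v → (mark v ≟ᴹ leaf) ⇔-dec Finₚ.any? (λ i → labelled i Finₚ.≟ v))
    ×-dec Finₚ.all? (λ i → Finₚ.all? λ j → (labelled i Finₚ.≟ labelled j) →-dec (i Finₚ.≟ j))
    ×-dec Finₚ.all? (λ v → star? edge? origin v)
    ×-dec Finₚ.all? (λ v → ¬? (mark v ≟ᴹ leaf) →-dec Finₚ.any? (λ w → edge? v w ×-dec plain? (mark w)))
    ×-dec Finₚ.all? (λ v → Finₚ.all? λ w → (mark v ≟ᴹ reticulation) →-dec (edge? v w →-dec (mark w ≟ᴹ leaf))))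
    where open FiniteGraph g

  module _ (M N : Network n) where
    private
      module M = Network M
      module N = Network N

    IsIso : (Fin M.order → Fin N.order) → Set
    IsIso f = (∀ i j → f i ≡ f j → i ≡ j) × (∀ u → ∃[ i ] f i ≡ u) ×
      (∀ i j → M.Edge i j ⇔ N.Edge (f i) (f j)) × (∀ k → f (M.labelled k) ≡ N.labelled k)

    isIso? : ∀ f → Dec (IsIso f)
    isIso? f = Finₚ.all? (λ i → Finₚ.all? λ j → (f i Finₚ.≟ f j) →-dec (i Finₚ.≟ j)) ×-dec
      Finₚ.all? (λ u → Finₚ.any? λ i → f i Finₚ.≟ u) ×-dec
      Finₚ.all? (λ i → Finₚ.all? λ j → M.edge? i j ⇔-dec N.edge? (f i) (f j)) ×-dec
      Finₚ.all? (λ k → f (M.labelled k) Finₚ.≟ N.labelled k)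

    iso : ∀ {f} → IsIso f → M ≈ N
    iso {f} (inj , surj , edges , labels) = record
      { bijection = mk↔ₛ′ f (proj₁ ∘ surj) (proj₂ ∘ surj) (λ i → inj _ _ (proj₂ (surj (f i))))
      ; edge-preserved = edges ; label-preserved = labels }

    _≈?_ : Dec (M ≈ N)
    _≈?_ = map′ (λ (xs , p) → iso p)
      (λ φ → let open Iso {n} {M} {N} φ ; eq = Vecₚ.lookup∘tabulate to in Vec.tabulate to ,
        (λ i j e → to-injective (trans (sym (eq i)) (trans e (eq j)))) ,
        (λ u → from u , trans (eq (from u)) (to∘from u)) ,
        (λ i j → subst₂ (λ a b → M.Edge i j ⇔ N.Edge a b) (sym (eq i)) (sym (eq j)) (edge-preserved i j)) ,
        (λ k → trans (eq _) (label-preserved k)))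
      (anyVec? (isIso? ∘ lookup))

≈-decSetoid : ℕ → DecSetoid 0ℓ 0ℓ
≈-decSetoid n = record
  { Carrier = Network n ; _≈_ = _≈_
  ; isDecEquivalence = record
    { isEquivalence = record
      { refl = λ {N} → ≈-refl {N = N}
      ; sym = λ {M} {N} → ≈-sym {M = M} {N}
      ; trans = λ {L} {M} {N} → ≈-trans {L = L} {M} {N} }
    ; _≟_ = _≈?_ } }

vectors : List A → ∀ k → List (Vec A k)
vectors xs zero    = [] ∷ []
vectors xs (suc k) = List.cartesianProductWith _∷_ xs (vectors xs k)

∈-vectors : (xs : List A) → (∀ x → x ∈ xs) → ∀ {k} (v : Vec A k) → v ∈ vectors xs k
∈-vectors xs all []      = here refl
∈-vectors xs all (x ∷ v) = ∈-cartesianProductWith⁺ _∷_ (all x) (∈-vectors xs all v)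

module _ (n : ℕ) where

  -- Functions are replaced by their tables, which can be listed. A network is recovered from its
  -- code only up to `_≈_`, which is what `complete` asks for.
  Code : ℕ → Set
  Code o = Vec (Vec Bool o) o × Vec Mark o × Fin o × Vec (Fin o) n

  codes : ∀ o → List (Code o)
  codes o = cartesianProduct (vectors (vectors (true ∷ false ∷ []) o) o)
    (cartesianProduct (vectors (root ∷ tree ∷ reticulation ∷ leaf ∷ []) o) (cartesianProduct (allFin o) (vectors (allFin o) n)))

  ∈-codes : ∀ {o} (c : Code o) → c ∈ codes o
  ∈-codes (a , m , v , l) = ∈-cartesianProduct⁺ (∈-vectors _ (∈-vectors _ λ { true → here refl ; false → there (here refl) }) a)
    (∈-cartesianProduct⁺ (∈-vectors _ (λ { root → here refl ; tree → there (here refl)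
      ; reticulation → there (there (here refl)) ; leaf → there (there (there (here refl))) }) m)
    (∈-cartesianProduct⁺ (∈-allFin v) (∈-vectors _ ∈-allFin l)))

  decode : ∀ {o} → Code o → FiniteGraph
  decode {o} (a , m , v , l) = record { order = o ; adj = λ u v → lookup (lookup a u) v ; mark = lookup m }

  realise : ∀ {o} → Code o → List (Network n)
  realise c@(a , m , v , l) with valid? (decode c) v (lookup l)
  ... | yes valid = network valid ∷ []
  ... | no  _     = []

  realisations : List (Network n)
  realisations = concatMap (λ o → concatMap realise (codes o)) (List.upTo (suc (4 * n)))

  encode : (N : Network n) → Code (Network.order N)
  encode N = Vec.tabulate (λ u → Vec.tabulate (adj u)) , Vec.tabulate mark , origin , Vec.tabulate labelled
    where open Network N

  module _ (N : Network n) where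
    private
      module N = Structure N
      module C = FiniteGraph (decode (encode N))

      adj≗ : ∀ u v → C.adj u v ≡ N.adj u v
      adj≗ u v = trans (cong (λ r → lookup r v) (Vecₚ.lookup∘tabulate (λ u → Vec.tabulate (N.adj u)) u)) (Vecₚ.lookup∘tabulate (N.adj u) v)

      mark≗ : ∀ v → C.mark v ≡ N.mark v
      mark≗ = Vecₚ.lookup∘tabulate N.mark

      lab : Fin n → Fin N.order
      lab = lookup (Vec.tabulate N.labelled)

      lab≗ : ∀ i → lab i ≡ N.labelled i
      lab≗ = Vecₚ.lookup∘tabulate N.labelled

      to : ∀ {u v} → C.Edge u v → N.Edge u v
      to {u} {v} = subst T (adj≗ u v)

      from : ∀ {u v} → N.Edge u v → C.Edge u v
      from {u} {v} = subst T (sym (adj≗ u v))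

    encode-valid : Valid (decode (encode N)) N.origin lab
    encode-valid = record
      { ins = λ v → subst (λ m → Exactly (proj₁ (degrees m)) (λ u → C.Edge u v)) (sym (mark≗ v))
                      (exactly-≐ (λ _ → from) (λ _ → to) _ (N.in-degree v))
      ; outs = λ v → subst (λ m → Exactly (proj₂ (degrees m)) (C.Edge v)) (sym (mark≗ v))
                      (exactly-≐ (λ _ → from) (λ _ → to) _ (N.out-degree v))
      ; root-mark = λ v → subst (λ m → m ≡ root ⇔ v ≡ N.origin) (sym (mark≗ v)) (N.root-mark v)
      ; leaf-mark = λ v → mk⇔
          (λ eq → let (i , e) = Equivalence.to (N.leaf-mark v) (trans (sym (mark≗ v)) eq) in i , trans (lab≗ i) e)
          (λ (i , e) → trans (mark≗ v) (Equivalence.from (N.leaf-mark v) (i , trans (sym (lab≗ i)) e)))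
      ; label-inj = λ i j e → N.label-inj i j (trans (sym (lab≗ i)) (trans e (lab≗ j)))
      ; reachable = λ v → Star.map from (N.reachable v)
      ; tree-child = λ v ¬l → let (w , e , pl) = N.tree-child v (λ eq → ¬l (trans (mark≗ v) eq)) in
          w , from e , subst Plain (sym (mark≗ w)) pl
      ; one-component = λ v w eq e → trans (mark≗ w) (N.one-component v w (trans (sym (mark≗ v)) eq) (to e)) }

    encode-≈ : (valid : Valid (decode (encode N)) N.origin lab) → N ≈ network valid
    encode-≈ _ = record
      { bijection = mk↔ₛ′ id id (λ _ → refl) (λ _ → refl)
      ; edge-preserved = λ u v → mk⇔ from to ; label-preserved = λ i → sym (lab≗ i) }

    realise-encode : Any (N ≈_) (realise (encode N))
    realise-encode with valid? (decode (encode N)) N.origin lab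
    ... | yes valid = here (encode-≈ valid)
    ... | no ¬valid = contradiction encode-valid ¬valid

    realisations-complete : Any (N ≈_) realisations
    realisations-complete = Anyₚ.concatMap⁺ (λ o → concatMap realise (codes o)) (lose (∈-upTo⁺ (s≤s N.order≤4n))
      (Anyₚ.concatMap⁺ realise (lose (∈-codes (encode N)) realise-encode)))

  representatives : Representatives n
  representatives = record
    { networks = deduplicate _≈?_ realisations
    ; complete = λ N → Anyₚ.deduplicate⁺ _≈?_
        (λ {M} {M′} M′≈M N≈M → ≈-trans {L = N} {M} {M′} N≈M (≈-sym {M = M′} {M} M′≈M)) (realisations-complete N)
    ; distinct = UniqueDecₚ.deduplicate-! (≈-decSetoid n) realisations }

-- Existence of networks

T-to : {P : Set} (d : Dec P) → T (does d) → P
T-to (yes p) _ = p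

T-from : {P : Set} (d : Dec P) → P → T (does d)
T-from (yes _) _ = tt
T-from (no ¬p) p = ¬p p

lift-exactly : {P : Fin n → Set} {Q : Fin (suc (suc n)) → Set} → ¬ Q zero → ¬ Q (suc zero) →
  (∀ v → P v → Q (suc (suc v))) → (∀ v → Q (suc (suc v)) → P v) → ∀ k → Exactly k P → Exactly k Q
lift-exactly ¬q₀ ¬q₁ to from 0 none = λ
  { zero q → ¬q₀ q ; (suc zero) q → ¬q₁ q ; (suc (suc v)) q → none v (from v q) }
lift-exactly ¬q₀ ¬q₁ to from 1 (a , pa , only) = suc (suc a) , to a pa , λ
  { zero q → contradiction q ¬q₀ ; (suc zero) q → contradiction q ¬q₁
  ; (suc (suc v)) q → cong (λ v → suc (suc v)) (only v (from v q)) }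
lift-exactly ¬q₀ ¬q₁ to from 2 (a , b , a≢b , pa , pb , only) =
  suc (suc a) , suc (suc b) , (λ { refl → a≢b refl }) , to a pa , to b pb , λ
  { zero q → contradiction q ¬q₀ ; (suc zero) q → contradiction q ¬q₁
  ; (suc (suc v)) q → case only v (from v q) of λ { (inj₁ refl) → inj₁ refl ; (inj₂ refl) → inj₂ refl } }

-- The vertex 0 is a new root, and the vertex 1 a new leaf below the old one.
module AddLeaf {n : ℕ} (N : Network n) where
  open Structure N

  pattern old v = suc (suc v)

  unroot : Mark → Mark
  unroot root         = tree
  unroot tree         = tree
  unroot reticulation = reticulation
  unroot leaf         = leaf

  adj′ : Fin (2 + order) → Fin (2 + order) → Bool
  adj′ zero       zero       = false
  adj′ zero       (suc zero) = false
  adj′ zero       (old v)    = does (v Finₚ.≟ origin)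
  adj′ (suc zero) _          = false
  adj′ (old u)    zero       = false
  adj′ (old u)    (suc zero) = does (u Finₚ.≟ origin)
  adj′ (old u)    (old v)    = adj u v

  mark′ : Fin (2 + order) → Mark
  mark′ zero       = root
  mark′ (suc zero) = leaf
  mark′ (old v)    = unroot (mark v)

  graph′ : FiniteGraph
  graph′ = record { order = 2 + order ; adj = adj′ ; mark = mark′ }

  open FiniteGraph graph′ using () renaming (Edge to Edge′)

  labelled′ : Fin (suc n) → Fin (2 + order)
  labelled′ zero    = suc zero
  labelled′ (suc i) = old (labelled i)

  unroot-≢ : ∀ {m} → m ≢ root → unroot m ≡ m
  unroot-≢ {root} ne = contradiction refl ne
  unroot-≢ {tree} ne = refl
  unroot-≢ {reticulation} ne = refl
  unroot-≢ {leaf} ne = refl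

  unroot-leaf : ∀ {m} → unroot m ≡ leaf → m ≡ leaf
  unroot-leaf {leaf} _ = refl

  unroot-reticulation : ∀ {m} → unroot m ≡ reticulation → m ≡ reticulation
  unroot-reticulation {reticulation} _ = refl

  unroot-plain : ∀ {m} → Plain m → Plain (unroot m)
  unroot-plain (inj₁ refl) = inj₁ refl
  unroot-plain (inj₂ refl) = inj₂ refl

  origin-root : mark origin ≡ root
  origin-root = Equivalence.from (root-mark origin) refl

  not-root : ∀ {v} → v ≢ origin → mark v ≢ root
  not-root v≢ eq = v≢ (Equivalence.to (root-mark _) eq)

  top : T (does (origin Finₚ.≟ origin))
  top = T-from (origin Finₚ.≟ origin) refl

  ins : ∀ v → Exactly (proj₁ (degrees (mark′ v))) (λ u → Edge′ u v)
  ins zero = λ { zero () ; (suc zero) () ; (old u) () }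
  ins (suc zero) = old origin , top , λ
    { zero () ; (suc zero) () ; (old u) e → cong (λ v → old v) (T-to (u Finₚ.≟ origin) e) }
  ins (old v) with v Finₚ.≟ origin
  ... | yes refl = subst (λ m → Exactly (proj₁ (degrees (unroot m))) (λ u → Edge′ u (old origin))) (sym origin-root)
        (zero , top , λ { zero _ → refl ; (suc zero) () ; (old u) e → contradiction refl (no-parent e) })
  ... | no v≢ = subst (λ m → Exactly (proj₁ (degrees m)) (λ u → Edge′ u (old v))) (sym (unroot-≢ (not-root v≢)))
        (lift-exactly (λ e → v≢ (T-to (v Finₚ.≟ origin) e)) (λ ()) (λ _ e → e) (λ _ e → e) _ (in-degree v))

  outs : ∀ v → Exactly (proj₂ (degrees (mark′ v))) (λ w → Edge′ v w)
  outs zero = old origin , top , λ { zero () ; (suc zero) () ; (old u) e → cong (λ v → old v) (T-to (u Finₚ.≟ origin) e) }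
  outs (suc zero) = λ { _ () }
  outs (old v) with v Finₚ.≟ origin
  ... | yes refl with subst (λ m → Exactly (proj₂ (degrees m)) (Edge v)) origin-root (out-degree origin)
  ...   | c , e , only = subst (λ m → Exactly (proj₂ (degrees (unroot m))) (Edge′ (old origin))) (sym origin-root)
          (suc zero , old c , (λ ()) , top , e , λ
            { (suc zero) _ → inj₁ refl ; (old w) f → inj₂ (cong (λ v → old v) (only w f)) })
  outs (old v) | no v≢ = subst (λ m → Exactly (proj₂ (degrees m)) (Edge′ (old v))) (sym (unroot-≢ (not-root v≢)))
        (lift-exactly (λ ()) (λ e → v≢ (T-to (v Finₚ.≟ origin) e)) (λ _ e → e) (λ _ e → e) _ (out-degree v))

  old-star : ∀ {u v} → Star Edge u v → Star Edge′ (old u) (old v)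
  old-star ε = ε
  old-star (e ◅ s) = e ◅ old-star s

  reach : ∀ v → Star Edge′ zero v
  reach zero = ε
  reach (suc zero) = _◅_ {j = old origin} top (_◅_ {j = suc zero} top ε)
  reach (old v) = _◅_ {j = old origin} top (old-star (reachable v))

  valid : Valid graph′ zero labelled′
  valid = record
    { ins = ins ; outs = outs
    ; root-mark = λ
      { zero → mk⇔ (λ _ → refl) (λ _ → refl)
      ; (suc zero) → mk⇔ (λ ()) (λ ())
      ; (old v) → mk⇔ (λ eq → contradiction eq (not-unrooted (mark v))) (λ ()) }
    ; leaf-mark = λ
      { zero → mk⇔ (λ ()) (λ { (zero , ()) ; (suc _ , ()) })
      ; (suc zero) → mk⇔ (λ _ → zero , refl) (λ _ → refl)
      ; (old v) → mk⇔
          (λ eq → let (i , e) = Equivalence.to (leaf-mark v) (unroot-leaf eq) in suc i , cong (λ v → old v) e)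
          (λ { (zero , ()) ; (suc i , refl) → cong unroot (Equivalence.from (leaf-mark v) (i , refl)) }) }
    ; label-inj = λ
      { zero zero _ → refl ; zero (suc _) () ; (suc _) zero ()
      ; (suc i) (suc j) e → cong suc (label-inj i j (Finₚ.suc-injective (Finₚ.suc-injective e))) }
    ; reachable = reach
    ; tree-child = λ
      { zero _ → old origin , top , inj₁ (cong unroot origin-root)
      ; (suc zero) ¬l → contradiction refl ¬l
      ; (old v) ¬l → let (w , e , pl) = tree-child v (λ eq → ¬l (cong unroot eq)) in
          old w , e , unroot-plain pl }
    ; one-component = λ
      { zero _ () ; (suc zero) _ () ; (old v) zero _ () ; (old v) (suc zero) _ _ → refl
      ; (old v) (old w) eq e → cong unroot (one-component v w (unroot-reticulation eq) e) } }
    where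
    not-unrooted : ∀ m → unroot m ≢ root
    not-unrooted root ()
    not-unrooted tree ()
    not-unrooted reticulation ()
    not-unrooted leaf ()

single-edge : Network 1
single-edge = network {1} {record { order = 2 ; adj = adj ; mark = mark }} {zero} {λ _ → suc zero} record
  { ins = λ { zero → λ { zero () ; (suc zero) () } ; (suc zero) → zero , tt , λ { zero _ → refl ; (suc zero) () } }
  ; outs = λ { zero → suc zero , tt , (λ { zero () ; (suc zero) _ → refl }) ; (suc zero) → λ { _ () } }
  ; root-mark = λ { zero → mk⇔ (λ _ → refl) (λ _ → refl) ; (suc zero) → mk⇔ (λ ()) (λ ()) }
  ; leaf-mark = λ { zero → mk⇔ (λ ()) (λ ()) ; (suc zero) → mk⇔ (λ _ → zero , refl) (λ _ → refl) }
  ; label-inj = λ { zero zero _ → refl }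
  ; reachable = λ { zero → ε ; (suc zero) → _◅_ {j = suc zero} tt ε }
  ; tree-child = λ { zero _ → suc zero , tt , inj₂ refl ; (suc zero) ¬l → contradiction refl ¬l }
  ; one-component = λ { zero _ () ; (suc zero) _ () } }
  where
  adj : Fin 2 → Fin 2 → Bool
  adj zero (suc zero) = true
  adj _    _          = false
  mark : Fin 2 → Mark
  mark zero       = root
  mark (suc zero) = leaf

-- Needed only to know that there is at least one class, so that the mean over the classes is a
-- genuine average.
caterpillar : ∀ n → Network (suc n)
caterpillar zero    = single-edge
caterpillar (suc n) = network (AddLeaf.valid (caterpillar n))

-- Isomorphism classes and the size of balls

module Classes {n : ℕ} (reps : Representatives n) where
  open Representatives reps

  #classes : ℕ
  #classes = length networks

  rep : Fin #classes → Network n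
  rep = List.lookup networks

  class : (N : Network n) → ∃[ j ] (N ≈ rep j)
  class N = Any.index (complete N) , Anyₚ.lookup-index (complete N)

  rep-injective : ∀ i j → rep i ≈ rep j → i ≡ j
  rep-injective = go networks distinct
    where
    go : ∀ Ns → AllPairs (λ M N → ¬ M ≈ N) Ns → ∀ i j → List.lookup Ns i ≈ List.lookup Ns j → i ≡ j
    go (N ∷ Ns) _ zero zero _ = refl
    go (N ∷ Ns) (new ∷ _) zero (suc j) φ = contradiction φ (All.lookup new (∈-lookup j))
    go (N ∷ Ns) (new ∷ _) (suc i) zero φ =
      contradiction (≈-sym {M = List.lookup Ns i} {N} φ) (All.lookup new (∈-lookup i))
    go (N ∷ Ns) (_ ∷ ds) (suc i) (suc j) φ = cong suc (go Ns ds i j φ)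

within-mono : ∀ {N r s v w} → r ≤ s → Within N r v w → Within N s v w
within-mono _       here       = here
within-mono (s≤s l) (step p e) = step (within-mono l p) e

module Balls {n : ℕ} (N : Network n) where
  open Structure N

  adjacent? : ∀ v w → Dec (Edge v w ⊎ Edge w v)
  adjacent? v w = edge? v w ⊎-dec edge? w v

  #adjacent≤3 : ∀ v → count (adjacent? v) ≤ 3
  #adjacent≤3 v = ℕₚ.≤-trans (count-split (adjacent? v) (edge? v) (λ w → edge? w v) id)
    (subst (_≤ 3) (cong₂ _+_ (sym (cong proj₂ (degree v))) (sym (cong proj₁ (degree v)))) (bound (mark v)))
    where
    bound : ∀ m → proj₂ (degrees m) + proj₁ (degrees m) ≤ 3
    bound root         = s≤s z≤n
    bound tree         = s≤s (s≤s (s≤s z≤n))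
    bound reticulation = s≤s (s≤s (s≤s z≤n))
    bound leaf         = s≤s z≤n

  -- Repetitions are harmless, as only the length is bounded: a vertex has at most three neighbours,
  -- and the extra centre is absorbed by passing from 3 to 4.
  ball : ℕ → V → List V
  ball zero    v = v ∷ []
  ball (suc r) v = v ∷ concatMap (λ u → select (adjacent? u)) (ball r v)

  ∈-ball : ∀ {r v w} → Within ⟦_⟧ r v w → w ∈ ball r v
  ∈-ball {zero}  here = here refl
  ∈-ball {suc r} here = here refl
  ∈-ball {suc r} {v} (step {u = u} p e) =
    there (Anyₚ.concatMap⁺ (λ u → select (adjacent? u)) (lose (∈-ball p) (∈-select⁺ (adjacent? u) e)))

  length-ball : ∀ r v → length (ball r v) ≤ 4 ^ r
  length-ball zero    v = s≤s z≤n
  length-ball (suc r) v = begin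
    suc (length (concatMap (λ u → select (adjacent? u)) (ball r v)))  ≤⟨ s≤s (bound (ball r v)) ⟩
    1 + 3 * length (ball r v)        ≤⟨ ℕₚ.+-mono-≤ (ℕₚ.m^n>0 4 r) (ℕₚ.*-monoʳ-≤ 3 (length-ball r v)) ⟩
    4 ^ r + 3 * 4 ^ r                ≡⟨⟩
    4 ^ suc r                        ∎
    where
    open ℕₚ.≤-Reasoning
    bound : ∀ xs → length (concatMap (λ u → select (adjacent? u)) xs) ≤ 3 * length xs
    bound [] = z≤n
    bound (x ∷ xs) = begin
      length (select (adjacent? x) ++ concatMap (λ u → select (adjacent? u)) xs)          ≡⟨ Listₚ.length-++ (select (adjacent? x)) ⟩
      count (adjacent? x) + length (concatMap (λ u → select (adjacent? u)) xs)   ≤⟨ ℕₚ.+-mono-≤ (#adjacent≤3 x) (bound xs) ⟩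
      3 + 3 * length xs                                                          ≡⟨ ℕₚ.*-suc 3 (length xs) ⟨
      3 * suc (length xs)                                                        ∎

  #within≤ : ∀ r v → count (within? (Network.graph N) r v) ≤ 4 ^ r
  #within≤ r v = ℕₚ.≤-trans (length-⊆ (select-unique (within? graph r v)) (λ p → ∈-ball (∈-select⁻ (within? graph r v) p)))
    (length-ball r v)

-- Vertices of short cycles are rare: regrafting

module Rotation {m : ℕ} (a b c : Fin m) where

  rot : Fin m → Fin m
  rot q with q Finₚ.≟ a | q Finₚ.≟ b | q Finₚ.≟ c
  ... | yes _ | _     | _     = b
  ... | no  _ | yes _ | _     = c
  ... | no  _ | no  _ | yes _ = a
  ... | no  _ | no  _ | no  _ = q

  rot-other : ∀ {q} → q ≢ a → q ≢ b → q ≢ c → rot q ≡ q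
  rot-other {q} qa qb qc with q Finₚ.≟ a | q Finₚ.≟ b | q Finₚ.≟ c
  ... | yes e | _     | _     = contradiction e qa
  ... | no  _ | yes e | _     = contradiction e qb
  ... | no  _ | no  _ | yes e = contradiction e qc
  ... | no  _ | no  _ | no  _ = refl

  rot-a : rot a ≡ b
  rot-a with a Finₚ.≟ a
  ... | yes _ = refl
  ... | no ne = contradiction refl ne

  rot-b : b ≢ a → rot b ≡ c
  rot-b ba with b Finₚ.≟ a | b Finₚ.≟ b
  ... | yes e | _      = contradiction e ba
  ... | no _  | yes _  = refl
  ... | no _  | no ne  = contradiction refl ne

  rot-c : c ≢ a → c ≢ b → rot c ≡ a
  rot-c ca cb with c Finₚ.≟ a | c Finₚ.≟ b | c Finₚ.≟ c
  ... | yes e | _     | _      = contradiction e ca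
  ... | no _  | yes e | _      = contradiction e cb
  ... | no _  | no _  | yes _  = refl
  ... | no _  | no _  | no ne  = contradiction refl ne

  data Position (q : Fin m) : Set where
    at-a  : q ≡ a → Position q
    at-b  : q ≡ b → Position q
    at-c  : q ≡ c → Position q
    other : q ≢ a → q ≢ b → q ≢ c → Position q

  position : ∀ q → Position q
  position q with q Finₚ.≟ a | q Finₚ.≟ b | q Finₚ.≟ c
  ... | yes e | _     | _     = at-a e
  ... | no  _ | yes e | _     = at-b e
  ... | no  _ | no  _ | yes e = at-c e
  ... | no  x | no  y | no  z = other x y z

module _ {m : ℕ} {a b c : Fin m} (b≢a : b ≢ a) (c≢a : c ≢ a) (c≢b : c ≢ b) where
  private
    module F = Rotation a b c
    module G = Rotation a c b

  rot-inverse : ∀ q → G.rot (F.rot q) ≡ q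
  rot-inverse q with F.position q
  ... | F.at-a refl = trans (cong G.rot F.rot-a) (G.rot-c b≢a (c≢b ∘ sym))
  ... | F.at-b refl = trans (cong G.rot (F.rot-b b≢a)) (G.rot-b c≢a)
  ... | F.at-c refl = trans (cong G.rot (F.rot-c c≢a c≢b)) G.rot-a
  ... | F.other x y z = trans (cong G.rot (F.rot-other x y z)) (G.rot-other x z y)

-- Once the edge from u to ϱ is deleted, a cycle through it is just a walk between its ends, which
-- need not be simple.
pruned : (N : FiniteGraph) → Fin (FiniteGraph.order N) → Fin (FiniteGraph.order N) → FiniteGraph
pruned N u ϱ = record
  { order = order ; mark = mark
  ; adj = λ p q → does (edge? p q ×-dec ¬? ((p Finₚ.≟ u) ×-dec (q Finₚ.≟ ϱ))) }
  where open FiniteGraph N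

pruned-edge⁻ : ∀ N {u ϱ p q} → FiniteGraph.Edge (pruned N u ϱ) p q → FiniteGraph.Edge N p q × ¬ (p ≡ u × q ≡ ϱ)
pruned-edge⁻ N {u} {ϱ} {p} {q} = T-to (FiniteGraph.edge? N p q ×-dec ¬? ((p Finₚ.≟ u) ×-dec (q Finₚ.≟ ϱ)))

pruned-edge⁺ : ∀ N {u ϱ p q} → FiniteGraph.Edge N p q → ¬ (p ≡ u × q ≡ ϱ) → FiniteGraph.Edge (pruned N u ϱ) p q
pruned-edge⁺ N {u} {ϱ} {p} {q} e ne = T-from (FiniteGraph.edge? N p q ×-dec ¬? ((p Finₚ.≟ u) ×-dec (q Finₚ.≟ ϱ))) (e , ne)

module ShortCycles {n : ℕ} (N : Network n) where
  open Structure N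

  -- The edge from u to its reticulation child lies on a cycle of length
  -- at most L + 1.
  Short : ℕ → V → Set
  Short L u = ∃[ ϱ ] ((Edge u ϱ × mark ϱ ≡ reticulation) × Within (FiniteGraph.⟦_⟧ (pruned graph u ϱ)) L ϱ u)

  short? : ∀ L u → Dec (Short L u)
  short? L u = Finₚ.any? λ ϱ → (edge? u ϱ ×-dec mark ϱ ≟ᴹ reticulation) ×-dec within? (pruned graph u ϱ) L ϱ u

-- The case `z ≡ y` is left out because the edge above y comes from u itself: inserting u there
-- would change nothing.
record Graft {n : ℕ} (N : Network n) (u z : Fin (Network.order N)) : Set where
  open Network N
  field
    ϱ y : Fin order
    eϱ  : Edge u ϱ
    mϱ  : mark ϱ ≡ reticulation
    ey  : Edge u y
    py  : Plain (mark y)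
    mz  : mark z ≡ tree
    z≢u : z ≢ u
    z≢y : z ≢ y

-- Regrafting at most doubles the length of a walk.
detour : ℕ → ℕ
detour zero    = 1
detour (suc r) = 2 + detour r

-- The tree vertex u is suppressed, so that y becomes the child of its
-- parent, and inserted again into the edge above z. All this amounts to a
-- cyclic permutation of three columns of the adjacency matrix.
module Regraft {n : ℕ} (N : Network n) {u z : Fin (Network.order N)} (graft : Graft N u z) where
  open Structure N
  open Graft graft

  open Rotation y u z public renaming (rot to π)
  open Rotation y z u public using () renaming (rot to π⁻¹; rot-a to π⁻¹-y)

  mu : mark u ≡ tree
  mu = reticulation-parent-tree eϱ mϱ

  u≢y : u ≢ y
  u≢y refl = acyclic u [ ey ]

  π⁻¹∘π : ∀ q → π⁻¹ (π q) ≡ q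
  π⁻¹∘π = rot-inverse u≢y z≢y z≢u

  π∘π⁻¹ : ∀ q → π (π⁻¹ q) ≡ q
  π∘π⁻¹ = rot-inverse z≢y u≢y (z≢u ∘ sym)

  -- The moved vertices u, y and z are tree vertices or leaves. All of them have indegree one, so
  -- permuting their columns changes no indegree although y may differ from the others in mark.
  π-moved : ∀ q → π q ≡ q ⊎ (Plain (mark q) × Plain (mark (π q)))
  π-moved q with position q
  ... | at-a refl = inj₂ (py , subst (Plain ∘ mark) (sym rot-a) (inj₁ mu))
  ... | at-b refl = inj₂ (inj₁ mu , subst (Plain ∘ mark) (sym (rot-b u≢y)) (inj₁ mz))
  ... | at-c refl = inj₂ (inj₁ mz , subst (Plain ∘ mark) (sym (rot-c z≢y z≢u)) py)
  ... | other a b c = inj₁ (rot-other a b c)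

  π-plain : ∀ {q} → Plain (mark q) → Plain (mark (π q))
  π-plain {q} pl with π-moved q
  ... | inj₁ eq = subst (Plain ∘ mark) (sym eq) pl
  ... | inj₂ (_ , pl′) = pl′

  π-plain⁻ : ∀ {q} → Plain (mark (π q)) → Plain (mark q)
  π-plain⁻ {q} pl with π-moved q
  ... | inj₁ eq = subst (Plain ∘ mark) eq pl
  ... | inj₂ (pl′ , _) = pl′

  π-indegree : ∀ q → proj₁ (degrees (mark (π q))) ≡ proj₁ (degrees (mark q))
  π-indegree q with π-moved q
  ... | inj₁ eq = cong (proj₁ ∘ degrees ∘ mark) eq
  ... | inj₂ (pl , pl′) = trans (plain-indegree pl′) (sym (plain-indegree pl))

  graph′ : FiniteGraph
  graph′ = record { order = order ; adj = λ p q → adj p (π q) ; mark = mark }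

  open FiniteGraph graph′ public using () renaming (Edge to Edge′)

  edge⁻¹ : ∀ {p q} → Edge p q → Edge′ p (π⁻¹ q)
  edge⁻¹ {p} {q} e = subst (Edge p) (sym (π∘π⁻¹ q)) e

  to-y : ∀ {p} → Edge p u → Edge′ p y
  to-y {p} = subst (Edge p) (sym rot-a)

  to-u : ∀ {p} → Edge p z → Edge′ p u
  to-u {p} = subst (Edge p) (sym (rot-b u≢y))

  u→z : Edge′ u z
  u→z = subst (Edge u) (sym (rot-c z≢y z≢u)) ey

  to-other : ∀ {p q} → q ≢ y → q ≢ u → q ≢ z → Edge p q → Edge′ p q
  to-other {p} a b c = subst (Edge p) (sym (rot-other a b c))

  plain-child : ∀ {q} → Edge u q → Plain (mark q) → q ≡ y
  plain-child e pl = plain-child-unique eϱ mϱ e ey pl py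

  tree-≢origin : ∀ {v} → mark v ≡ tree → v ≢ origin
  tree-≢origin eq e = case trans (sym eq) (Equivalence.from (root-mark _) e) of λ ()

  -- Among the edges that avoid u only the one into z changes, and it is now subdivided by u. An
  -- edge into y would have to come from u.
  link : ∀ {p q} → p ≢ u → q ≢ u → Edge p q → Edge′ p q ⊎ (Edge′ p u × Edge′ u q)
  link {p} {q} p≢u q≢u e with position q
  ... | at-a refl = contradiction (parent-unique py e ey) p≢u
  ... | at-b refl = contradiction refl q≢u
  ... | at-c refl = inj₂ (to-u e , u→z)
  ... | other a b c = inj₁ (to-other a b c e)

  -- Of the two children of u only y depends on u: the other one is a reticulation and has a second
  -- parent.
  parent-≢u : ∀ {v} → v ≢ origin → v ≢ y → ∃[ p ] (p ≢ u × Edge p v)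
  parent-≢u {v} v≢o v≢y with parent-exists v v≢o
  ... | p , e with plain-or-reticulation e
  ...   | inj₁ pl = p , (λ { refl → v≢y (plain-child e pl) }) , e
  ...   | inj₂ m with reticulation-parents v m
  ...     | a , b , a≢b , ea , eb , _ with a Finₚ.≟ u
  ...       | no a≢u = a , a≢u , ea
  ...       | yes refl = b , (a≢b ∘ sym) , eb

  -- The new place of u may lie below its old descendants, so the recursion never rests on u itself:
  -- y is reached from the old parent of u, and any other vertex from a parent other than u.
  reach-≢u : ∀ v → v ≢ u → Star Edge′ origin v
  reach-≢u = All.wfRec ancestors-wf 0ℓ (λ v → v ≢ u → Star Edge′ origin v) go
    where
    go : ∀ v → (∀ {w} → TransClosure Edge w v → w ≢ u → Star Edge′ origin w) → v ≢ u → Star Edge′ origin v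
    go v ih v≢u with v Finₚ.≟ origin | v Finₚ.≟ y
    ... | yes refl | _ = ε
    ... | no _ | yes refl with parent-exists u (tree-≢origin mu)
    ...   | p , e = ih (e ∷ [ ey ]) (λ { refl → acyclic _ [ e ] }) ◅◅ (to-y e ◅ ε)
    go v ih v≢u | no v≢o | no v≢y with parent-≢u v≢o v≢y
    ... | p , p≢u , e with link p≢u v≢u e
    ...   | inj₁ f = ih [ e ] p≢u ◅◅ (f ◅ ε)
    ...   | inj₂ (f , g) = ih [ e ] p≢u ◅◅ (f ◅ g ◅ ε)

  reach : ∀ v → Star Edge′ origin v
  reach v with v Finₚ.≟ u
  ... | no v≢u = reach-≢u v v≢u
  ... | yes refl with parent-≢u (tree-≢origin mz) z≢y
  ...   | p , p≢u , e = reach-≢u p p≢u ◅◅ (to-u e ◅ ε)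

  valid : Valid graph′ origin labelled
  valid = record
    { ins = λ v → subst (λ k → Exactly k (λ p → Edge′ p v)) (π-indegree v) (in-degree (π v))
    ; outs = λ v → exactly-map π⁻¹ π π∘π⁻¹ π⁻¹∘π (λ _ → edge⁻¹) (λ _ e → e) _ (out-degree v)
    ; root-mark = root-mark ; leaf-mark = leaf-mark ; label-inj = label-inj
    ; reachable = reach
    ; tree-child = λ v ¬l → let (w , e , pl) = tree-child v ¬l in
        π⁻¹ w , edge⁻¹ e , π-plain⁻ (subst (Plain ∘ mark) (sym (π∘π⁻¹ w)) pl)
    ; one-component = one }
    where
    one : ∀ v w → mark v ≡ reticulation → Edge′ v w → mark w ≡ leaf
    one v w m e with position w
    ... | at-a refl = case trans (sym mu) (one-component v u m (subst (Edge v) rot-a e)) of λ ()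
    ... | at-b refl = case trans (sym mz) (one-component v z m (subst (Edge v) (rot-b u≢y) e)) of λ ()
    ... | at-c refl with parent-unique py (subst (Edge v) (rot-c z≢y z≢u) e) ey
    ...   | refl = case trans (sym mu) m of λ ()
    one v w m e | other a b c = one-component v w m (subst (Edge v) (rot-other a b c) e)

  N′ : Network n
  N′ = network valid

  ϱ≢y : ϱ ≢ y
  ϱ≢y refl = reticulation-not-plain mϱ py

  private
    W : ℕ → V → Set
    W r v = Within (FiniteGraph.⟦_⟧ graph′) r u v

    edge-to-ϱ : Edge′ u ϱ
    edge-to-ϱ = to-other ϱ≢y (λ { refl → acyclic _ [ eϱ ] }) (λ { refl → case trans (sym mz) mϱ of λ () }) eϱ

    unprune : ∀ {p q} → FiniteGraph.Edge (pruned graph u ϱ) p q → Edge p q × ¬ (p ≡ u × q ≡ ϱ)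
    unprune {p} {q} = pruned-edge⁻ graph {u} {ϱ} {p} {q}

    -- A walk from ϱ is followed in the new graph until it first comes to u. Coming down from a
    -- parent of u, the new edge leads on to y; coming up from a plain child, that child is y; and
    -- the edge from ϱ itself has been pruned. In each case y turns out to be near u in the new
    -- graph.
    survives : ∀ {r v} → Within (FiniteGraph.⟦_⟧ (pruned graph u ϱ)) r ϱ v → W (suc (detour r)) y ⊎ (v ≢ u × W (detour r) v)
    survives {r} here = inj₂ ((λ { refl → acyclic _ [ eϱ ] }) , one r)
      where
      one : ∀ r → W (detour r) ϱ
      one zero    = step here (inj₁ edge-to-ϱ)
      one (suc r) = step here (inj₁ edge-to-ϱ)
    survives {suc r} {w} (step {u = v} p e) with survives p
    ... | inj₁ done = inj₁ (within-mono (s≤s (ℕₚ.m≤n+m (detour r) 2)) done)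
    ... | inj₂ (v≢u , q) = [ along , against ]′ e
      where
      along : FiniteGraph.Edge (pruned graph u ϱ) v w → W (suc (detour (suc r))) y ⊎ (w ≢ u × W (detour (suc r)) w)
      along e with unprune {v} {w} e | w Finₚ.≟ u
      ... | f , _ | yes refl = inj₁ (within-mono (s≤s (ℕₚ.m≤n+m (detour r) 2)) (step q (inj₁ (to-y f))))
      ... | f , _ | no w≢u with link v≢u w≢u f
      ...   | inj₁ f = inj₂ (w≢u , within-mono (ℕₚ.n≤1+n _) (step q (inj₁ f)))
      ...   | inj₂ (f , g) = inj₂ (w≢u , step (step q (inj₁ f)) (inj₁ g))
      against : FiniteGraph.Edge (pruned graph u ϱ) w v → W (suc (detour (suc r))) y ⊎ (w ≢ u × W (detour (suc r)) w)
      against e with unprune {w} {v} e | w Finₚ.≟ u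
      ... | f , ne | yes refl with plain-or-reticulation f
      ...   | inj₁ pl = inj₁ (within-mono (ℕₚ.m≤n+m (detour r) 3) (subst (W (detour r)) (plain-child f pl) q))
      ...   | inj₂ m = contradiction (refl , reticulation-unique f eϱ m mϱ) ne
      against e | f , _ | no w≢u with link w≢u v≢u f
      ...   | inj₁ f = inj₂ (w≢u , within-mono (ℕₚ.n≤1+n _) (step q (inj₂ f)))
      ...   | inj₂ (f , g) = inj₂ (w≢u , step (step q (inj₂ g)) (inj₂ f))

  short-near : ∀ {L} → Within (FiniteGraph.⟦_⟧ (pruned graph u ϱ)) L ϱ u → Within (FiniteGraph.⟦_⟧ graph′) (suc (detour L)) u y
  short-near w with survives w
  ... | inj₁ near = near
  ... | inj₂ (u≢u , _) = contradiction refl u≢u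

module _ {n : ℕ} {N₁ N₂ : Network n} {u₁ z₁ : Fin (Network.order N₁)} {u₂ z₂ : Fin (Network.order N₂)}
         (g₁ : Graft N₁ u₁ z₁) (g₂ : Graft N₂ u₂ z₂) where
  private
    module S₁ = Structure N₁
    module S₂ = Structure N₂
    module R₁ = Regraft N₁ g₁
    module R₂ = Regraft N₂ g₂
    module G₁ = Graft g₁
    module G₂ = Graft g₂

  module _ (ψ : R₁.N′ ≈ R₂.N′) where
    private module ψ = Iso {M = R₁.N′} {R₂.N′} ψ

    module _ (u-eq : ψ.to u₁ ≡ u₂) (y-eq : ψ.to G₁.y ≡ G₂.y) where

      -- After the regrafting z is the only plain child of u. So the old place y of u is all that
      -- has to be remembered.
      regraft-z : ψ.to z₁ ≡ z₂
      regraft-z = trans (sym (R₂.π⁻¹∘π (ψ.to z₁))) (trans (cong R₂.π⁻¹ child) R₂.π⁻¹-y)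
        where
        child : R₂.π (ψ.to z₁) ≡ G₂.y
        child = R₂.plain-child (subst (λ v → R₂.Edge′ v (ψ.to z₁)) u-eq (ψ.to-edge R₁.u→z))
          (R₂.π-plain (subst Plain (sym (≈-mark {M = R₁.N′} {R₂.N′} ψ z₁)) (inj₁ G₁.mz)))

      private
        -- As `ψ` matches all three rotated vertices, it intertwines the two rotations, so the same
        -- map is an isomorphism of the networks before regrafting.
        conj : ∀ q → ψ.to (R₁.π q) ≡ R₂.π (ψ.to q)
        conj q with R₁.position q
        ... | R₁.at-a refl = trans (cong ψ.to R₁.rot-a) (trans u-eq (sym (trans (cong R₂.π y-eq) R₂.rot-a)))
        ... | R₁.at-b refl = trans (cong ψ.to (R₁.rot-b R₁.u≢y)) (trans regraft-z (sym (trans (cong R₂.π u-eq) (R₂.rot-b R₂.u≢y))))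
        ... | R₁.at-c refl = trans (cong ψ.to (R₁.rot-c G₁.z≢y G₁.z≢u))
                (trans y-eq (sym (trans (cong R₂.π regraft-z) (R₂.rot-c G₂.z≢y G₂.z≢u))))
        ... | R₁.other a b c = trans (cong ψ.to (R₁.rot-other a b c)) (sym (R₂.rot-other
                (λ e → a (ψ.to-injective (trans e (sym y-eq))))
                (λ e → b (ψ.to-injective (trans e (sym u-eq))))
                (λ e → c (ψ.to-injective (trans e (sym regraft-z))))))

      regraft-iso : N₁ ≈ N₂
      regraft-iso = record
        { bijection = ψ.bijection
        ; edge-preserved = λ p q → mk⇔
            (λ e → subst (S₂.Edge (ψ.to p)) (trans (sym (conj (R₁.π⁻¹ q))) (cong ψ.to (R₁.π∘π⁻¹ q))) (ψ.to-edge (R₁.edge⁻¹ e)))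
            (λ e → subst (S₁.Edge p) (R₁.π∘π⁻¹ q) (ψ.from-edge
              (subst (S₂.Edge (ψ.to p)) (sym (trans (sym (conj (R₁.π⁻¹ q))) (cong ψ.to (R₁.π∘π⁻¹ q)))) e)))
        ; label-preserved = ψ.label-preserved }

module FewShort {n : ℕ} (reps : Representatives n) (L : ℕ) where
  open Classes reps

  private
    module S (i : Fin #classes) = Structure (rep i)

    -- The last condition expresses `z ≢ y` without naming y: a tree vertex that is a child of u can
    -- only be its plain child.
    Target : (i : Fin #classes) → Rel (S.V i) 0ℓ
    Target i u z = S.mark i z ≡ tree × z ≢ u × ¬ S.Edge i u z

    target? : ∀ i u z → Dec (Target i u z)
    target? i u z = S.mark i z ≟ᴹ tree ×-dec ¬? (z Finₚ.≟ u) ×-dec ¬? (S.edge? i u z)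

  short? : ∀ i u → Dec (ShortCycles.Short (rep i) L u)
  short? i = ShortCycles.short? (rep i) L

  #short : Fin #classes → ℕ
  #short i = count (short? i)

  private
    sources : ∀ i → List (Σ (S.V i) (λ _ → S.V i))
    sources i = tagged (λ u → select (λ z → short? i u ×-dec target? i u z))

    near? : ∀ i u y → Dec (S.mark i u ≡ tree × Within (S.⟦_⟧ i) (suc (detour L)) u y)
    near? i u y = S.mark i u ≟ᴹ tree ×-dec within? (S.graph i) (suc (detour L)) u y

    goals : ∀ i → List (Σ (S.V i) (λ _ → S.V i))
    goals i = tagged (λ u → select (near? i u))

    -- A source records u and its new place z, a goal the images of u and of its old place y in the
    -- representative of the new network.
    H : Σ (Fin #classes) (λ i → Σ (S.V i) (λ _ → S.V i)) → Σ (Fin #classes) (λ i → Σ (S.V i) (λ _ → S.V i)) → Set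
    H (i , u , z) (j , u′ , y′) = Σ[ g ∈ Graft (rep i) u z ] Σ[ φ ∈ Regraft.N′ (rep i) g ≈ rep j ]
      (_≈_.to φ u ≡ u′ × _≈_.to φ (Graft.y g) ≡ y′)

    singleton : ∀ {m} (a : Fin m) → count (λ z → z Finₚ.≟ a) ≡ 1
    singleton a = exactly⇒count (λ z → z Finₚ.≟ a) 1 (a , refl , λ _ e → e)

    -- The subtracted 2 stands for u and its plain child, the only tree vertices that are excluded
    -- as new places.
    row : ∀ i u → bit (short? i u) * (S.#tree i ∸ 2) ≤ count (λ z → short? i u ×-dec target? i u z)
    row i u with short? i u
    ... | no _ = z≤n
    ... | yes s@(ϱ , (e , m) , _) with S.tree-child i u (S.not-leaf i e)
    ...   | y , ey , py = begin
      1 * (S.#tree i ∸ 2)                                               ≡⟨ ℕₚ.*-identityˡ _ ⟩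
      S.#tree i ∸ 2                                                     ≤⟨ ℕₚ.∸-monoˡ-≤ 2 (begin
        S.#tree i                                                          ≤⟨ count-split (S.of-mark? i tree) (target? i u) exc? split ⟩
        count (target? i u) + count exc?                                   ≤⟨ ℕₚ.+-monoʳ-≤ (count (target? i u)) (count-split exc? (λ z → z Finₚ.≟ u) (λ z → z Finₚ.≟ y) id) ⟩
        count (target? i u) + (count (λ z → z Finₚ.≟ u) + count (λ z → z Finₚ.≟ y)) ≡⟨ cong (count (target? i u) +_) (cong₂ _+_ (singleton u) (singleton y)) ⟩
        count (target? i u) + 2                                            ∎) ⟩
      (count (target? i u) + 2) ∸ 2                                     ≡⟨ ℕₚ.m+n∸n≡m (count (target? i u)) 2 ⟩
      count (target? i u)                                               ≤⟨ count-mono (target? i u) (λ z → yes s ×-dec target? i u z) (s ,_) ⟩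
      count (λ z → yes s ×-dec target? i u z)                           ∎
      where
      open ℕₚ.≤-Reasoning
      exc? : ∀ z → Dec (z ≡ u ⊎ z ≡ y)
      exc? z = (z Finₚ.≟ u) ⊎-dec (z Finₚ.≟ y)
      split : ∀ {z} → S.mark i z ≡ tree → Target i u z ⊎ (z ≡ u ⊎ z ≡ y)
      split {z} mz with z Finₚ.≟ u | S.edge? i u z
      ... | yes eq | _ = inj₂ (inj₁ eq)
      ... | no _ | yes f = inj₂ (inj₂ (S.plain-child-unique i e m f ey (inj₁ mz) py))
      ... | no ne | no ¬f = inj₁ (mz , ne , ¬f)

    sources-length : ∀ i → #short i * (S.#tree i ∸ 2) ≤ length (sources i)
    sources-length i = begin
      #short i * (S.#tree i ∸ 2)                            ≡⟨ ℕₚ.*-comm (#short i) _ ⟩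
      (S.#tree i ∸ 2) * #short i                            ≡⟨ cong ((S.#tree i ∸ 2) *_) (count-sum (short? i)) ⟩
      (S.#tree i ∸ 2) * sum (λ u → bit (short? i u))        ≡⟨ sum-scale (S.#tree i ∸ 2) (λ u → bit (short? i u)) ⟨
      sum (λ u → (S.#tree i ∸ 2) * bit (short? i u))        ≤⟨ sum-mono (λ u → ℕₚ.≤-trans (ℕₚ.≤-reflexive (ℕₚ.*-comm (S.#tree i ∸ 2) _)) (row i u)) ⟩
      sum (λ u → count (λ z → short? i u ×-dec target? i u z)) ≡⟨ length-tagged (λ u → select (λ z → short? i u ×-dec target? i u z)) ⟨
      length (sources i)                                    ∎
      where open ℕₚ.≤-Reasoning

    goals-length : ∀ i → length (goals i) ≤ S.#tree i * 4 ^ suc (detour L)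
    goals-length i = begin
      length (goals i)                                      ≡⟨ length-tagged (λ u → select (near? i u)) ⟩
      sum (λ u → count (near? i u))                         ≤⟨ sum-mono bound ⟩
      sum (λ u → 4 ^ suc (detour L) * bit (S.of-mark? i tree u)) ≡⟨ sum-scale (4 ^ suc (detour L)) (λ u → bit (S.of-mark? i tree u)) ⟩
      4 ^ suc (detour L) * sum (λ u → bit (S.of-mark? i tree u)) ≡⟨ cong (4 ^ suc (detour L) *_) (count-sum (S.of-mark? i tree)) ⟨
      4 ^ suc (detour L) * S.#tree i                        ≡⟨ ℕₚ.*-comm (4 ^ suc (detour L)) _ ⟩
      S.#tree i * 4 ^ suc (detour L)                        ∎
      where
      open ℕₚ.≤-Reasoning
      bound : ∀ u → count (near? i u) ≤ 4 ^ suc (detour L) * bit (S.of-mark? i tree u)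
      bound u with S.mark i u ≟ᴹ tree
      ... | yes m = ℕₚ.≤-trans (count-mono (λ y → yes m ×-dec within? (S.graph i) (suc (detour L)) u y) (within? (S.graph i) (suc (detour L)) u) proj₂)
              (ℕₚ.≤-trans (Balls.#within≤ (rep i) (suc (detour L)) u) (ℕₚ.≤-reflexive (sym (ℕₚ.*-identityʳ (4 ^ suc (detour L))))))
      ... | no ¬m = ℕₚ.≤-trans (ℕₚ.≤-reflexive (exactly⇒count (λ y → no ¬m ×-dec within? (S.graph i) (suc (detour L)) u y) 0 (λ _ (m , _) → ¬m m))) z≤n

    total : ∀ {x} → x ∈ tagged sources → ∃[ y ] (y ∈ tagged goals × H x y)
    total {i , u , z} p with ∈-select⁻ (λ z → short? i u ×-dec target? i u z)
      (∈-tagged⁻ (λ u → select (λ z → short? i u ×-dec target? i u z)) (∈-tagged⁻ sources p))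
    ... | (ϱ , (e , m) , w) , mz , z≢u , ¬uz with S.tree-child i u (S.not-leaf i e)
    ... | y , ey , py with class (Regraft.N′ (rep i) record
             { ϱ = ϱ ; y = y ; eϱ = e ; mϱ = m ; ey = ey ; py = py ; mz = mz ; z≢u = z≢u ; z≢y = λ { refl → ¬uz ey } })
    ... | j , φ = (j , φ.to u , φ.to y) , ∈-tagged⁺ goals j (∈-tagged⁺ (λ u → select (near? j u)) (φ.to u)
            (∈-select⁺ (near? j (φ.to u)) (trans (≈-mark {M = R.N′} {rep j} φ u) R.mu ,
               within-map (R.short-near w))))
            , g , φ , refl , refl
      where
      g : Graft (rep i) u z
      g = record { ϱ = ϱ ; y = y ; eϱ = e ; mϱ = m ; ey = ey ; py = py ; mz = mz ; z≢u = z≢u ; z≢y = λ { refl → ¬uz ey } }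
      module R = Regraft (rep i) g
      module φ = Iso {M = R.N′} {rep j} φ
      within-map : ∀ {r a b} → Within (FiniteGraph.⟦_⟧ R.graph′) r a b → Within (S.⟦_⟧ j) r (φ.to a) (φ.to b)
      within-map here = here
      within-map (step p (inj₁ e)) = step (within-map p) (inj₁ (φ.to-edge e))
      within-map (step p (inj₂ e)) = step (within-map p) (inj₂ (φ.to-edge e))

    injective : ∀ {x x′ y} → x ∈ tagged sources → x′ ∈ tagged sources → H x y → H x′ y → x ≡ x′
    injective {i , u , z} {i′ , u′ , z′} {j , v , w} _ _ (g , φ , eu , ey) (g′ , φ′ , eu′ , ey′)
      with rep-injective i i′ (regraft-iso g g′ ψ u-eq y-eq)
      where
      module R = Regraft (rep i) g
      module R′ = Regraft (rep i′) g′
      ψ : R.N′ ≈ R′.N′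
      ψ = ≈-trans {L = R.N′} {rep j} {R′.N′} φ (≈-sym {M = R′.N′} {rep j} φ′)
      back : ∀ {a b} → _≈_.to φ a ≡ _≈_.to φ′ b → _≈_.to ψ a ≡ b
      back {b = b} eq = trans (cong (_≈_.from φ′) eq) (Iso.from∘to {M = R′.N′} {rep j} φ′ b)
      u-eq : _≈_.to ψ u ≡ u′
      u-eq = back (trans eu (sym eu′))
      y-eq : _≈_.to ψ (Graft.y g) ≡ Graft.y g′
      y-eq = back (trans ey (sym ey′))
    ... | refl = cong₂ (λ u z → i , u , z) (trans (sym (fixed u)) u-eq) (trans (sym (fixed z)) (regraft-z g g′ ψ u-eq y-eq))
      where
      module R = Regraft (rep i) g
      module R′ = Regraft (rep i) g′
      ψ : R.N′ ≈ R′.N′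
      ψ = ≈-trans {L = R.N′} {rep j} {R′.N′} φ (≈-sym {M = R′.N′} {rep j} φ′)
      back : ∀ {a b} → _≈_.to φ a ≡ _≈_.to φ′ b → _≈_.to ψ a ≡ b
      back {b = b} eq = trans (cong (_≈_.from φ′) eq) (Iso.from∘to {M = R′.N′} {rep j} φ′ b)
      u-eq : _≈_.to ψ u ≡ u′
      u-eq = back (trans eu (sym eu′))
      y-eq : _≈_.to ψ (Graft.y g) ≡ Graft.y g′
      y-eq = back (trans ey (sym ey′))
      -- Now that the classes agree, the isomorphism is an automorphism, hence the identity.
      fixed : ∀ v → _≈_.to ψ v ≡ v
      fixed = ≈-unique {M = rep i} {rep i} (regraft-iso g g′ ψ u-eq y-eq) (≈-refl {N = rep i})

  -- A vertex on a short cycle has nearly as many new places as there are tree vertices, while a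
  -- tree vertex has boundedly many candidates for y around it.
  few-short : sum (λ i → #short i * (S.#tree i ∸ 2)) ≤ sum (λ j → S.#tree j * 4 ^ suc (detour L))
  few-short = begin
    sum (λ i → #short i * (S.#tree i ∸ 2))        ≤⟨ sum-mono sources-length ⟩
    sum (λ i → length (sources i))                ≡⟨ length-tagged sources ⟨
    length (tagged sources)                       ≤⟨ length-injection (tagged goals) H
      (tagged-unique sources (λ i → tagged-unique _ (λ u → select-unique (λ z → short? i u ×-dec target? i u z)))) total injective ⟩
    length (tagged goals)                         ≡⟨ length-tagged goals ⟩
    sum (λ j → length (goals j))                  ≤⟨ sum-mono goals-length ⟩
    sum (λ j → S.#tree j * 4 ^ suc (detour L))    ∎
    where open ℕₚ.≤-Reasoning

-- Branching vertices are rare: switching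

exactly-image : {P : A → Set} {Q : B → Set} (f : A → B) → (∀ {x y} → f x ≡ f y → x ≡ y) →
  (∀ x → P x → Q (f x)) → (∀ y → Q y → ∃[ x ] (P x × y ≡ f x)) → ∀ k → Exactly k P → Exactly k Q
exactly-image f inj to from 0 none y q with from y q
... | x , p , _ = none x p
exactly-image {Q = Q} f inj to from 1 (a , pa , only) = f a , to a pa , unique
  where
  unique : ∀ y → Q y → y ≡ f a
  unique y q with from y q
  ... | x , p , refl = cong f (only x p)
exactly-image {Q = Q} f inj to from 2 (a , b , a≢b , pa , pb , only) = f a , f b , (λ e → a≢b (inj e)) , to a pa , to b pb , unique
  where
  unique : ∀ y → Q y → y ≡ f a ⊎ y ≡ f b
  unique y q with from y q
  ... | x , p , refl = [ (λ e → inj₁ (cong f e)) , (λ e → inj₂ (cong f e)) ]′ (only x p)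

-- The condition `not-below` prevents a cycle: w is placed just above a and becomes the parent of z,
-- so a must not descend from z.
record Switchable {n : ℕ} (N : Network n) (v a z : Fin (Network.order N)) : Set where
  open Structure N
  field
    branching : Branching v
    free      : FreeLeaf a
    ez        : Edge v z
    not-below : ¬ Star Edge z a

-- A new tree vertex w, numbered 0, is inserted into the edge above the
-- leaf a and becomes the parent of z; a new reticulation, numbered 1, with
-- parents v and w becomes the parent of a.
module Switch {n : ℕ} (N : Network n) {v a z : Fin (Network.order N)} (sw : Switchable N v a z) where
  open Structure N
  open Switchable sw

  pattern w = zero
  pattern ϱ = suc zero
  pattern old q = suc (suc q)

  ma : mark a ≡ leaf
  ma = proj₁ free

  pz : Plain (mark z)
  pz with plain-or-reticulation ez
  ... | inj₁ pl = pl
  ... | inj₂ m  = contradiction (z , ez , m) (proj₂ branching)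

  a≢z : a ≢ z
  a≢z refl = not-below ε

  leaf-≢origin : ∀ {q} → Plain (mark q) → q ≢ origin
  leaf-≢origin pl e with Equivalence.from (root-mark _) e
  ... | eq = case subst Plain eq pl of λ { (inj₁ ()) ; (inj₂ ()) }

  x : V
  x = proj₁ (parent-exists a (leaf-≢origin (inj₂ ma)))

  ex : Edge x a
  ex = proj₂ (parent-exists a (leaf-≢origin (inj₂ ma)))

  kept? : ∀ p q → Dec (Edge p q × q ≢ a × q ≢ z)
  kept? p q = edge? p q ×-dec ¬? (q Finₚ.≟ a) ×-dec ¬? (q Finₚ.≟ z)

  adj′ : Fin (2 + order) → Fin (2 + order) → Bool
  adj′ w       w       = false
  adj′ w       ϱ       = true
  adj′ w       (old q) = does (q Finₚ.≟ z)
  adj′ ϱ       (old q) = does (q Finₚ.≟ a)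
  adj′ ϱ       _       = false
  adj′ (old p) w       = adj p a
  adj′ (old p) ϱ       = adj p z
  adj′ (old p) (old q) = does (kept? p q)

  mark′ : Fin (2 + order) → Mark
  mark′ w       = tree
  mark′ ϱ       = reticulation
  mark′ (old q) = mark q

  graph′ : FiniteGraph
  graph′ = record { order = 2 + order ; adj = adj′ ; mark = mark′ }

  open FiniteGraph graph′ public using () renaming (Edge to Edge′)

  -- The end in the new graph of an edge to q.
  end : V → Fin (2 + order)
  end q with q Finₚ.≟ a | q Finₚ.≟ z
  ... | yes _ | _     = w
  ... | no  _ | yes _ = ϱ
  ... | no  _ | no  _ = old q

  end-a : end a ≡ w
  end-a with a Finₚ.≟ a
  ... | yes _ = refl
  ... | no ne = contradiction refl ne

  end-z : end z ≡ ϱ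
  end-z with z Finₚ.≟ a | z Finₚ.≟ z
  ... | yes e | _     = contradiction (sym e) a≢z
  ... | no  _ | yes _ = refl
  ... | no  _ | no ne = contradiction refl ne

  end-other : ∀ {q} → q ≢ a → q ≢ z → end q ≡ old q
  end-other {q} qa qz with q Finₚ.≟ a | q Finₚ.≟ z
  ... | yes e | _     = contradiction e qa
  ... | no  _ | yes e = contradiction e qz
  ... | no  _ | no  _ = refl

  end-injective : ∀ {q r} → end q ≡ end r → q ≡ r
  end-injective {q} {r} with q Finₚ.≟ a | q Finₚ.≟ z | r Finₚ.≟ a | r Finₚ.≟ z
  ... | yes refl | _        | yes refl | _        = λ _ → refl
  ... | yes refl | _        | no _     | yes refl = λ ()
  ... | yes refl | _        | no _     | no _     = λ ()
  ... | no _     | yes refl | yes refl | _        = λ ()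
  ... | no _     | yes refl | no _     | yes refl = λ _ → refl
  ... | no _     | yes refl | no _     | no _     = λ ()
  ... | no _     | no _     | yes refl | _        = λ ()
  ... | no _     | no _     | no _     | yes refl = λ ()
  ... | no _     | no _     | no _     | no _     = Finₚ.suc-injective ∘ Finₚ.suc-injective

  edge-end : ∀ {p q} → Edge p q → Edge′ (old p) (end q)
  edge-end {p} {q} e with q Finₚ.≟ a | q Finₚ.≟ z
  ... | yes refl | _        = e
  ... | no _     | yes refl = e
  ... | no qa    | no qz    = T-from (kept? p q) (e , qa , qz)

  edge-end⁻ : ∀ {p} y → Edge′ (old p) y → ∃[ q ] (Edge p q × y ≡ end q)
  edge-end⁻ w e = a , e , sym end-a
  edge-end⁻ ϱ e = z , e , sym end-z
  edge-end⁻ {p} (old q) e with T-to (kept? p q) e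
  ... | f , qa , qz = q , f , sym (end-other qa qz)

  kept⁻ : ∀ {p q} → Edge′ (old p) (old q) → Edge p q
  kept⁻ {p} {q} e = proj₁ (T-to (kept? p q) e)

  w→z : Edge′ w (old z)
  w→z = T-from (z Finₚ.≟ z) refl

  ϱ→a : Edge′ ϱ (old a)
  ϱ→a = T-from (a Finₚ.≟ a) refl

  w-children : ∀ q → Edge′ w q → q ≡ ϱ ⊎ q ≡ old z
  w-children ϱ       _ = inj₁ refl
  w-children (old q) e = inj₂ (cong (λ q → old q) (T-to (q Finₚ.≟ z) e))

  ϱ-child : ∀ q → Edge′ ϱ q → q ≡ old a
  ϱ-child (old q) e = cong (λ q → old q) (T-to (q Finₚ.≟ a) e)

  ins : ∀ q → Exactly (proj₁ (degrees (mark′ q))) (λ p → Edge′ p q)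
  ins w = old x , ex , λ { w () ; ϱ () ; (old p) e → cong (λ q → old q) (parent-unique (inj₂ ma) e ex) }
  ins ϱ = w , old v , (λ ()) , tt , ez , λ
    { w _ → inj₁ refl ; ϱ () ; (old p) e → inj₂ (cong (λ q → old q) (parent-unique pz e ez)) }
  ins (old q) = by (q Finₚ.≟ a) (q Finₚ.≟ z)
    where
    by : Dec (q ≡ a) → Dec (q ≡ z) → Exactly (proj₁ (degrees (mark q))) (λ p → Edge′ p (old q))
    by (yes refl) _ = subst (λ k → Exactly k (λ p → Edge′ p (old a))) (sym (plain-indegree (inj₂ ma)))
      (ϱ , ϱ→a , λ { w e → contradiction (T-to (a Finₚ.≟ z) e) a≢z ; ϱ _ → refl
                   ; (old p) e → contradiction refl (proj₁ (proj₂ (T-to (kept? p a) e))) })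
    by (no _) (yes refl) = subst (λ k → Exactly k (λ p → Edge′ p (old z))) (sym (plain-indegree pz))
      (w , w→z , λ { w _ → refl ; ϱ e → contradiction (sym (T-to (z Finₚ.≟ a) e)) a≢z
                   ; (old p) e → contradiction refl (proj₂ (proj₂ (T-to (kept? p z) e))) })
    by (no qa) (no qz) = lift-exactly (λ e → qz (T-to (q Finₚ.≟ z) e)) (λ e → qa (T-to (q Finₚ.≟ a) e))
      (λ p e → T-from (kept? p q) (e , qa , qz)) (λ _ → kept⁻) _ (in-degree q)

  outs : ∀ p → Exactly (proj₂ (degrees (mark′ p))) (λ q → Edge′ p q)
  outs w = ϱ , old z , (λ ()) , tt , w→z , w-children
  outs ϱ = old a , ϱ→a , ϱ-child
  outs (old p) = exactly-image end end-injective (λ _ → edge-end) edge-end⁻ _ (out-degree p)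

  private
    Reached : Fin (2 + order) → Set
    Reached = Star Edge′ (old origin)

    extend : ∀ {p q} → Edge′ p q → Reached p → Reached q
    extend e s = s ◅◅ (e ◅ ε)

    -- In the new graph z hangs from w and thus from x, the parent of a. So x has to be reached
    -- without passing through z, which is possible because x is not below z.
    reach-above : ∀ q → ¬ Star Edge z q → q ≢ a → Reached (old q)
    reach-above = All.wfRec ancestors-wf 0ℓ (λ q → ¬ Star Edge z q → q ≢ a → Reached (old q)) go
      where
      go : ∀ q → (∀ {p} → TransClosure Edge p q → ¬ Star Edge z p → p ≢ a → Reached (old p)) →
        ¬ Star Edge z q → q ≢ a → Reached (old q)
      go q ih above q≢a with q Finₚ.≟ origin
      ... | yes refl = ε
      ... | no q≢o with parent-exists q q≢o
      ...   | p , e = extend {old p} {old q} (T-from (kept? p q) (e , q≢a , λ { refl → above ε }))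
              (ih [ e ] (λ s → above (s ◅◅ (e ◅ ε))) (λ { refl → leaf-no-child ma e }))

    reach-w : Reached w
    reach-w = extend {old x} {w} ex (reach-above x (λ s → not-below (s ◅◅ (ex ◅ ε))) (λ e → leaf-no-child (trans (cong mark e) ma) ex))

    reach-ϱ : Reached ϱ
    reach-ϱ = extend {w} {ϱ} tt reach-w

    reach-old : ∀ q → Reached (old q)
    reach-old = All.wfRec ancestors-wf 0ℓ (Reached ∘ (λ q → old q)) go
      where
      go : ∀ q → (∀ {p} → TransClosure Edge p q → Reached (old p)) → Reached (old q)
      go q ih with q Finₚ.≟ origin | q Finₚ.≟ a | q Finₚ.≟ z
      ... | yes refl | _        | _        = ε
      ... | no _     | yes refl | _        = extend {ϱ} {old a} ϱ→a reach-ϱ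
      ... | no _     | no _     | yes refl = extend {w} {old z} w→z reach-w
      ... | no q≢o   | no qa    | no qz with parent-exists q q≢o
      ...   | p , e = extend {old p} {old q} (T-from (kept? p q) (e , qa , qz)) (ih [ e ])

    child′ : ∀ {p c} → Edge p c → Plain (mark c) → c ≢ z → ∃[ c′ ] (Edge′ (old p) c′ × Plain (mark′ c′))
    child′ {p} {c} e pl c≢z with c Finₚ.≟ a
    ... | yes refl = w , e , inj₁ refl
    ... | no c≢a = old c , T-from (kept? p c) (e , c≢a , c≢z) , pl

    sibling : ∃[ y ] (y ≢ z × Edge v y)
    sibling with tree-children v (proj₁ branching)
    ... | b , c , b≢c , eb , ec , only with only z ez
    ...   | inj₁ refl = c , b≢c ∘ sym , ec
    ...   | inj₂ refl = b , b≢c , eb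

    -- Only v loses the plain child z, and being branching it has another one. A lost child a is
    -- replaced by the tree vertex w.
    child : ∀ p → mark p ≢ leaf → ∃[ c′ ] (Edge′ (old p) c′ × Plain (mark′ c′))
    child p ¬l with p Finₚ.≟ v
    ... | no p≢v = let (c , e , pl) = tree-child p ¬l in child′ e pl (λ { refl → p≢v (parent-unique pz e ez) })
    ... | yes refl with sibling
    ...   | y , y≢z , e with plain-or-reticulation e
    ...     | inj₁ pl = child′ e pl y≢z
    ...     | inj₂ m  = contradiction (y , e , m) (proj₂ branching)

  valid : Valid graph′ (old origin) (λ i → old (labelled i))
  valid = record
    { ins = ins ; outs = outs
    ; root-mark = λ
      { w → mk⇔ (λ ()) (λ ()) ; ϱ → mk⇔ (λ ()) (λ ())
      ; (old q) → mk⇔ (λ e → cong (λ q → old q) (Equivalence.to (root-mark q) e))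
                      (λ e → Equivalence.from (root-mark q) (Finₚ.suc-injective (Finₚ.suc-injective e))) }
    ; leaf-mark = λ
      { w → mk⇔ (λ ()) (λ ()) ; ϱ → mk⇔ (λ ()) (λ ())
      ; (old q) → mk⇔ (λ e → let (i , eq) = Equivalence.to (leaf-mark q) e in i , cong (λ q → old q) eq)
                      (λ (i , e) → Equivalence.from (leaf-mark q) (i , Finₚ.suc-injective (Finₚ.suc-injective e))) }
    ; label-inj = λ i j e → label-inj i j (Finₚ.suc-injective (Finₚ.suc-injective e))
    ; reachable = λ { w → reach-w ; ϱ → reach-ϱ ; (old q) → reach-old q }
    ; tree-child = λ { w _ → old z , w→z , pz ; ϱ _ → old a , ϱ→a , inj₂ ma ; (old p) ¬l → child p ¬l }
    ; one-component = λ
      { w _ () ; ϱ w _ () ; ϱ ϱ _ () ; ϱ (old q) _ e → trans (cong mark (T-to (q Finₚ.≟ a) e)) ma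
      ; (old p) w m e → contradiction (p , e , m) (proj₂ free)
      ; (old p) ϱ m e → case trans (sym m) (trans (cong mark (parent-unique pz e ez)) (proj₁ branching)) of λ ()
      ; (old p) (old q) m e → one-component p q m (kept⁻ e) } }

  N′ : Network n
  N′ = network valid

module _ {n : ℕ} {N₁ N₂ : Network n} {v₁ a₁ z₁ : Fin (Network.order N₁)} {v₂ a₂ z₂ : Fin (Network.order N₂)}
         (s₁ : Switchable N₁ v₁ a₁ z₁) (s₂ : Switchable N₂ v₂ a₂ z₂) where
  private
    module S₁ = Structure N₁
    module S₂ = Structure N₂
    module W₁ = Switch N₁ s₁
    module W₂ = Switch N₂ s₂
    open W₁ using (w; ϱ; old)

  module SwitchIso (ψ : W₁.N′ ≈ W₂.N′) (w-eq : _≈_.to ψ w ≡ w) where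
    private
      module ψ = Iso {M = W₁.N′} {W₂.N′} ψ

      marks : ∀ q → W₂.mark′ (ψ.to q) ≡ W₁.mark′ q
      marks = ≈-mark {M = W₁.N′} {W₂.N′} ψ

      w-child : ∀ {q} → W₁.Edge′ w q → W₂.Edge′ w (ψ.to q)
      w-child {q} e = subst (λ p → W₂.Edge′ p (ψ.to q)) w-eq (ψ.to-edge {w} {q} e)

      -- The two children of w are told apart by their marks, as z is plain. Then a is the child of
      -- ϱ, and v is the old parent of ϱ.
      ϱ-eq : ψ.to ϱ ≡ ϱ
      ϱ-eq = [ id , (λ eq → contradiction W₂.pz (S₂.reticulation-not-plain (trans (sym (cong W₂.mark′ eq)) (marks ϱ)))) ]′
        (W₂.w-children (ψ.to ϱ) (w-child {ϱ} tt))

      z-eq : ψ.to (old z₁) ≡ old z₂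
      z-eq = [ (λ eq → contradiction W₁.pz (S₁.reticulation-not-plain (trans (sym (marks (old z₁))) (cong W₂.mark′ eq)))) , id ]′
        (W₂.w-children (ψ.to (old z₁)) (w-child {old z₁} W₁.w→z))

      a-eq : ψ.to (old a₁) ≡ old a₂
      a-eq = W₂.ϱ-child (ψ.to (old a₁)) (subst (λ p → W₂.Edge′ p (ψ.to (old a₁))) ϱ-eq (ψ.to-edge {ϱ} {old a₁} W₁.ϱ→a))

      restrict : ∀ v → ∃[ u ] ψ.to (old v) ≡ old u
      restrict v with ψ.to (old v) in eq
      ... | w = case ψ.to-injective {w} {old v} (trans w-eq (sym eq)) of λ ()
      ... | ϱ = case ψ.to-injective {ϱ} {old v} (trans ϱ-eq (sym eq)) of λ ()
      ... | old u = u , refl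

    χ : S₁.V → S₂.V
    χ v = proj₁ (restrict v)

    old-χ : ∀ v → ψ.to (old v) ≡ old (χ v)
    old-χ v = proj₂ (restrict v)

    private
      old-injective : ∀ {m} {p q : Fin m} → _≡_ {A = Fin (2 + m)} (old p) (old q) → p ≡ q
      old-injective refl = refl

      corestrict : ∀ u → ∃[ v ] χ v ≡ u
      corestrict u with ψ.from (old u) in eq
      ... | w = case trans (sym (ψ.to∘from (old u))) (trans (cong ψ.to eq) w-eq) of λ ()
      ... | ϱ = case trans (sym (ψ.to∘from (old u))) (trans (cong ψ.to eq) ϱ-eq) of λ ()
      ... | old v = v , old-injective (trans (sym (old-χ v)) (trans (cong ψ.to (sym eq)) (ψ.to∘from (old u))))

      χ-injective : ∀ {p q} → χ p ≡ χ q → p ≡ q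
      χ-injective {p} {q} e = old-injective (ψ.to-injective (trans (old-χ p) (trans (cong (λ q → old q) e) (sym (old-χ q)))))

    χ-a : χ a₁ ≡ a₂
    χ-a = old-injective (trans (sym (old-χ a₁)) a-eq)

    private
      χ-z : χ z₁ ≡ z₂
      χ-z = old-injective (trans (sym (old-χ z₁)) z-eq)

      -- The vertices a and z correspond, and so do w and ϱ, which replace them as ends of edges.
      -- Hence redirecting edges commutes with the isomorphism, and the original edges are
      -- preserved.
      conj : ∀ q → ψ.to (W₁.end q) ≡ W₂.end (χ q)
      conj q = by (q Finₚ.≟ a₁) (q Finₚ.≟ z₁)
        where
        by : Dec (q ≡ a₁) → Dec (q ≡ z₁) → ψ.to (W₁.end q) ≡ W₂.end (χ q)
        by (yes refl) _ = trans (cong ψ.to W₁.end-a) (trans w-eq (sym (trans (cong W₂.end χ-a) W₂.end-a)))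
        by (no _) (yes refl) = trans (cong ψ.to W₁.end-z) (trans ϱ-eq (sym (trans (cong W₂.end χ-z) W₂.end-z)))
        by (no qa) (no qz) = trans (cong ψ.to (W₁.end-other qa qz)) (trans (old-χ q)
          (sym (W₂.end-other (λ e → qa (χ-injective (trans e (sym χ-a)))) (λ e → qz (χ-injective (trans e (sym χ-z)))))))

      end⇒edge₁ : ∀ {p q} → W₁.Edge′ (old p) (W₁.end q) → S₁.Edge p q
      end⇒edge₁ {p} {q} e with W₁.edge-end⁻ (W₁.end q) e
      ... | r , f , eq with W₁.end-injective eq
      ...   | refl = f

      end⇒edge₂ : ∀ {p q} → W₂.Edge′ (old p) (W₂.end q) → S₂.Edge p q
      end⇒edge₂ {p} {q} e with W₂.edge-end⁻ (W₂.end q) e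
      ... | r , f , eq with W₂.end-injective eq
      ...   | refl = f

    switch-iso : N₁ ≈ N₂
    switch-iso = record
      { bijection = mk↔ₛ′ χ (proj₁ ∘ corestrict) (proj₂ ∘ corestrict)
          (λ v → χ-injective (proj₂ (corestrict (χ v))))
      ; edge-preserved = λ p q → mk⇔
          (λ e → end⇒edge₂ (subst₂ W₂.Edge′ (old-χ p) (conj q) (ψ.to-edge {old p} {W₁.end q} (W₁.edge-end e))))
          (λ e → end⇒edge₁ (ψ.from-edge {old p} {W₁.end q} (subst₂ W₂.Edge′ (sym (old-χ p)) (sym (conj q)) (W₂.edge-end e))))
      ; label-preserved = λ i → old-injective (trans (sym (old-χ _)) (ψ.label-preserved i)) }

    χ-v : χ v₁ ≡ v₂
    χ-v = S₂.parent-unique W₂.pz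
      (subst₂ W₂.Edge′ (old-χ v₁) ϱ-eq (ψ.to-edge {old v₁} {ϱ} (Switchable.ez s₁))) (Switchable.ez s₂)

-- Ancestors of free leaves

module Ancestry {n : ℕ} (N : Network n) where
  open Structure N

  star-last : ∀ {u v} → Star Edge u v → u ≡ v ⊎ (∃[ q ] (Star Edge u q × Edge q v))
  star-last s with star⇒plus s
  ... | inj₁ eq = inj₁ eq
  ... | inj₂ p  = inj₂ (plus-last p)

  -- These vertices have no reticulation among their ancestors, since a reticulation is a parent of
  -- a leaf only.
  Free : V → Set
  Free q = mark q ≡ tree ⊎ FreeLeaf q

  free-plain : ∀ {q} → Free q → Plain (mark q)
  free-plain (inj₁ m) = inj₁ m
  free-plain (inj₂ (m , _)) = inj₂ m

  free-parent : ∀ {p q} → Free q → Edge p q → mark p ≢ root → Free p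
  free-parent {p} {q} f e ¬r with mark p in eq
  ... | root = contradiction refl ¬r
  ... | tree = inj₁ refl
  ... | leaf = contradiction e (leaf-no-child eq)
  free-parent {p} {q} (inj₁ m) e ¬r | reticulation = case trans (sym m) (one-component p q eq e) of λ ()
  free-parent {p} {q} (inj₂ (_ , ¬h)) e ¬r | reticulation = contradiction (p , e , eq) ¬h

  -- Going up from a free vertex, parents are unique. A vertex below y is not the root since y is
  -- not, so the recursion stays among free vertices.
  ancestors-chain : ∀ {y z} → y ≢ origin → ∀ q → Free q → Star Edge y q → Star Edge z q → Star Edge y z ⊎ Star Edge z y
  ancestors-chain {y} {z} y≢o = All.wfRec ancestors-wf 0ℓ (λ q → Free q → Star Edge y q → Star Edge z q → Star Edge y z ⊎ Star Edge z y) go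
    where
    below-root : ∀ {p} → Star Edge y p → mark p ≢ root
    below-root s m with star-last s
    ... | inj₁ refl = y≢o (Equivalence.to (root-mark _) m)
    ... | inj₂ (_ , _ , e) = target-not-root e m
    go : ∀ q → (∀ {p} → TransClosure Edge p q → Free p → Star Edge y p → Star Edge z p → Star Edge y z ⊎ Star Edge z y) →
      Free q → Star Edge y q → Star Edge z q → Star Edge y z ⊎ Star Edge z y
    go q ih f sy sz with star-last sy | star-last sz
    ... | inj₁ refl | _ = inj₂ sz
    ... | inj₂ _ | inj₁ refl = inj₁ sy
    ... | inj₂ (p , sp , e) | inj₂ (p′ , sp′ , e′) with parent-unique (free-plain f) e e′
    ...   | refl = ih [ e ] (free-parent f e (below-root sp)) sp sp′

  -- A path from y to z would enter z through its only parent v, which is also a parent of y.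
  below-sibling : ∀ {v y z} → y ≢ z → Edge v y → Edge v z → Plain (mark z) → ¬ Star Edge y z
  below-sibling y≢z ey ez pz s with star-last s
  ... | inj₁ eq = y≢z eq
  ... | inj₂ (q , s′ , e) with parent-unique pz e ez
  ...   | refl = acyclic _ (subst (TransClosure Edge _) refl (case star⇒plus s′ of λ { (inj₁ refl) → [ ey ] ; (inj₂ p) → ey ∷ p }))

  -- If both children of v were above a, they would be comparable, as the ancestors of a free leaf
  -- form a chain; but siblings are not.
  switchable : ∀ {v a} → Branching v → FreeLeaf a → ∃[ z ] Switchable N v a z
  switchable {v} {a} br fr with tree-children v (proj₁ br)
  ... | y , z , y≢z , ey , ez , _ with star? edge? y a
  ...   | no ¬s = y , record { branching = br ; free = fr ; ez = ey ; not-below = ¬s }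
  ...   | yes sy = z , record { branching = br ; free = fr ; ez = ez ; not-below = λ sz →
            [ below-sibling y≢z ey ez (plain ez) , below-sibling (y≢z ∘ sym) ez ey (plain ey) ]′
              (ancestors-chain (no-parent ey) a (inj₂ fr) sy sz) }
    where
    plain : ∀ {c} → Edge v c → Plain (mark c)
    plain e with plain-or-reticulation e
    ... | inj₁ pl = pl
    ... | inj₂ m = contradiction (_ , e , m) (proj₂ br)

count-× : {P : Set} {Q : Pred (Fin n) 0ℓ} (P? : Dec P) (Q? : Decidable Q) →
  count Q? * bit P? ≡ count (λ a → P? ×-dec Q? a)
count-× (yes p) Q? = trans (ℕₚ.*-identityʳ _) (ℕₚ.≤-antisym
  (count-mono Q? (λ a → yes p ×-dec Q? a) (p ,_)) (count-mono (λ a → yes p ×-dec Q? a) Q? proj₂))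
count-× (no ¬p) Q? = trans (ℕₚ.*-zeroʳ (count Q?)) (sym (exactly⇒count (λ a → no ¬p ×-dec Q? a) 0 (λ _ (p , _) → ¬p p)))

module FewBranching {n : ℕ} (reps : Representatives n) where
  open Classes reps

  private
    module S (i : Fin #classes) = Structure (rep i)

    source? : ∀ i v a → Dec (S.Branching i v × S.FreeLeaf i a)
    source? i v a = S.branching? i v ×-dec S.freeLeaf? i a

    sources : ∀ i → List (Σ (S.V i) (λ _ → S.V i))
    sources i = tagged (λ v → select (source? i v))

    goals : ∀ i → List (S.V i)
    goals i = select (S.of-mark? i tree)

    H : Σ (Fin #classes) (λ i → Σ (S.V i) (λ _ → S.V i)) → Σ (Fin #classes) S.V → Set
    H (i , v , a) (j , w) = ∃[ z ] Σ[ s ∈ Switchable (rep i) v a z ] Σ[ φ ∈ Switch.N′ (rep i) s ≈ rep j ] (_≈_.to φ zero ≡ w)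

    sources-length : ∀ i → S.#branching i * S.#freeLeaf i ≡ length (sources i)
    sources-length i = begin
      S.#branching i * S.#freeLeaf i                           ≡⟨ ℕₚ.*-comm (S.#branching i) _ ⟩
      S.#freeLeaf i * S.#branching i                           ≡⟨ cong (S.#freeLeaf i *_) (count-sum (S.branching? i)) ⟩
      S.#freeLeaf i * sum (λ v → bit (S.branching? i v))       ≡⟨ sum-scale (S.#freeLeaf i) (λ v → bit (S.branching? i v)) ⟨
      sum (λ v → S.#freeLeaf i * bit (S.branching? i v))       ≡⟨ sum-cong-≗ row ⟩
      sum (λ v → count (source? i v))                          ≡⟨ length-tagged (λ v → select (source? i v)) ⟨
      length (sources i)                                       ∎
      where
      open ≡-Reasoning
      row : ∀ v → S.#freeLeaf i * bit (S.branching? i v) ≡ count (source? i v)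
      row v = count-× (S.branching? i v) (S.freeLeaf? i)

    total : ∀ {x} → x ∈ tagged sources → ∃[ y ] (y ∈ tagged goals × H x y)
    total {i , v , a} p with ∈-select⁻ (source? i v) (∈-tagged⁻ (λ v → select (source? i v)) (∈-tagged⁻ sources p))
    ... | br , fr with Ancestry.switchable (rep i) br fr
    ...   | z , s with class (Switch.N′ (rep i) s)
    ...     | j , φ = (j , _≈_.to φ zero) , ∈-tagged⁺ goals j
      (∈-select⁺ (S.of-mark? j tree) (≈-mark {M = Switch.N′ (rep i) s} {rep j} φ zero)) , z , s , φ , refl

    injective : ∀ {x x′ y} → x ∈ tagged sources → x′ ∈ tagged sources → H x y → H x′ y → x ≡ x′
    injective {i , v , a} {i′ , v′ , a′} {j , w} _ _ (z , s , φ , e) (z′ , s′ , φ′ , e′) = merge (rep-injective i i′ switch-iso)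
      where
      M M′ : Network n
      M = Switch.N′ (rep i) s
      M′ = Switch.N′ (rep i′) s′
      ψ : M ≈ M′
      ψ = ≈-trans {L = M} {rep j} {M′} φ (≈-sym {M = M′} {rep j} φ′)
      w-eq : _≈_.to ψ zero ≡ zero
      w-eq = trans (cong (_≈_.from φ′) (trans e (sym e′))) (Iso.from∘to {M = M′} {rep j} φ′ zero)
      open SwitchIso s s′ ψ w-eq
      merge : i ≡ i′ → (i , v , a) ≡ (i′ , v′ , a′)
      merge refl = cong₂ (λ v a → i , v , a) (trans (sym (fixed v)) χ-v) (trans (sym (fixed a)) χ-a)
        where
        fixed : ∀ u → χ u ≡ u
        fixed = ≈-unique {M = rep i} {rep i} switch-iso (≈-refl {N = rep i})

  -- The image of w alone determines the source, so no constant is lost.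
  few-branching : sum (λ i → S.#branching i * S.#freeLeaf i) ≤ sum (λ j → S.#tree j)
  few-branching = begin
    sum (λ i → S.#branching i * S.#freeLeaf i)    ≡⟨ sum-cong-≗ sources-length ⟩
    sum (λ i → length (sources i))                ≡⟨ length-tagged sources ⟨
    length (tagged sources)                       ≤⟨ length-injection (tagged goals) H
      (tagged-unique sources (λ i → tagged-unique _ (λ v → select-unique (source? i v)))) total injective ⟩
    length (tagged goals)                         ≡⟨ length-tagged goals ⟩
    sum (λ j → S.#tree j)                         ∎
    where open ℕₚ.≤-Reasoning

-- Neighbourhoods without special vertices

module Cycles {n : ℕ} (N : Network n) where
  open Structure N
  open ShortCycles N

  -- A simple cycle of the underlying graph, given as a sequence of which only the indices up to `l`
  -- matter. Length two is excluded, being one edge passed back and forth.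
  module _ (c : ℕ → V) (l : ℕ) (3≤l : 3 ≤ l)
           (joined : ∀ k → k < l → Edge (c k) (c (suc k)) ⊎ Edge (c (suc k)) (c k))
           (closed : c 0 ≡ c l)
           (distinct : ∀ i j → i < j → j ≤ l → ¬ (i ≡ 0 × j ≡ l) → c i ≢ c j) where

    private
      Down Up : ℕ → Set
      Down k = Edge (c k) (c (suc k))
      Up   k = Edge (c (suc k)) (c k)

      <-distinct : ∀ {i j} → i < l → j < l → c i ≡ c j → i ≡ j
      <-distinct {i} {j} i<l j<l eq with ℕₚ.<-cmp i j
      ... | tri< i<j _ _ = contradiction eq (distinct i j i<j (ℕₚ.<⇒≤ j<l) (λ (_ , e) → ℕₚ.<⇒≢ j<l e))
      ... | tri≈ _ e _   = e
      ... | tri> _ _ j<i = contradiction (sym eq) (distinct j i j<i (ℕₚ.<⇒≤ i<l) (λ (_ , e) → ℕₚ.<⇒≢ i<l e))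

      -- The way round the cycle that avoids the edge from c j to c (j + 1).
      round : ∀ j p → suc j + p ≡ l → Down j → mark (c (suc j)) ≡ reticulation →
        (∀ k → k < l → c (suc k) ≡ c j → c k ≢ c (suc j)) → ∃[ L ] (suc L ≡ l × Short L (c j))
      round j p eq d m apart = p + j , trans (sym (cong suc (ℕₚ.+-comm j p))) eq , c (suc j) , (d , m) , arc j ℕₚ.≤-refl
        where
        P : FiniteGraph
        P = pruned graph (c j) (c (suc j))
        j<l : j < l
        j<l = subst (j <_) eq (s≤s (ℕₚ.m≤m+n j p))
        link : ∀ k → k < l → k ≢ j → FiniteGraph.Edge P (c k) (c (suc k)) ⊎ FiniteGraph.Edge P (c (suc k)) (c k)
        link k k<l k≢j with joined k k<l
        ... | inj₁ e = inj₁ (pruned-edge⁺ graph {c j} {c (suc j)} {c k} {c (suc k)} e (λ (e₁ , _) → k≢j (<-distinct k<l j<l e₁)))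
        -- An edge passed upwards could be the deleted one only if the cycle used that edge in both
        -- directions, which `apart` forbids.
        ... | inj₂ e = inj₂ (pruned-edge⁺ graph {c j} {c (suc j)} {c (suc k)} {c k} e (λ (e₁ , e₂) → apart k k<l e₁ e₂))
        tail : ∀ m → suc j + m ≤ l → Within (FiniteGraph.⟦_⟧ P) m (c (suc j)) (c (suc j + m))
        tail zero    le = subst (λ k → Within (FiniteGraph.⟦_⟧ P) 0 (c (suc j)) (c k)) (sym (ℕₚ.+-identityʳ (suc j))) here
        tail (suc m) le = subst (λ k → Within (FiniteGraph.⟦_⟧ P) (suc m) (c (suc j)) (c k)) (sym (ℕₚ.+-suc (suc j) m))
          (step (tail m (ℕₚ.<⇒≤ lt)) (link (suc j + m) lt (λ e → ℕₚ.m≢1+m+n j (sym e))))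
          where
          lt : suc j + m < l
          lt = subst (_≤ l) (ℕₚ.+-suc (suc j) m) le
        arc : ∀ m → m ≤ j → Within (FiniteGraph.⟦_⟧ P) (p + m) (c (suc j)) (c m)
        arc zero    _ = subst₂ (λ r v → Within (FiniteGraph.⟦_⟧ P) r (c (suc j)) v) (sym (ℕₚ.+-identityʳ p))
          (trans (cong c eq) (sym closed)) (tail p (ℕₚ.≤-reflexive eq))
        arc (suc m) lt = subst (λ r → Within (FiniteGraph.⟦_⟧ P) r (c (suc j)) (c (suc m))) (sym (ℕₚ.+-suc p m))
          (step (arc m (ℕₚ.<⇒≤ lt)) (link m (ℕₚ.<-trans lt j<l) (ℕₚ.<⇒≢ lt)))

      Found : Set
      Found = ∃[ j ] ∃[ L ] (j < l × suc L ≡ l × Short L (c j))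

      two-parents : ∀ {p q v} → p ≢ q → Edge p v → Edge q v → mark v ≡ reticulation
      two-parents p≢q e f with plain-or-reticulation e
      ... | inj₂ m = m
      ... | inj₁ pl = contradiction (parent-unique pl e f) p≢q

      valley : ∀ j → suc (suc j) ≤ l → Down j → Up (suc j) → Found
      valley j lt d u with round j (l ∸ suc j) (ℕₚ.m+[n∸m]≡n (ℕₚ.<⇒≤ lt)) d (two-parents j≢ d u) apart
        where
        j≢ : c j ≢ c (suc (suc j))
        j≢ = distinct j (suc (suc j)) (ℕₚ.m<n⇒m<1+n (ℕₚ.n<1+n j)) lt λ { (refl , refl) → case 3≤l of λ { (s≤s (s≤s ())) } }
        apart : ∀ k → k < l → c (suc k) ≡ c j → c k ≢ c (suc j)
        apart k k<l e₁ e₂ with <-distinct k<l lt e₂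
        ... | refl = j≢ (sym e₁)
      ... | L , eq , s = j , L , ℕₚ.<⇒≤ lt , eq , s

      -- The valley at the point where the sequence closes up, entered by the last edge and left by
      -- the first.
      wrap : ∀ j → suc j ≡ l → Down j → Up 0 → Found
      wrap j refl d u with round j 0 (ℕₚ.+-identityʳ (suc j)) d
                             (two-parents j≢ d (subst (Edge (c 1)) closed u)) apart
        where
        j≢ : c j ≢ c 1
        j≢ e = distinct 1 j (ℕₚ.≤-pred 3≤l) (ℕₚ.n≤1+n j) (λ ()) (sym e)
        apart : ∀ k → k < suc j → c (suc k) ≡ c j → c k ≢ c (suc j)
        apart k k<l e₁ e₂ with <-distinct k<l (s≤s z≤n) (trans e₂ (sym closed))
        ... | refl = j≢ (sym e₁)
      ... | L , eq , s = j , L , ℕₚ.≤-refl , eq , s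

      -- Between a descending edge and an ascending one `m` places later the direction changes at
      -- some vertex. A distance of zero would give a directed cycle of length two.
      seek : ∀ m i → i + m < l → Down i → Up (i + m) → Found
      seek zero i _ d u = contradiction (subst (λ k → Edge (c (suc k)) (c k)) (ℕₚ.+-identityʳ i) u) (λ u → acyclic _ (d ∷ [ u ]))
      seek (suc m) i lt d u = by (joined (suc i) 1+i<l)
        where
        lt′ : suc i + m < l
        lt′ = subst (_< l) (ℕₚ.+-suc i m) lt
        1+i<l : suc i < l
        1+i<l = ℕₚ.≤-<-trans (ℕₚ.m≤m+n (suc i) m) lt′
        by : Down (suc i) ⊎ Up (suc i) → Found
        by (inj₁ d′) = seek m (suc i) lt′ d′ (subst Up (ℕₚ.+-suc i m) u)
        by (inj₂ u′) = valley i 1+i<l d u′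

      all-down : Down 0 → ∀ k → k < l → Found ⊎ TransClosure Edge (c 0) (c (suc k))
      all-down d zero    _  = inj₂ [ d ]
      all-down d (suc k) lt with all-down d k (ℕₚ.<⇒≤ lt) | joined (suc k) lt
      ... | inj₁ found | _      = inj₁ found
      ... | inj₂ p     | inj₁ e = inj₂ (p ∷ʳ e)
      ... | inj₂ _     | inj₂ u = inj₁ (seek (suc k) 0 lt d u)

      -- A descending edge anywhere is followed later by the last edge, which ascends.
      all-up : ∀ j → suc j ≡ l → Up j → Up 0 → ∀ k → k < l → Found ⊎ TransClosure Edge (c (suc k)) (c 0)
      all-up j refl u u₀ zero    _  = inj₂ [ u₀ ]
      all-up j refl u u₀ (suc k) lt with all-up j refl u u₀ k (ℕₚ.<⇒≤ lt) | joined (suc k) lt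
      ... | inj₁ found | _      = inj₁ found
      ... | inj₂ p     | inj₂ e = inj₂ (e ∷ p)
      ... | inj₂ _     | inj₁ d = inj₁ (seek (j ∸ suc k) (suc k) (s≤s (ℕₚ.≤-reflexive eq)) d (subst Up (sym eq) u))
        where
        eq : suc k + (j ∸ suc k) ≡ j
        eq = ℕₚ.m+[n∸m]≡n (ℕₚ.≤-pred lt)

    -- Going round a cycle, one must at some point descend into a vertex
    -- and ascend from it again, and this vertex is then a reticulation.
    short-vertex : ∃[ j ] ∃[ L ] (j < l × suc L ≡ l × Short L (c j))
    short-vertex = by l refl
      where
      by : ∀ k → k ≡ l → Found
      by zero refl = case 3≤l of λ ()
      by (suc j) refl with joined 0 (s≤s z≤n) | joined j ℕₚ.≤-refl
      ... | inj₁ d | _ with all-down d j ℕₚ.≤-refl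
      ...   | inj₁ found = found
      ...   | inj₂ p = contradiction (subst (TransClosure Edge (c 0)) (sym closed) p) (acyclic _)
      by (suc j) refl | inj₂ u | inj₁ d = wrap j refl d u
      by (suc j) refl | inj₂ u | inj₂ u′ with all-up j refl u′ u j ℕₚ.≤-refl
      ...   | inj₁ found = found
      ...   | inj₂ p = contradiction (subst (λ v → TransClosure Edge v (c 0)) (sym closed) p) (acyclic _)

-- Moving along spines and across reticulations

module Navigation {n : ℕ} (N : Network n) where
  open Structure N

  pick : {P : Pred V 0ℓ} → Decidable P → V → V
  pick P? v with Finₚ.any? P?
  ... | yes (w , _) = w
  ... | no _        = v

  pick-spec : {P : Pred V 0ℓ} (P? : Decidable P) → ∀ {v} → ∃ P → P (pick P? v)
  pick-spec P? ex with Finₚ.any? P?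
  ... | yes (_ , p) = p
  ... | no none     = contradiction ex none

  down? : ∀ v w → Dec (Edge v w × Plain (mark w))
  down? v w = edge? v w ×-dec plain? (mark w)

  ret? : ∀ v w → Dec (Edge v w × mark w ≡ reticulation)
  ret? v w = edge? v w ×-dec mark w ≟ᴹ reticulation

  other? : ∀ v r w → Dec (Edge w r × w ≢ v)
  other? v r w = edge? w r ×-dec ¬? (w Finₚ.≟ v)

  -- The argument itself is a junk value, returned if there is no vertex
  -- of the required kind.
  down up ret below : V → V
  down v = pick (down? v) v
  up v = pick (λ p → edge? p v) v
  ret v = pick (ret? v) v
  below v = pick (edge? v) v

  other : V → V → V
  other v r = pick (other? v r) v

  record Tame (L : ℕ) (v : V) : Set where
    field
      not-origin    : v ≢ origin
      not-branching : ¬ Branching v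
      not-free      : ¬ FreeLeaf v
      not-short     : ¬ ShortCycles.Short N L v

  module _ {L v} (mv : mark v ≡ tree) (tame : Tame L v) where
    open Tame tame

    down-spec : Edge v (down v) × Plain (mark (down v))
    down-spec = pick-spec (down? v) (let (w , e , pl) = tree-child v (λ eq → case trans (sym mv) eq of λ ()) in w , e , pl)

    up-spec : Edge (up v) v
    up-spec = pick-spec (λ p → edge? p v) (parent-exists v not-origin)

    ret-spec : Edge v (ret v) × mark (ret v) ≡ reticulation
    ret-spec = pick-spec (ret? v) (decidable-stable (reticulated? v) (λ ¬r → not-branching (mv , ¬r)))

    other-spec : Edge (other v (ret v)) (ret v) × other v (ret v) ≢ v
    other-spec = pick-spec (other? v (ret v)) ex
      where
      ex : ∃[ w ] (Edge w (ret v) × w ≢ v)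
      ex with reticulation-parents (ret v) (proj₂ ret-spec)
      ... | a , b , a≢b , ea , eb , _ with a Finₚ.≟ v
      ...   | no a≢v = a , ea , a≢v
      ...   | yes refl = b , eb , a≢b ∘ sym

    below-spec : Edge (ret v) (below (ret v))
    below-spec = pick-spec (edge? (ret v)) (let (w , e , _) = reticulation-child (ret v) (proj₂ ret-spec) in w , e)

    -- A leaf below the tree vertex v has no other parent, so it would be a free leaf.
    down-tree : Tame L (down v) → mark (down v) ≡ tree
    down-tree t with proj₂ down-spec
    ... | inj₁ m = m
    ... | inj₂ m = contradiction (m , λ (r , e , mr) → case trans (sym mv)
            (trans (cong mark (parent-unique (inj₂ m) (proj₁ down-spec) e)) mr) of λ ()) (Tame.not-free t)

    up-tree : Tame L (up v) → mark (up v) ≡ tree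
    up-tree t with mark (up v) in eq
    ... | root = contradiction (Equivalence.to (root-mark _) eq) (Tame.not-origin t)
    ... | tree = refl
    ... | reticulation = case trans (sym mv) (one-component _ v eq up-spec) of λ ()
    ... | leaf = contradiction up-spec (leaf-no-child eq)

-- The decorated chain

-- The distance from `p₀` to position 0 of the spine: the 2 comes from one step down to the shared
-- reticulation and one up to the created spine.
depth : Spine → ℕ
depth main            = 0
depth (created s i _) = 2 + (depth s + ℤ.∣ i ∣)

-- The graph distance from `p₀` in closed form: `within⇒dist` and `to-root` give the two
-- inequalities.
dist : ChainVertex → ℕ
dist (node s i) = depth s + ℤ.∣ i ∣
dist (ρ s i _)  = 1 + (depth s + ℤ.∣ i ∣)
dist (ℓ s i _)  = 2 + (depth s + ℤ.∣ i ∣)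

suc-bounds : ∀ i → ℤ.∣ ℤ.suc i ∣ ≤ suc ℤ.∣ i ∣ × ℤ.∣ i ∣ ≤ suc ℤ.∣ ℤ.suc i ∣
suc-bounds (ℤ.+ k)            = ℕₚ.≤-refl , ℕₚ.≤-trans (ℕₚ.n≤1+n k) (ℕₚ.n≤1+n _)
suc-bounds ℤ.-[1+ zero ]      = z≤n , ℕₚ.≤-refl
suc-bounds ℤ.-[1+ suc k ]     = ℕₚ.≤-trans (ℕₚ.n≤1+n _) (ℕₚ.n≤1+n _) , ℕₚ.≤-refl

dist-edge : ∀ {x y} → ChainEdge x y → dist y ≤ suc (dist x) × dist x ≤ suc (dist y)
dist-edge (next s i) =
  ℕₚ.≤-trans (ℕₚ.+-monoʳ-≤ (depth s) (proj₁ (suc-bounds i))) (ℕₚ.≤-reflexive (ℕₚ.+-suc _ _)) ,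
  ℕₚ.≤-trans (ℕₚ.+-monoʳ-≤ (depth s) (proj₂ (suc-bounds i))) (ℕₚ.≤-reflexive (ℕₚ.+-suc _ _))
dist-edge (node→ρ s i d) = ℕₚ.≤-refl , ℕₚ.≤-trans (ℕₚ.n≤1+n _) (ℕₚ.n≤1+n _)
dist-edge (w→ρ s i d) =
  ℕₚ.≤-trans (ℕₚ.≤-trans (ℕₚ.n≤1+n _) (ℕₚ.n≤1+n _)) (s≤s (ℕₚ.m≤m+n _ 0)) , s≤s (s≤s (ℕₚ.≤-reflexive (ℕₚ.+-identityʳ _)))
dist-edge (ρ→ℓ s i d) = ℕₚ.≤-refl , ℕₚ.≤-trans (ℕₚ.n≤1+n _) (ℕₚ.n≤1+n _)

within⇒dist : ∀ {r x} → Within 𝓛̂ r p₀ x → dist x ≤ r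
within⇒dist here = z≤n
within⇒dist (step p (inj₁ e)) = ℕₚ.≤-trans (proj₁ (dist-edge e)) (s≤s (within⇒dist p))
within⇒dist (step p (inj₂ e)) = ℕₚ.≤-trans (proj₂ (dist-edge e)) (s≤s (within⇒dist p))

into-node : ∀ {x y s j} → ChainEdge x y → y ≡ node s j → x ≡ node s (ℤ.pred j)
into-node (next s i) refl = cong (node s) (sym (ℤₚ.pred-suc i))

out-unique : ∀ {x y z} → ChainEdge x y → ChainEdge x z → MarkedGraph.mark 𝓛̂ y ≡ MarkedGraph.mark 𝓛̂ z → y ≡ z
out-unique (next s i)      (next _ _)      _ = refl
out-unique (next s i)      (node→ρ _ _ _)  ()
out-unique (next _ _)      (w→ρ _ _ _)     ()
out-unique (node→ρ s i d)  (next _ _)      ()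
out-unique (node→ρ s i d)  (node→ρ _ _ _)  _ = refl
-- Position 0 of a created spine is not decorated, so it has no second reticulation child.
out-unique (node→ρ _ _ d)  (w→ρ _ _ _)     _ = ⊥-elim-irr (d refl)
out-unique (w→ρ s i d)     (next _ _)      ()
out-unique (w→ρ s i d)     (node→ρ _ _ d′) _ = ⊥-elim-irr (d′ refl)
out-unique (w→ρ s i d)     (w→ρ _ _ _)     _ = refl
out-unique (ρ→ℓ s i d)     (ρ→ℓ _ _ _)     _ = refl

-- Walks in the decorated chain

module ChainWalks (D : ℕ) where

  -- Both ends are kept within distance `D`, since the unfolding is known to respect edges only
  -- there.
  Adj : Rel ChainVertex 0ℓ
  Adj x y = (ChainEdge x y ⊎ ChainEdge y x) × dist x ≤ D × dist y ≤ D

  data Walk : ℕ → Rel ChainVertex 0ℓ where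
    nil  : ∀ {x} → Walk 0 x x
    cons : ∀ {l x y z} → Adj x y → Walk l y z → Walk (suc l) x z

  append : ∀ {k l x y z} → Walk k x y → Walk l y z → Walk (k + l) x z
  append nil w = w
  append (cons e v) w = cons e (append v w)

  adj-sym : ∀ {x y} → Adj x y → Adj y x
  adj-sym (inj₁ e , p , q) = inj₂ e , q , p
  adj-sym (inj₂ e , p , q) = inj₁ e , q , p

  snoc : ∀ {l x y z} → Walk l x y → Adj y z → Walk (suc l) x z
  snoc nil e = cons e nil
  snoc (cons e w) e′ = cons e (snoc w e′)

  reverse : ∀ {l x y} → Walk l x y → Walk l y x
  reverse nil = nil
  reverse (cons e w) = snoc (reverse w) (adj-sym e)

  vertex : ∀ {l x y} → Walk l x y → ℕ → ChainVertex
  vertex {x = x} nil        _       = x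
  vertex {x = x} (cons e w) zero    = x
  vertex         (cons e w) (suc k) = vertex w k

  vertex-start : ∀ {l x y} (w : Walk l x y) → vertex w 0 ≡ x
  vertex-start nil        = refl
  vertex-start (cons _ _) = refl

  vertex-end : ∀ {l x y} (w : Walk l x y) → vertex w l ≡ y
  vertex-end nil        = refl
  vertex-end (cons _ w) = vertex-end w

  vertex-adj : ∀ {l x y} (w : Walk l x y) → ∀ k → k < l → Adj (vertex w k) (vertex w (suc k))
  vertex-adj (cons e w) zero    _        = subst (Adj _) (sym (vertex-start w)) e
  vertex-adj (cons e w) (suc k) (s≤s lt) = vertex-adj w k lt

  segment : ∀ {l x y} (w : Walk l x y) m i → i + m ≤ l → Walk m (vertex w i) (vertex w (i + m))
  segment w zero    i le = subst (λ k → Walk 0 (vertex w i) (vertex w k)) (sym (ℕₚ.+-identityʳ i)) nil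
  segment {l} w (suc m) i le = subst (λ k → Walk (suc m) (vertex w i) (vertex w k)) (sym (ℕₚ.+-suc i m))
    (cons (vertex-adj w i (ℕₚ.≤-trans (s≤s (ℕₚ.m≤m+n i m)) le′)) (segment w m (suc i) le′))
    where
    le′ : suc i + m ≤ l
    le′ = subst (_≤ l) (ℕₚ.+-suc i m) le

  private
    along : ∀ s i → depth s + ℤ.∣ i ∣ ≤ D → Walk ℤ.∣ i ∣ (node s i) (node s 0ℤ)
    along s (ℤ.+ zero)        le = nil
    along s (ℤ.+ suc k)       le = cons (inj₂ (next s (ℤ.+ k)) , le , le′) (along s (ℤ.+ k) le′)
      where le′ = ℕₚ.≤-trans (ℕₚ.+-monoʳ-≤ (depth s) (ℕₚ.n≤1+n k)) le
    along s ℤ.-[1+ zero ]     le = cons (inj₁ (next s ℤ.-[1+ zero ]) , le , ℕₚ.≤-trans (ℕₚ.+-monoʳ-≤ (depth s) z≤n) le) nil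
    along s ℤ.-[1+ suc k ]    le = cons (inj₁ (next s ℤ.-[1+ suc k ]) , le , le′) (along s ℤ.-[1+ k ] le′)
      where le′ = ℕₚ.≤-trans (ℕₚ.+-monoʳ-≤ (depth s) (ℕₚ.n≤1+n (suc k))) le

    base-to-root : ∀ s → depth s ≤ D → Walk (depth s) (node s 0ℤ) p₀
    base-to-root main le = nil
    base-to-root (created s i d) le = cons (inj₁ (w→ρ s i d) , ℕₚ.≤-trans (ℕₚ.≤-reflexive (ℕₚ.+-identityʳ _)) le , le₁)
      (cons (inj₂ (node→ρ s i d) , le₁ , le₂)
      (subst (λ k → Walk k (node s i) p₀) (ℕₚ.+-comm ℤ.∣ i ∣ (depth s))
        (append (along s i le₂) (base-to-root s (ℕₚ.≤-trans (ℕₚ.m≤m+n _ _) le₂)))))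
      where
      le₁ = ℕₚ.<⇒≤ le
      le₂ = ℕₚ.<⇒≤ le₁

    node-to-root : ∀ s i → depth s + ℤ.∣ i ∣ ≤ D → Walk (depth s + ℤ.∣ i ∣) (node s i) p₀
    node-to-root s i le = subst (λ k → Walk k (node s i) p₀) (ℕₚ.+-comm ℤ.∣ i ∣ (depth s))
      (append (along s i le) (base-to-root s (ℕₚ.≤-trans (ℕₚ.m≤m+n _ _) le)))

  -- Each step decreases `dist`, so this walk is a geodesic and stays within distance `D`.
  to-root : ∀ x → dist x ≤ D → Walk (dist x) x p₀
  to-root (node s i) le = node-to-root s i le
  to-root (ρ s i d)  le = cons (inj₂ (node→ρ s i d) , le , ℕₚ.<⇒≤ le) (node-to-root s i (ℕₚ.<⇒≤ le))
  to-root (ℓ s i d)  le = cons (inj₂ (ρ→ℓ s i d) , le , ℕₚ.<⇒≤ le) (to-root (ρ s i d) (ℕₚ.<⇒≤ le))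

  walk⇒within : ∀ {l x} → Walk l x p₀ → Within 𝓛̂ l p₀ x
  walk⇒within nil = here
  walk⇒within (cons (inj₁ e , _) w) = step (walk⇒within w) (inj₂ e)
  walk⇒within (cons (inj₂ e , _) w) = step (walk⇒within w) (inj₁ e)

-- Unfolding a network

module Unfolding {n : ℕ} (N : Network n) (u : Fin (Network.order N)) where
  open Structure N
  open Navigation N

  walk : V → ℤ → V
  walk b (ℤ.+ zero)     = b
  walk b (ℤ.+ suc k)    = down (walk b (ℤ.+ k))
  walk b ℤ.-[1+ zero ]  = up b
  walk b ℤ.-[1+ suc k ] = up (walk b ℤ.-[1+ k ])

  base : Spine → V
  base main            = u
  base (created s i _) = other (walk (base s) i) (ret (walk (base s) i))

  at : Spine → ℤ → V
  at s i = walk (base s) i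

  -- Defined on the whole chain thanks to the junk values. It is meaningful only as far from `p₀` as
  -- the vertices of the network are tame.
  unfold : ChainVertex → V
  unfold (node s i) = at s i
  unfold (ρ s i _)  = ret (at s i)
  unfold (ℓ s i _)  = below (ret (at s i))

  module _ {D L : ℕ} (mu : mark u ≡ tree) (tame : ∀ {v} → Within ⟦_⟧ D u v → Tame L v) where

    private
      W : ℕ → V → Set
      W r v = Within ⟦_⟧ r u v

      tame≤ : ∀ {r v} → r ≤ D → W r v → Tame L v
      tame≤ le w = tame (within-mono le w)

      Ok : ℕ → V → Set
      Ok r v = mark v ≡ tree × W r v

      walk-down-ok : ∀ {b d} → Ok d b → ∀ k → d + k ≤ D → Ok (d + k) (walk b (ℤ.+ k))
      walk-down-ok {b} {d} ok zero le = subst (λ r → Ok r b) (sym (ℕₚ.+-identityʳ d)) ok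
      walk-down-ok {b} {d} ok (suc k) le = subst (λ r → Ok r (walk b (ℤ.+ suc k))) (sym (ℕₚ.+-suc d k)) (down-tree m t (tame≤ le′ w′) , w′)
        where
        le′ : suc (d + k) ≤ D
        le′ = subst (_≤ D) (ℕₚ.+-suc d k) le
        m = proj₁ (walk-down-ok ok k (ℕₚ.<⇒≤ le′))
        w = proj₂ (walk-down-ok ok k (ℕₚ.<⇒≤ le′))
        t = tame≤ (ℕₚ.<⇒≤ le′) w
        w′ = step w (inj₁ (proj₁ (down-spec m t)))

      up-ok : ∀ {r v} → r < D → Ok r v → Ok (suc r) (up v)
      up-ok lt (m , w) = up-tree m t (tame≤ lt w′) , w′
        where
        t = tame≤ (ℕₚ.<⇒≤ lt) w
        w′ = step w (inj₂ (up-spec m t))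

      walk-up-ok : ∀ {b d} → Ok d b → ∀ k → suc (d + k) ≤ D → Ok (suc (d + k)) (walk b ℤ.-[1+ k ])
      walk-up-ok {b} {d} ok zero le = subst (λ r → Ok (suc r) (up b)) (sym (ℕₚ.+-identityʳ d))
        (up-ok (subst (_< D) (ℕₚ.+-identityʳ d) le) ok)
      walk-up-ok {b} {d} ok (suc k) le = subst (λ r → Ok (suc r) (walk b ℤ.-[1+ suc k ])) (sym (ℕₚ.+-suc d k))
        (up-ok (subst (_< D) (ℕₚ.+-suc d k) le) (walk-up-ok ok k (ℕₚ.<⇒≤ (subst (_< D) (ℕₚ.+-suc d k) le))))

      walk-ok : ∀ {b d} → mark b ≡ tree → W d b → ∀ i → d + ℤ.∣ i ∣ ≤ D → mark (walk b i) ≡ tree × W (d + ℤ.∣ i ∣) (walk b i)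
      walk-ok mb wb (ℤ.+ k) le = walk-down-ok (mb , wb) k le
      walk-ok {b} {d} mb wb ℤ.-[1+ k ] le = subst (λ r → Ok r (walk b ℤ.-[1+ k ])) (sym (ℕₚ.+-suc d k))
        (walk-up-ok (mb , wb) k (subst (_≤ D) (ℕₚ.+-suc d k) le))

      base-ok : ∀ s → depth s ≤ D → mark (base s) ≡ tree × W (depth s) (base s)
      base-ok main le = mu , here
      base-ok (created s i d) le with base-ok s (ℕₚ.≤-trans (ℕₚ.m≤m+n _ ℤ.∣ i ∣) (ℕₚ.<⇒≤ (ℕₚ.<⇒≤ le)))
      ... | mb , wb with walk-ok mb wb i (ℕₚ.<⇒≤ (ℕₚ.<⇒≤ le))
      ...   | m , w = reticulation-parent-tree (proj₁ (other-spec m t)) (proj₂ (ret-spec m t)) ,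
              step (step w (inj₁ (proj₁ (ret-spec m t)))) (inj₂ (proj₁ (other-spec m t)))
        where t = tame≤ (ℕₚ.<⇒≤ (ℕₚ.<⇒≤ le)) w

      at-ok : ∀ s i → depth s + ℤ.∣ i ∣ ≤ D → mark (at s i) ≡ tree × W (depth s + ℤ.∣ i ∣) (at s i)
      at-ok s i le with base-ok s (ℕₚ.≤-trans (ℕₚ.m≤m+n _ _) le)
      ... | mb , wb = walk-ok mb wb i le

      module At (s : Spine) (i : ℤ) (le : depth s + ℤ.∣ i ∣ ≤ D) where
        m : mark (at s i) ≡ tree
        m = proj₁ (at-ok s i le)
        w : W (depth s + ℤ.∣ i ∣) (at s i)
        w = proj₂ (at-ok s i le)
        t : Tame L (at s i)
        t = tame≤ le w
        downE = down-spec m t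
        upE = up-spec m t
        retE = ret-spec m t
        otherE = other-spec m t
        belowE = below-spec m t

      next-edge : ∀ s i → depth s + ℤ.∣ i ∣ ≤ D → depth s + ℤ.∣ ℤ.suc i ∣ ≤ D → Edge (at s i) (at s (ℤ.suc i))
      next-edge s (ℤ.+ k)        le le′ = proj₁ (At.downE s (ℤ.+ k) le)
      next-edge s ℤ.-[1+ zero ]  le le′ = At.upE s 0ℤ le′
      next-edge s ℤ.-[1+ suc k ] le le′ = At.upE s ℤ.-[1+ k ] le′

    unfold-edge : ∀ {x y} → ChainEdge x y → dist x ≤ D → dist y ≤ D → Edge (unfold x) (unfold y)
    unfold-edge (next s i) p q = next-edge s i p q
    unfold-edge (node→ρ s i d) p q = proj₁ (At.retE s i p)
    unfold-edge (w→ρ s i d) p q = proj₁ (At.otherE s i (ℕₚ.<⇒≤ q))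
    unfold-edge (ρ→ℓ s i d) p q = At.belowE s i (ℕₚ.<⇒≤ p)

    unfold-mark : ∀ x → dist x ≤ D → mark (unfold x) ≡ MarkedGraph.mark 𝓛̂ x
    unfold-mark (node s i) le = At.m s i le
    unfold-mark (ρ s i d) le = proj₂ (At.retE s i (ℕₚ.<⇒≤ le))
    unfold-mark (ℓ s i d) le = one-component _ _ (proj₂ (At.retE s i (ℕₚ.<⇒≤ (ℕₚ.<⇒≤ le)))) (At.belowE s i (ℕₚ.<⇒≤ (ℕₚ.<⇒≤ le)))

    unfold-near : ∀ x → dist x ≤ D → W (dist x) (unfold x)
    unfold-near (node s i) le = At.w s i le
    unfold-near (ρ s i d) le = step (At.w s i (ℕₚ.<⇒≤ le)) (inj₁ (proj₁ (At.retE s i (ℕₚ.<⇒≤ le))))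
    unfold-near (ℓ s i d) le = step (unfold-near (ρ s i d) (ℕₚ.<⇒≤ le)) (inj₁ (At.belowE s i (ℕₚ.<⇒≤ (ℕₚ.<⇒≤ le))))

    -- With `lift-in` this is path lifting: up to distance `D` the unfolding behaves like a covering
    -- map, so every vertex near u has a preimage.
    lift-out : ∀ x → dist x < D → ∀ {v} → Edge (unfold x) v → ∃[ y ] (ChainEdge x y × unfold y ≡ v)
    lift-out (node s i) lt {v} e with plain-or-reticulation e
    ... | inj₁ pl = node s (ℤ.suc i) , next s i ,
          plain-child-unique (proj₁ A.retE) (proj₂ A.retE) (next-edge s i (ℕₚ.<⇒≤ lt) le′) e (inj₁ (At.m s (ℤ.suc i) le′)) pl
      where
      module A = At s i (ℕₚ.<⇒≤ lt)
      le′ = ℕₚ.≤-trans (proj₁ (dist-edge (next s i))) lt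
    ... | inj₂ mv = by s refl
      where
      module A = At s i (ℕₚ.<⇒≤ lt)
      decorated : .(d : Decorated s i) → ∃[ y ] (ChainEdge (node s i) y × unfold y ≡ v)
      decorated d = ρ s i d , node→ρ s i d , reticulation-unique (proj₁ A.retE) e (proj₂ A.retE) mv
      by : ∀ s′ → s′ ≡ s → ∃[ y ] (ChainEdge (node s i) y × unfold y ≡ v)
      by main refl = decorated tt
      by (created s′ i′ d′) refl with i ℤₚ.≟ 0ℤ
      ... | no i≢0 = decorated i≢0
      -- The reticulation child of position 0 of a created spine is the one across which the spine
      -- was created.
      ... | yes refl = ρ s′ i′ d′ , w→ρ s′ i′ d′ , reticulation-unique (proj₁ B.otherE) e (proj₂ B.retE) mv
        where module B = At s′ i′ (ℕₚ.≤-trans (ℕₚ.≤-trans (ℕₚ.n≤1+n _) (ℕₚ.≤-trans (ℕₚ.n≤1+n _) (ℕₚ.m≤m+n _ 0))) (ℕₚ.<⇒≤ lt))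
    lift-out (ρ s i d) lt e with reticulation-child _ (proj₂ (At.retE s i (ℕₚ.<⇒≤ (ℕₚ.<⇒≤ lt))))
    ... | _ , _ , only = ℓ s i d , ρ→ℓ s i d , trans (only _ (At.belowE s i (ℕₚ.<⇒≤ (ℕₚ.<⇒≤ lt)))) (sym (only _ e))
    lift-out (ℓ s i d) lt e = contradiction e (leaf-no-child (unfold-mark (ℓ s i d) (ℕₚ.<⇒≤ lt)))

    lift-in : ∀ x → dist x < D → ∀ {v} → Edge v (unfold x) → ∃[ y ] (ChainEdge y x × unfold y ≡ v)
    lift-in (node s i) lt e = node s (ℤ.pred i) , edge ,
      parent-unique (inj₁ (At.m s i (ℕₚ.<⇒≤ lt))) (unfold-edge edge (ℕₚ.≤-trans (proj₂ (dist-edge edge)) lt) (ℕₚ.<⇒≤ lt)) e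
      where
      edge : ChainEdge (node s (ℤ.pred i)) (node s i)
      edge = subst (λ j → ChainEdge (node s (ℤ.pred i)) (node s j)) (ℤₚ.suc-pred i) (next s (ℤ.pred i))
    lift-in (ρ s i d) lt {v} e = by (reticulation-parents _ (proj₂ A.retE))
      where
      module A = At s i (ℕₚ.<⇒≤ (ℕₚ.<⇒≤ lt))
      first : at s i ≡ v → ∃[ y ] (ChainEdge y (ρ s i d) × unfold y ≡ v)
      first eq = node s i , node→ρ s i d , eq
      second : other (at s i) (ret (at s i)) ≡ v → ∃[ y ] (ChainEdge y (ρ s i d) × unfold y ≡ v)
      second eq = node (created s i d) 0ℤ , w→ρ s i d , eq
      by : Exactly 2 (λ p → Edge p (ret (at s i))) → ∃[ y ] (ChainEdge y (ρ s i d) × unfold y ≡ v)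
      by (a , b , a≢b , _ , _ , only) with only _ (proj₁ A.retE) | only _ (proj₁ A.otherE) | only v e
      ... | inj₁ p | inj₁ q | _ = contradiction (trans q (sym p)) (proj₂ A.otherE)
      ... | inj₂ p | inj₂ q | _ = contradiction (trans q (sym p)) (proj₂ A.otherE)
      ... | inj₁ p | inj₂ q | inj₁ r = first (trans p (sym r))
      ... | inj₁ p | inj₂ q | inj₂ r = second (trans q (sym r))
      ... | inj₂ p | inj₁ q | inj₁ r = second (trans q (sym r))
      ... | inj₂ p | inj₁ q | inj₂ r = first (trans p (sym r))
    lift-in (ℓ s i d) lt e = ρ s i d , ρ→ℓ s i d ,
      parent-unique (inj₂ (unfold-mark (ℓ s i d) (ℕₚ.<⇒≤ lt))) (unfold-edge (ρ→ℓ s i d) (ℕₚ.<⇒≤ (ℕₚ.<⇒≤ lt)) (ℕₚ.<⇒≤ lt)) e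

    open ChainWalks D

    private
      in-injective : ∀ x {y z} → ChainEdge y x → ChainEdge z x → dist x ≤ D → unfold y ≡ unfold z → y ≡ z
      in-injective (node s j) e f _ _ = trans (into-node e refl) (sym (into-node f refl))
      in-injective (ρ s i d) (node→ρ _ _ _) (node→ρ _ _ _) le eq = refl
      in-injective (ρ s i d) (node→ρ _ _ _) (w→ρ _ _ _) le eq = contradiction (sym eq) (proj₂ (At.otherE s i (ℕₚ.<⇒≤ le)))
      in-injective (ρ s i d) (w→ρ _ _ _) (node→ρ _ _ _) le eq = contradiction eq (proj₂ (At.otherE s i (ℕₚ.<⇒≤ le)))
      in-injective (ρ s i d) (w→ρ _ _ _) (w→ρ _ _ _) le eq = refl
      in-injective (ℓ s i d) (ρ→ℓ _ _ _) (ρ→ℓ _ _ _) le eq = refl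

      two-cycle : ∀ {x y z} → ChainEdge x y → ChainEdge z x → dist x ≤ D → dist y ≤ D → dist z ≤ D → unfold y ≢ unfold z
      two-cycle {x} {y} {z} e f px py pz eq =
        acyclic (unfold x) (subst (Edge (unfold x)) eq (unfold-edge e px py) ∷ [ unfold-edge f pz px ])

    -- Children of a vertex differ in mark, and the two parents of a reticulation are distinct by
    -- `other-spec`. A child and a parent with the same image would form a directed cycle.
    locally-injective : ∀ {x y z} → Adj x y → Adj x z → unfold y ≡ unfold z → y ≡ z
    locally-injective (inj₁ e , px , py) (inj₁ f , _ , pz) eq =
      out-unique e f (trans (sym (unfold-mark _ py)) (trans (cong mark eq) (unfold-mark _ pz)))
    locally-injective (inj₂ e , px , py) (inj₂ f , _ , pz) eq = in-injective _ e f px eq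
    locally-injective (inj₁ e , px , py) (inj₂ f , _ , pz) eq = contradiction eq (two-cycle e f px py pz)
    locally-injective (inj₂ e , px , py) (inj₁ f , _ , pz) eq = contradiction (sym eq) (two-cycle f e px pz py)

    unfold-adj : ∀ {x y} → Adj x y → Edge (unfold x) (unfold y) ⊎ Edge (unfold y) (unfold x)
    unfold-adj (inj₁ e , p , q) = inj₁ (unfold-edge e p q)
    unfold-adj (inj₂ e , p , q) = inj₂ (unfold-edge e q p)

    -- A shortest walk violating injectivity would map to a cycle.
    walk-injective : ∀ l → l ≤ suc L → ∀ {x y} → Walk l x y → unfold x ≡ unfold y → x ≡ y
    walk-injective = <-rec (λ l → l ≤ suc L → ∀ {x y} → Walk l x y → unfold x ≡ unfold y → x ≡ y) go
      where
      go : ∀ l → (∀ {k} → k < l → k ≤ suc L → ∀ {x y} → Walk k x y → unfold x ≡ unfold y → x ≡ y) →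
        l ≤ suc L → ∀ {x y} → Walk l x y → unfold x ≡ unfold y → x ≡ y
      go l ih l≤ {x} {y} w eq = by (Finₚ.any? λ i → Finₚ.any? λ j → repeat? (toℕ i) (toℕ j))
        where
        a : ℕ → ChainVertex
        a = vertex w
        Repeat : ℕ → ℕ → Set
        Repeat i j = i < j × ¬ (i ≡ 0 × j ≡ l) × unfold (a i) ≡ unfold (a j)
        repeat? : ∀ i j → Dec (Repeat i j)
        repeat? i j = (i ℕₚ.<? j) ×-dec ¬? ((i ℕₚ.≟ 0) ×-dec (j ℕₚ.≟ l)) ×-dec (unfold (a i) Finₚ.≟ unfold (a j))

        -- The segment between two indices with equal images is shorter than the walk, so its ends
        -- agree by induction. Cutting it out leaves a shorter walk from x to y.
        shortcut : ∀ i j → j ≤ l → Repeat i j → x ≡ y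
        shortcut i j j≤l (i<j , ne , e) = ih lt (ℕₚ.≤-trans (ℕₚ.<⇒≤ lt) l≤) short eq
          where
          k<l : j ∸ i < l
          k<l with i ℕₚ.≟ 0
          ... | yes refl = ℕₚ.≤∧≢⇒< j≤l (λ e → ne (refl , e))
          ... | no i≢0 = ℕₚ.<-≤-trans (ℕₚ.∸-monoʳ-< (ℕₚ.n≢0⇒n>0 i≢0) (ℕₚ.<⇒≤ i<j)) j≤l
          i+k≡j : i + (j ∸ i) ≡ j
          i+k≡j = ℕₚ.m+[n∸m]≡n (ℕₚ.<⇒≤ i<j)
          middle : Walk (j ∸ i) (a i) (a j)
          middle = subst (λ k → Walk (j ∸ i) (a i) (a k)) i+k≡j (segment w (j ∸ i) i (subst (_≤ l) (sym i+k≡j) j≤l))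
          same : a i ≡ a j
          same = ih k<l (ℕₚ.≤-trans (ℕₚ.<⇒≤ k<l) l≤) middle e
          lt : i + (l ∸ j) < l
          lt = subst (i + (l ∸ j) <_) (ℕₚ.m+[n∸m]≡n j≤l) (ℕₚ.+-monoˡ-< (l ∸ j) i<j)
          short : Walk (i + (l ∸ j)) x y
          short = append
            (subst₂ (Walk i) (vertex-start w) same (segment w i 0 (ℕₚ.≤-trans (ℕₚ.<⇒≤ i<j) j≤l)))
            (subst (Walk (l ∸ j) (a j)) (trans (cong a (ℕₚ.m+[n∸m]≡n j≤l)) (vertex-end w))
              (segment w (l ∸ j) j (ℕₚ.≤-reflexive (ℕₚ.m+[n∸m]≡n j≤l))))

        by : Dec (∃[ i ] ∃[ j ] Repeat (toℕ {suc l} i) (toℕ {suc l} j)) → x ≡ y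
        by (yes (i , j , rep)) = shortcut (toℕ i) (toℕ j) (Finₚ.toℕ≤pred[n] j) rep
        by (no none) = simple l refl w eq
          where
          distinct : ∀ i j → i < j → j ≤ l → ¬ (i ≡ 0 × j ≡ l) → unfold (a i) ≢ unfold (a j)
          distinct i j i<j j≤l ne e = none (Fin.fromℕ< (s≤s (ℕₚ.≤-trans (ℕₚ.<⇒≤ i<j) j≤l)) , Fin.fromℕ< (s≤s j≤l) ,
            subst₂ Repeat (sym (Finₚ.toℕ-fromℕ< _)) (sym (Finₚ.toℕ-fromℕ< _)) (i<j , ne , e))
          simple : ∀ k → k ≡ l → ∀ {x′ y′} → Walk k x′ y′ → unfold x′ ≡ unfold y′ → x′ ≡ y′
          simple 0 _ nil _ = refl
          simple 1 _ (cons e nil) eq with unfold-adj e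
          ... | inj₁ f = contradiction [ subst (Edge _) (sym eq) f ] (acyclic _)
          ... | inj₂ f = contradiction [ subst (λ v → Edge v _) (sym eq) f ] (acyclic _)
          -- Too short for a cycle: x and y are neighbours of the middle vertex with equal images.
          simple 2 _ (cons e (cons f nil)) eq = locally-injective (adj-sym e) f eq
          simple (suc (suc (suc k))) refl _ _
            with Cycles.short-vertex N (λ k → unfold (a k)) l (s≤s (s≤s (s≤s z≤n)))
                   (λ k lt → unfold-adj (vertex-adj w k lt))
                   (trans (cong unfold (vertex-start w)) (trans eq (cong unfold (sym (vertex-end w))))) distinct
          ... | j , L′ , j<l , refl , r , e , wi = contradiction (r , e , within-mono (ℕₚ.≤-pred l≤) wi)
                  (Tame.not-short (tame≤ ≤D (unfold-near (a j) ≤D)))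
            where ≤D = proj₁ (proj₂ (vertex-adj w j j<l))

    -- Two vertices within distance `D` are joined through `p₀` by a walk of length at most `D + D`.
    unfold-injective : D + D ≤ L → ∀ {x y} → dist x ≤ D → dist y ≤ D → unfold x ≡ unfold y → x ≡ y
    unfold-injective 2D≤L {x} {y} px py = walk-injective (dist x + dist y)
      (ℕₚ.≤-trans (ℕₚ.+-mono-≤ px py) (ℕₚ.≤-trans 2D≤L (ℕₚ.n≤1+n L)))
      (append (to-root x px) (reverse (to-root y py)))

    preimage : ∀ {r v} → r ≤ D → W r v → ∃[ x ] (dist x ≤ r × unfold x ≡ v)
    preimage le here = p₀ , z≤n , refl
    preimage le (step p e) with preimage (ℕₚ.<⇒≤ le) p
    preimage le (step p (inj₁ e)) | x , dx , refl with lift-out x (ℕₚ.≤-trans (s≤s dx) le) e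
    ... | y , f , eq = y , ℕₚ.≤-trans (proj₁ (dist-edge f)) (s≤s dx) , eq
    preimage le (step p (inj₂ e)) | x , dx , refl with lift-in x (ℕₚ.≤-trans (s≤s dx) le) e
    ... | y , f , eq = y , ℕₚ.≤-trans (proj₂ (dist-edge f)) (s≤s dx) , eq

  -- The radius is R + 1 because `lift-out` and `lift-in` apply strictly inside it and are needed at
  -- distance R. The bound on cycles is twice this radius, as `unfold-injective` requires.
  module LocalLimit (R : ℕ) (mu : mark u ≡ tree)
                    (tame : ∀ {v} → Within ⟦_⟧ (suc R) u v → Tame (suc R + suc R) v) where
    private
      D = suc R
      Ball = RootedMarkedGraph.Vertex (U R ⟦_⟧ u)
      ChainBall = RootedMarkedGraph.Vertex (U R 𝓛̂ p₀)

      ball-≡ : {y z : Ball} → value y ≡ value z → y ≡ z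
      ball-≡ refl = refl

      chain-≡ : {y z : ChainBall} → value y ≡ value z → y ≡ z
      chain-≡ refl = refl

      find : (b : Ball) → ∃[ x ] (dist x ≤ R × unfold x ≡ value b)
      find b = preimage mu tame (ℕₚ.n≤1+n R) (relevant (within? graph R u (value b)) (proof b))

      bound : (c : ChainBall) → dist (value c) ≤ R
      -- Distance in the infinite chain cannot be decided by search, so the irrelevant proof is
      -- first turned into an inequality between numbers.
      bound c = relevant (dist (value c) ℕₚ.≤? R) (Data.Irrelevant.map within⇒dist (proof c))

      to : Ball → ChainBall
      to b = let (x , le , _) = find b in
        x , Data.Irrelevant.[ within-mono le (ChainWalks.walk⇒within D (ChainWalks.to-root D x (ℕₚ.m≤n⇒m≤1+n le))) ]

      from : ChainBall → Ball
      from c = unfold (value c) , Data.Irrelevant.[ within-mono (bound c) (unfold-near mu tame (value c) (ℕₚ.m≤n⇒m≤1+n (bound c))) ]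

      injective : ∀ {x y} → dist x ≤ D → dist y ≤ D → unfold x ≡ unfold y → x ≡ y
      injective = unfold-injective mu tame ℕₚ.≤-refl

      to≤ : ∀ b → dist (value (to b)) ≤ D
      to≤ b = ℕₚ.m≤n⇒m≤1+n (proj₁ (proj₂ (find b)))

      unfold-to : ∀ b → unfold (value (to b)) ≡ value b
      unfold-to b = proj₂ (proj₂ (find b))

    ball-≅ : U R ⟦_⟧ u ≅ U R 𝓛̂ p₀
    ball-≅ = record
      { bijection = mk↔ₛ′ to from
          (λ c → chain-≡ (injective (to≤ (from c)) (ℕₚ.m≤n⇒m≤1+n (bound c)) (unfold-to (from c))))
          (λ b → ball-≡ (unfold-to b))
      ; base-preserved = chain-≡ (injective (to≤ b₀) z≤n (unfold-to b₀))
      ; mark-preserved = λ b → trans (sym (unfold-mark mu tame (value (to b)) (to≤ b))) (cong mark (unfold-to b))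
      ; edge-preserved = λ b c → mk⇔ (forth b c) (λ e → subst₂ Edge (unfold-to b) (unfold-to c) (unfold-edge mu tame e (to≤ b) (to≤ c))) }
      where
      b₀ = RootedMarkedGraph.base (U R ⟦_⟧ u)
      forth : ∀ b c → Edge (value b) (value c) → ChainEdge (value (to b)) (value (to c))
      forth b c e with lift-out mu tame (value (to b)) (s≤s (proj₁ (proj₂ (find b)))) (subst₂ Edge (sym (unfold-to b)) refl e)
      ... | y , f , eq = subst (ChainEdge (value (to b)))
              (injective (ℕₚ.≤-trans (proj₁ (dist-edge f)) (s≤s (proj₁ (proj₂ (find b))))) (to≤ c) (trans eq (sym (unfold-to c)))) f

-- Most tree vertices are far from special vertices

within-snoc : ∀ {N r v w u} → MarkedGraph.Edge N v w ⊎ MarkedGraph.Edge N w v → Within N r w u → Within N (suc r) v u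
within-snoc e here       = step here e
within-snoc e (step p f) = step (within-snoc e p) f

within-sym : ∀ {N r v w} → Within N r v w → Within N r w v
within-sym here = here
within-sym (step p (inj₁ e)) = within-snoc (inj₂ e) (within-sym p)
within-sym (step p (inj₂ e)) = within-snoc (inj₁ e) (within-sym p)

module Special {n : ℕ} (N : Network n) (R : ℕ) where
  open Structure N
  open Navigation N using (Tame)
  open ShortCycles N

  L : ℕ
  L = suc R + suc R

  SpecialVertex : V → Set
  SpecialVertex v = v ≡ origin ⊎ Branching v ⊎ FreeLeaf v ⊎ Short L v

  special? : ∀ v → Dec (SpecialVertex v)
  special? v = (v Finₚ.≟ origin) ⊎-dec branching? v ⊎-dec freeLeaf? v ⊎-dec short? L v

  Near : V → Set
  Near u = ∃[ v ] (Within ⟦_⟧ (suc R) u v × SpecialVertex v)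

  near? : ∀ u → Dec (Near u)
  near? u = Finₚ.any? λ v → within? graph (suc R) u v ×-dec special? v

  #short #near : ℕ
  #short = count (short? L)
  #near = count near?

  not-near⇒tame : ∀ {u} → ¬ Near u → ∀ {v} → Within ⟦_⟧ (suc R) u v → Tame L v
  not-near⇒tame far w = record
    { not-origin    = λ p → far (_ , w , inj₁ p)
    ; not-branching = λ p → far (_ , w , inj₂ (inj₁ p))
    ; not-free      = λ p → far (_ , w , inj₂ (inj₂ (inj₁ p)))
    ; not-short     = λ p → far (_ , w , inj₂ (inj₂ (inj₂ p))) }

  -- The root and the branching vertices together are exactly as many as the free leaves.
  #special : count special? ≤ 2 * #freeLeaf + #short
  #special = begin
    count special?                                                      ≤⟨ count-split special? (λ v → v Finₚ.≟ origin) _ id ⟩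
    count (λ v → v Finₚ.≟ origin) + count (λ v → branching? v ⊎-dec freeLeaf? v ⊎-dec short? L v)
      ≤⟨ ℕₚ.+-mono-≤ (ℕₚ.≤-reflexive (exactly⇒count (λ v → v Finₚ.≟ origin) 1 (origin , refl , λ _ e → e)))
          (ℕₚ.≤-trans (count-split (λ v → branching? v ⊎-dec freeLeaf? v ⊎-dec short? L v) branching? _ id)
            (ℕₚ.+-monoʳ-≤ #branching (count-split (λ v → freeLeaf? v ⊎-dec short? L v) freeLeaf? (short? L) id))) ⟩
    1 + (#branching + (#freeLeaf + #short))                             ≡⟨ cong (_+ (#freeLeaf + #short)) #branching-formula ⟩
    #freeLeaf + (#freeLeaf + #short)                                    ≡⟨ s1 #freeLeaf #short ⟩
    2 * #freeLeaf + #short                                              ∎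
    where
    open ℕₚ.≤-Reasoning
    s1 : ∀ m s → m + (m + s) ≡ 2 * m + s
    s1 = solve-∀

  -- Pairs of a vertex and a special vertex near it are counted from the special one, whose ball is
  -- bounded; being near is symmetric.
  #near≤ : #near ≤ 4 ^ suc R * (2 * #freeLeaf + #short)
  #near≤ = begin
    #near                                                 ≡⟨ count-sum near? ⟩
    sum (λ u → bit (near? u))                             ≤⟨ sum-mono row ⟩
    sum (λ u → count (H? u))                              ≡⟨ double-count H? ⟩
    sum (λ v → count (λ u → H? u v))                      ≤⟨ sum-mono column ⟩
    sum (λ v → 4 ^ suc R * bit (special? v))              ≡⟨ sum-scale (4 ^ suc R) (λ v → bit (special? v)) ⟩
    4 ^ suc R * sum (λ v → bit (special? v))              ≡⟨ cong (4 ^ suc R *_) (count-sum special?) ⟨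
    4 ^ suc R * count special?                            ≤⟨ ℕₚ.*-monoʳ-≤ (4 ^ suc R) #special ⟩
    4 ^ suc R * (2 * #freeLeaf + #short)                  ∎
    where
    open ℕₚ.≤-Reasoning
    H? : ∀ u v → Dec (Within ⟦_⟧ (suc R) u v × SpecialVertex v)
    H? u v = within? graph (suc R) u v ×-dec special? v
    some : ∀ {m} {P : Pred (Fin m) 0ℓ} (P? : Decidable P) (ex? : Dec (∃ P)) → bit ex? ≤ count P?
    some P? (no _) = z≤n
    some P? (yes (x , p)) with select P? | ∈-select⁺ P? p
    ... | _ ∷ _ | _ = s≤s z≤n
    row : ∀ u → bit (near? u) ≤ count (H? u)
    row u = some (H? u) (near? u)
    column : ∀ v → count (λ u → H? u v) ≤ 4 ^ suc R * bit (special? v)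
    column v = begin
      count (λ u → H? u v)
        ≤⟨ count-mono (λ u → H? u v) (λ u → special? v ×-dec within? graph (suc R) v u) (λ (w , s) → s , within-sym w) ⟩
      count (λ u → special? v ×-dec within? graph (suc R) v u)    ≡⟨ count-× (special? v) (within? graph (suc R) v) ⟨
      count (within? graph (suc R) v) * bit (special? v)          ≤⟨ ℕₚ.*-monoˡ-≤ (bit (special? v)) (Balls.#within≤ N (suc R) v) ⟩
      4 ^ suc R * bit (special? v)                                ∎

-- K bounds the size of a ball, and K₂ the number of ways to undo a
-- regrafting at a given vertex.
module Constants (R : ℕ) where

  K K₂ : ℕ
  K = 4 ^ suc R
  K₂ = 4 ^ suc (detour (suc R + suc R))

  -- With the weight s = 8 M K, the estimate of `few-near` suffices as soon as Y + 4 + 4 m < 8 m,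
  -- where Y is the sum of the first two terms here. The last term 8 ensures this and also gives 6 ≤
  -- n.
  threshold : ℕ → ℕ
  threshold M = let s = 8 * (M * K) in 2 * (s * s) + 4 * (s * K₂) + 8

module FewNear {n : ℕ} (reps : Representatives n) (R : ℕ) where
  open Classes reps
  open Constants R
  private
    module S (i : Fin #classes) = Structure (rep i)
    module P (i : Fin #classes) = Special (rep i) R

  near-total : ℕ
  near-total = sum (λ i → P.#near i)

  private
    #trees≤ : sum (λ i → S.#tree i) ≤ #classes * (2 * n)
    #trees≤ = ℕₚ.≤-trans (sum-mono (λ i → S.#tree≤2n i)) (ℕₚ.≤-reflexive (sum-const #classes (2 * n)))

    -- Let m be the number of free leaves and b = m - 1. If m ≤ s, then s m is at most s²; otherwise
    -- s ≤ b, and s m is at most b m, whose sum is bounded by `few-branching`.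
    free-leaves : ∀ s → s * sum (λ i → S.#freeLeaf i) ≤ #classes * (s * s + 2 * n)
    free-leaves s = begin
      s * sum (λ i → S.#freeLeaf i)                            ≡⟨ sum-scale s (λ i → S.#freeLeaf i) ⟨
      sum (λ i → s * S.#freeLeaf i)                            ≤⟨ sum-mono pointwise ⟩
      sum (λ i → s * s + S.#branching i * S.#freeLeaf i)       ≡⟨ ∑-distrib-+ (λ _ → s * s) (λ i → S.#branching i * S.#freeLeaf i) ⟩
      sum {#classes} (λ _ → s * s) + sum (λ i → S.#branching i * S.#freeLeaf i)
        ≤⟨ ℕₚ.+-mono-≤ (ℕₚ.≤-reflexive (sum-const #classes (s * s))) (ℕₚ.≤-trans (FewBranching.few-branching reps) #trees≤) ⟩
      #classes * (s * s) + #classes * (2 * n)                  ≡⟨ ℕₚ.*-distribˡ-+ #classes (s * s) (2 * n) ⟨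
      #classes * (s * s + 2 * n)                               ∎
      where
      open ℕₚ.≤-Reasoning
      young : ∀ b → s * suc b ≤ s * s + b * suc b
      young b with ℕₚ.≤-total (suc b) s
      ... | inj₁ le = ℕₚ.≤-trans (ℕₚ.*-monoʳ-≤ s le) (ℕₚ.m≤m+n (s * s) _)
      ... | inj₂ ge with ℕₚ.m≤n⇒m<n∨m≡n ge
      ...   | inj₁ (s≤s le) = ℕₚ.≤-trans (ℕₚ.*-monoˡ-≤ (suc b) le) (ℕₚ.m≤n+m _ (s * s))
      ...   | inj₂ refl = ℕₚ.m≤m+n (suc b * suc b) _
      pointwise : ∀ i → s * S.#freeLeaf i ≤ s * s + S.#branching i * S.#freeLeaf i
      pointwise i = subst (λ m → s * m ≤ s * s + S.#branching i * m) (S.#branching-formula i) (young (S.#branching i))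

    -- There are at least n - 1 tree vertices, hence at least n - 3 new places for each vertex on a
    -- short cycle, and this is at least n / 2 once 6 ≤ n. The factor n then cancels against the at
    -- most 2 n tree vertices.
    shorts : 6 ≤ n → sum (λ i → P.#short i) ≤ #classes * (4 * K₂)
    shorts 6≤n = ℕₚ.*-cancelˡ-≤ n {{ℕ.>-nonZero (ℕₚ.≤-trans (s≤s z≤n) 6≤n)}} (begin
      n * sum (λ i → P.#short i)                                 ≤⟨ ℕₚ.*-monoˡ-≤ _ (half 6≤n) ⟩
      2 * (n ∸ 3) * sum (λ i → P.#short i)                       ≡⟨ ℕₚ.*-assoc 2 (n ∸ 3) _ ⟩
      2 * ((n ∸ 3) * sum (λ i → P.#short i))                     ≡⟨ cong (2 *_) (sum-scale (n ∸ 3) (λ i → P.#short i)) ⟨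
      2 * sum (λ i → (n ∸ 3) * P.#short i)                       ≤⟨ ℕₚ.*-monoʳ-≤ 2 (sum-mono pointwise) ⟩
      2 * sum (λ i → P.#short i * (S.#tree i ∸ 2))               ≤⟨ ℕₚ.*-monoʳ-≤ 2 (FewShort.few-short reps (suc R + suc R)) ⟩
      2 * sum (λ i → S.#tree i * K₂)                             ≡⟨ cong (2 *_) (trans (sum-cong-≗ (λ i → ℕₚ.*-comm (S.#tree i) K₂)) (sum-scale K₂ (λ i → S.#tree i))) ⟩
      2 * (K₂ * sum (λ i → S.#tree i))                           ≤⟨ ℕₚ.*-monoʳ-≤ 2 (ℕₚ.*-monoʳ-≤ K₂ #trees≤) ⟩
      2 * (K₂ * (#classes * (2 * n)))                            ≡⟨ s1 K₂ #classes n ⟩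
      n * (#classes * (4 * K₂))                                  ∎)
      where
      open ℕₚ.≤-Reasoning
      half : ∀ {m} → 6 ≤ m → m ≤ 2 * (m ∸ 3)
      half (s≤s (s≤s (s≤s (s≤s (s≤s (s≤s {n = m} z≤n)))))) =
        ℕₚ.≤-trans (ℕₚ.m≤n+m (6 + m) m) (ℕₚ.≤-reflexive (s2 m))
        where
        s2 : ∀ m → m + (6 + m) ≡ 2 * (3 + m)
        s2 = solve-∀
      pointwise : ∀ i → (n ∸ 3) * P.#short i ≤ P.#short i * (S.#tree i ∸ 2)
      pointwise i = ℕₚ.≤-trans (ℕₚ.≤-reflexive (ℕₚ.*-comm (n ∸ 3) _))
        (ℕₚ.*-monoʳ-≤ (P.#short i) (ℕₚ.∸-monoˡ-≤ 3 (S.n≤1+#tree i)))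
      s1 : ∀ k c n → 2 * (k * (c * (2 * n))) ≡ n * (c * (4 * k))
      s1 = solve-∀

  few-near : 6 ≤ n → ∀ s → s * near-total ≤ #classes * (K * (2 * (s * s) + 4 * n + 4 * (s * K₂)))
  few-near 6≤n s = begin
    s * near-total
      ≤⟨ ℕₚ.*-monoʳ-≤ s (sum-mono (λ i → P.#near≤ i)) ⟩
    s * sum (λ i → K * (2 * S.#freeLeaf i + P.#short i))
      ≡⟨ cong (s *_) (trans (sum-scale K (λ i → 2 * S.#freeLeaf i + P.#short i)) (cong (K *_)
          (trans (∑-distrib-+ (λ i → 2 * S.#freeLeaf i) (λ i → P.#short i)) (cong (_+ Z) (sum-scale 2 (λ i → S.#freeLeaf i)))))) ⟩
    s * (K * (2 * F + Z))                                                  ≡⟨ s1 s K F Z ⟩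
    K * (2 * (s * F) + s * Z)
      ≤⟨ ℕₚ.*-monoʳ-≤ K (ℕₚ.+-mono-≤ (ℕₚ.*-monoʳ-≤ 2 (free-leaves s)) (ℕₚ.*-monoʳ-≤ s (shorts 6≤n))) ⟩
    K * (2 * (#classes * (s * s + 2 * n)) + s * (#classes * (4 * K₂)))     ≡⟨ s2 K #classes s n K₂ ⟩
    #classes * (K * (2 * (s * s) + 4 * n + 4 * (s * K₂)))                  ∎
    where
    open ℕₚ.≤-Reasoning
    F = sum (λ i → S.#freeLeaf i)
    Z = sum (λ i → P.#short i)
    s1 : ∀ s k f z → s * (k * (2 * f + z)) ≡ k * (2 * (s * f) + s * z)
    s1 = solve-∀
    s2 : ∀ k c s n k₂ → k * (2 * (c * (s * s + 2 * n)) + s * (c * (4 * k₂))) ≡ c * (k * (2 * (s * s) + 4 * n + 4 * (s * k₂)))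
    s2 = solve-∀

  near-rare : ∀ M .{{_ : NonZero M}} m → n ≡ suc m → threshold M ≤ m → 1 ≤ #classes → near-total * M < m * #classes
  near-rare M {{M≢0}} m refl large 1≤c = ℕₚ.*-cancelˡ-< s _ _ (begin-strict
    s * (near-total * M)                                              ≡⟨ s1 s near-total M ⟩
    M * (s * near-total)                                              ≤⟨ ℕₚ.*-monoʳ-≤ M (few-near 6≤n s) ⟩
    M * (#classes * (K * (2 * (s * s) + 4 * n + 4 * (s * K₂))))       ≡⟨ s2 M #classes K s m K₂ ⟩
    #classes * (M * K * (2 * (s * s) + 4 * (s * K₂) + 4 + 4 * m))     <⟨ ℕₚ.*-monoʳ-< #classes {{ℕ.>-nonZero 1≤c}} (ℕₚ.*-monoʳ-< (M * K) {{MK≢0}} less) ⟩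
    #classes * (M * K * (8 * m))                                      ≡⟨ s3 #classes (M * K) m ⟩
    s * (m * #classes)                                                ∎)
    where
    open ℕₚ.≤-Reasoning
    s = 8 * (M * K)
    MK≢0 : NonZero (M * K)
    MK≢0 = ℕₚ.m*n≢0 M K {{M≢0}} {{ℕₚ.m^n≢0 4 (suc R)}}
    Y = 2 * (s * s) + 4 * (s * K₂)
    8≤m : 8 ≤ m
    8≤m = ℕₚ.≤-trans (ℕₚ.m≤n+m 8 Y) large
    6≤n : 6 ≤ suc m
    6≤n = ℕₚ.≤-trans (ℕₚ.m≤m+n 6 2) (ℕₚ.≤-trans 8≤m (ℕₚ.n≤1+n m))
    less : Y + 4 + 4 * m < 8 * m
    less = begin-strict
      Y + 4 + 4 * m   <⟨ ℕₚ.+-monoˡ-< (4 * m) (ℕₚ.<-≤-trans (ℕₚ.+-monoʳ-< Y (ℕₚ.m<m+n 4 (s≤s (z≤n {3})))) (ℕₚ.≤-trans large (ℕₚ.m≤m+n m _))) ⟩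
      4 * m + 4 * m   ≡⟨ s4 m ⟩
      8 * m           ∎
      where
      s4 : ∀ m → 4 * m + 4 * m ≡ 8 * m
      s4 = solve-∀
    s1 : ∀ s t m → s * (t * m) ≡ m * (s * t)
    s1 = solve-∀
    s2 : ∀ M c k s m k₂ → M * (c * (k * (2 * (s * s) + 4 * suc m + 4 * (s * k₂)))) ≡ c * (M * k * (2 * (s * s) + 4 * (s * k₂) + 4 + 4 * m))
    s2 = solve-∀
    s3 : ∀ c x m → c * (x * (8 * m)) ≡ 8 * x * (m * c)
    s3 = solve-∀

-- Averages

opaque

  ι : ℕ → ℚ
  ι k = ℤ.+ k ℚ./ 1

  inv : ℕ → ℚ
  inv k = ℤ.+ 1 ℚ./ suc k

private
  -- Comparisons are made between unnormalised fractions, where they are cross multiplications of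
  -- integers, and then carried over to `ℚ`.
  frac : ℕ → ℕ → ℚᵘ.ℚᵘ
  frac a d = ℚᵘ.mkℚᵘ (ℤ.+ a) d

  via : ∀ p → ℚ.toℚᵘ (ℚ.fromℚᵘ p) ℚᵘ.≃ p
  via = ℚₚ.toℚᵘ-fromℚᵘ

  from-≤ : ∀ {p q} → p ℚᵘ.≤ q → ℚ.fromℚᵘ p ℚ.≤ ℚ.fromℚᵘ q
  from-≤ {p} {q} le = ℚₚ.toℚᵘ-cancel-≤ (ℚᵘₚ.≤-respˡ-≃ (ℚᵘₚ.≃-sym (via p)) (ℚᵘₚ.≤-respʳ-≃ (ℚᵘₚ.≃-sym (via q)) le))

  from-< : ∀ {p q} → p ℚᵘ.< q → ℚ.fromℚᵘ p ℚ.< ℚ.fromℚᵘ q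
  from-< {p} {q} lt = ℚₚ.toℚᵘ-cancel-< (ℚᵘₚ.<-respˡ-≃ (ℚᵘₚ.≃-sym (via p)) (ℚᵘₚ.<-respʳ-≃ (ℚᵘₚ.≃-sym (via q)) lt))

  from-+ : ∀ p q → ℚ.fromℚᵘ (p ℚᵘ.+ q) ≡ ℚ.fromℚᵘ p ℚ.+ ℚ.fromℚᵘ q
  from-+ p q = ℚₚ.toℚᵘ-injective (ℚᵘₚ.≃-trans (via (p ℚᵘ.+ q))
    (ℚᵘₚ.≃-sym (ℚᵘₚ.≃-trans (ℚₚ.toℚᵘ-homo-+ (ℚ.fromℚᵘ p) (ℚ.fromℚᵘ q)) (ℚᵘₚ.+-cong (via p) (via q)))))

  from-* : ∀ p q → ℚ.fromℚᵘ (p ℚᵘ.* q) ≡ ℚ.fromℚᵘ p ℚ.* ℚ.fromℚᵘ q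
  from-* p q = ℚₚ.toℚᵘ-injective (ℚᵘₚ.≃-trans (via (p ℚᵘ.* q))
    (ℚᵘₚ.≃-sym (ℚᵘₚ.≃-trans (ℚₚ.toℚᵘ-homo-* (ℚ.fromℚᵘ p) (ℚ.fromℚᵘ q)) (ℚᵘₚ.*-cong (via p) (via q)))))

opaque
  unfolding ι inv

  ι-+ : ∀ a b → ι (a + b) ≡ ι a ℚ.+ ι b
  ι-+ a b = trans (ℚₚ.fromℚᵘ-cong {frac (a + b) 0} {frac a 0 ℚᵘ.+ frac b 0}
    (ℚᵘ.*≡* (cong (ℤ._* ℤ.+ 1) (cong₂ ℤ._+_ (sym (ℤₚ.*-identityʳ (ℤ.+ a))) (sym (ℤₚ.*-identityʳ (ℤ.+ b)))))))
    (from-+ (frac a 0) (frac b 0))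

  ι-* : ∀ a b → ι (a * b) ≡ ι a ℚ.* ι b
  ι-* a b = trans (ℚₚ.fromℚᵘ-cong {frac (a * b) 0} {frac a 0 ℚᵘ.* frac b 0}
    (ℚᵘ.*≡* (cong (ℤ._* ℤ.+ 1) (ℤₚ.pos-* a b)))) (from-* (frac a 0) (frac b 0))

  ι-mono-≤ : ∀ {a b} → a ≤ b → ι a ℚ.≤ ι b
  ι-mono-≤ {a} {b} le = from-≤ {frac a 0} {frac b 0} (ℚᵘ.*≤* (ℤₚ.*-monoʳ-≤-nonNeg (ℤ.+ 1) (ℤ.+≤+ le)))

  ι-mono-< : ∀ {a b} → a < b → ι a ℚ.< ι b
  ι-mono-< {a} {b} lt = from-< {frac a 0} {frac b 0} (ℚᵘ.*<* (ℤₚ.*-monoʳ-<-pos (ℤ.+ 1) (ℤ.+<+ lt)))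

  ι-inv : ∀ k → ι (suc k) ℚ.* inv k ≡ 1ℚ
  ι-inv k = trans (sym (from-* (frac (suc k) 0) (frac 1 k)))
    (ℚₚ.fromℚᵘ-cong {frac (suc k) 0 ℚᵘ.* frac 1 k} {frac 1 0} (ℚᵘ.*≡* (cong (λ m → ℤ.+ suc m) (s1 k))))
    where
    s1 : ∀ k → k * 1 * 1 ≡ k + 0 + 0
    s1 = solve-∀

  inv-antitone : ∀ {a b} → a ≤ b → inv b ℚ.≤ inv a
  inv-antitone {a} {b} le = from-≤ {frac 1 b} {frac 1 a} (ℚᵘ.*≤* (ℤₚ.*-monoˡ-≤-nonNeg (ℤ.+ 1) (ℤ.+≤+ (s≤s le))))

  inv-positive : ∀ k → ℚ.Positive (inv k)
  inv-positive k = ℚₚ.normalize-pos 1 (suc k)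

  ι-nonNegative : ∀ k → ℚ.NonNegative (ι k)
  ι-nonNegative k = ℚ.nonNegative (ι-mono-≤ {0} {k} z≤n)

  -- The denominator of ϵ serves, as a positive numerator is at least one.
  inv-below : ∀ ϵ → 0ℚ ℚ.< ϵ → ∃[ d ] inv d ℚ.≤ ϵ
  inv-below ϵ@(ℚ.mkℚ (ℤ.+ suc a) d _) _ = d , ℚₚ.toℚᵘ-cancel-≤ (ℚᵘₚ.≤-respˡ-≃ (ℚᵘₚ.≃-sym (via (frac 1 d)))
    (ℚᵘ.*≤* (ℤₚ.*-monoʳ-≤-nonNeg (ℤ.+ suc d) {ℤ.+ 1} {ℤ.+ suc a} (ℤ.+≤+ (s≤s z≤n)))))
  inv-below (ℚ.mkℚ (ℤ.+ zero) d _) (ℚ.*<* (ℤ.+<+ ()))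
  inv-below (ℚ.mkℚ ℤ.-[1+ _ ] d _) (ℚ.*<* ())

  ι-0 : ι 0 ≡ 0ℚ
  ι-0 = refl

  ι-1 : ι 1 ≡ 1ℚ
  ι-1 = refl

  mean-∷ : ∀ q qs → mean (q ∷ qs) ≡ foldr ℚ._+_ 0ℚ (q ∷ qs) ℚ.* inv (length qs)
  mean-∷ q qs = refl

small : ∀ B k c d → B * suc d < suc k * suc c → ι B ℚ.* inv k ℚ.* inv c ℚ.< inv d
small B k c d lt = ℚₚ.*-cancelʳ-<-nonNeg (ι (suc d)) {{ι-nonNegative (suc d)}} (begin-strict
  ι B ℚ.* inv k ℚ.* inv c ℚ.* ι (suc d)                       ≡⟨ cong (ℚ._* ι (suc d)) (ℚₚ.*-assoc (ι B) (inv k) (inv c)) ⟩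
  ι B ℚ.* (inv k ℚ.* inv c) ℚ.* ι (suc d)                     ≡⟨ trans (ℚₚ.*-assoc (ι B) _ _) (trans (cong (ι B ℚ.*_) (ℚₚ.*-comm _ (ι (suc d)))) (sym (ℚₚ.*-assoc (ι B) _ _))) ⟩
  ι B ℚ.* ι (suc d) ℚ.* (inv k ℚ.* inv c)                     ≡⟨ cong (ℚ._* (inv k ℚ.* inv c)) (ι-* B (suc d)) ⟨
  ι (B * suc d) ℚ.* (inv k ℚ.* inv c)                         <⟨ ℚₚ.*-monoˡ-<-pos (inv k ℚ.* inv c) {{ℚₚ.pos*pos⇒pos (inv k) {{inv-positive k}} (inv c) {{inv-positive c}}}} (ι-mono-< lt) ⟩
  ι (suc k * suc c) ℚ.* (inv k ℚ.* inv c)                     ≡⟨ cong (ℚ._* (inv k ℚ.* inv c)) (ι-* (suc k) (suc c)) ⟩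
  ι (suc k) ℚ.* ι (suc c) ℚ.* (inv k ℚ.* inv c)               ≡⟨ interchange* (ι (suc k)) (ι (suc c)) (inv k) (inv c) ⟩
  ι (suc k) ℚ.* inv k ℚ.* (ι (suc c) ℚ.* inv c)               ≡⟨ cong₂ ℚ._*_ (ι-inv k) (ι-inv c) ⟩
  1ℚ                                                          ≡⟨ trans (ℚₚ.*-comm (inv d) (ι (suc d))) (ι-inv d) ⟨
  inv d ℚ.* ι (suc d)                                         ∎)
  where
  open ℚₚ.≤-Reasoning
  interchange* = CommutativeSemigroupProperties.interchange (CommutativeMonoid.commutativeSemigroup ℚₚ.*-1-commutativeMonoid)

-- Used at two levels: for the tree vertices of a network, with `h` the bit of being near and `δ`
-- one, and for the networks, with `h` the number of near vertices and `δ` a bound for the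
-- reciprocal of the number of tree vertices.
average-bound : (xs : List A) (k : ℕ) → length xs ≡ suc k → (f : A → ℚ) (q : ℚ) (h : A → ℕ) (δ : ℚ) →
  (∀ {x} → x ∈ xs → ℚ.∣ f x ℚ.- q ∣ ℚ.≤ ι (h x) ℚ.* δ) →
  ℚ.∣ mean (map f xs) ℚ.- q ∣ ℚ.≤ ι (ListAction.sum (map h xs)) ℚ.* δ ℚ.* inv k
average-bound {A = A} (x ∷ xs) k refl f q h δ close rewrite mean-∷ (f x) (map f xs) | Listₚ.length-map f xs = begin
  ℚ.∣ S (x ∷ xs) ℚ.* inv k ℚ.- q ∣                              ≡⟨ cong ℚ.∣_∣ factor ⟩
  ℚ.∣ (S (x ∷ xs) ℚ.- ι (suc k) ℚ.* q) ℚ.* inv k ∣              ≡⟨ ℚₚ.∣p*q∣≡∣p∣*∣q∣ (S (x ∷ xs) ℚ.- ι (suc k) ℚ.* q) (inv k) ⟩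
  ℚ.∣ S (x ∷ xs) ℚ.- ι (suc k) ℚ.* q ∣ ℚ.* ℚ.∣ inv k ∣          ≡⟨ cong (ℚ.∣ S (x ∷ xs) ℚ.- ι (suc k) ℚ.* q ∣ ℚ.*_) (ℚₚ.0≤p⇒∣p∣≡p (ℚₚ.<⇒≤ (ℚₚ.positive⁻¹ (inv k) {{inv-positive k}}))) ⟩
  ℚ.∣ S (x ∷ xs) ℚ.- ι (suc k) ℚ.* q ∣ ℚ.* inv k                ≤⟨ ℚₚ.*-monoʳ-≤-nonNeg (inv k) {{ℚₚ.pos⇒nonNeg (inv k) {{inv-positive k}}}} (total (x ∷ xs) close) ⟩
  ι (ListAction.sum (map h (x ∷ xs))) ℚ.* δ ℚ.* inv k                 ∎
  where
  open ℚₚ.≤-Reasoning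
  S : List A → ℚ
  S ys = foldr ℚ._+_ 0ℚ (map f ys)
  factor : S (x ∷ xs) ℚ.* inv k ℚ.- q ≡ (S (x ∷ xs) ℚ.- ι (suc k) ℚ.* q) ℚ.* inv k
  factor = sym (trans (ℚₚ.*-distribʳ-+ (inv k) (S (x ∷ xs)) (ℚ.- (ι (suc k) ℚ.* q))) (cong (S (x ∷ xs) ℚ.* inv k ℚ.+_)
    (trans (sym (ℚₚ.neg-distribˡ-* (ι (suc k) ℚ.* q) (inv k))) (cong ℚ.-_ (trans (cong (ℚ._* inv k) (ℚₚ.*-comm (ι (suc k)) q))
      (trans (ℚₚ.*-assoc q (ι (suc k)) (inv k)) (trans (cong (q ℚ.*_) (ι-inv k)) (ℚₚ.*-identityʳ q))))))))
  total : ∀ ys → (∀ {y} → y ∈ ys → ℚ.∣ f y ℚ.- q ∣ ℚ.≤ ι (h y) ℚ.* δ) →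
    ℚ.∣ S ys ℚ.- ι (length ys) ℚ.* q ∣ ℚ.≤ ι (ListAction.sum (map h ys)) ℚ.* δ
  total [] _ = ℚₚ.≤-reflexive (trans (cong (λ p → ℚ.∣ 0ℚ ℚ.- p ∣) (trans (cong (ℚ._* q) ι-0) (ℚₚ.*-zeroˡ q))) (sym (trans (cong (ℚ._* δ) ι-0) (ℚₚ.*-zeroˡ δ))))
  total (y ∷ ys) close = begin
    ℚ.∣ (f y ℚ.+ S ys) ℚ.- ι (suc (length ys)) ℚ.* q ∣          ≡⟨ cong ℚ.∣_∣ split ⟩
    ℚ.∣ (f y ℚ.- q) ℚ.+ (S ys ℚ.- ι (length ys) ℚ.* q) ∣        ≤⟨ ℚₚ.∣p+q∣≤∣p∣+∣q∣ (f y ℚ.- q) _ ⟩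
    ℚ.∣ f y ℚ.- q ∣ ℚ.+ ℚ.∣ S ys ℚ.- ι (length ys) ℚ.* q ∣      ≤⟨ ℚₚ.+-mono-≤ (close (here refl)) (total ys (λ p → close (there p))) ⟩
    ι (h y) ℚ.* δ ℚ.+ ι (ListAction.sum (map h ys)) ℚ.* δ             ≡⟨ ℚₚ.*-distribʳ-+ δ (ι (h y)) _ ⟨
    (ι (h y) ℚ.+ ι (ListAction.sum (map h ys))) ℚ.* δ                 ≡⟨ cong (ℚ._* δ) (ι-+ (h y) _) ⟨
    ι (h y + ListAction.sum (map h ys)) ℚ.* δ                         ∎
    where
    split : (f y ℚ.+ S ys) ℚ.- ι (suc (length ys)) ℚ.* q ≡ (f y ℚ.- q) ℚ.+ (S ys ℚ.- ι (length ys) ℚ.* q)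
    split = trans (cong (λ p → (f y ℚ.+ S ys) ℚ.- p) (trans (cong (ℚ._* q) (trans (ι-+ 1 (length ys)) (cong (ℚ._+ ι (length ys)) ι-1)))
        (trans (ℚₚ.*-distribʳ-+ q 1ℚ (ι (length ys))) (cong (ℚ._+ ι (length ys) ℚ.* q) (ℚₚ.*-identityˡ q)))))
      (trans (cong ((f y ℚ.+ S ys) ℚ.+_) (ℚₚ.neg-distrib-+ q (ι (length ys) ℚ.* q)))
        (CommutativeSemigroupProperties.interchange (CommutativeMonoid.commutativeSemigroup ℚₚ.+-0-commutativeMonoid) (f y) (S ys) (ℚ.- q) (ℚ.- (ι (length ys) ℚ.* q))))

-- Passing to the limit

≅-sym : ∀ {G H} → G ≅ H → H ≅ G
≅-sym {G} {H} φ = record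
  { bijection = mk↔ₛ′ from to strictlyInverseʳ strictlyInverseˡ
  ; base-preserved = trans (cong from (sym base-preserved)) (strictlyInverseʳ _)
  ; mark-preserved = λ u → trans (sym (mark-preserved (from u))) (cong H.mark (strictlyInverseˡ u))
  ; edge-preserved = λ u v → mk⇔
      (λ e → Equivalence.from (edge-preserved (from u) (from v)) (subst₂ H.Edge (sym (strictlyInverseˡ u)) (sym (strictlyInverseˡ v)) e))
      (λ e → subst₂ H.Edge (strictlyInverseˡ u) (strictlyInverseˡ v) (Equivalence.to (edge-preserved (from u) (from v)) e)) }
  where
  module H = RootedMarkedGraph H
  open _≅_ φ
  open Inverse bijection using (strictlyInverseˡ; strictlyInverseʳ)

≅-trans : ∀ {G H I} → G ≅ H → H ≅ I → G ≅ I
≅-trans φ ψ = record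
  { bijection = mk↔ₛ′ (ψ.to ∘ φ.to) (φ.from ∘ ψ.from)
      (λ v → trans (cong ψ.to (Inverse.strictlyInverseˡ φ.bijection _)) (Inverse.strictlyInverseˡ ψ.bijection v))
      (λ v → trans (cong φ.from (Inverse.strictlyInverseʳ ψ.bijection _)) (Inverse.strictlyInverseʳ φ.bijection v))
  ; base-preserved = trans (cong ψ.to φ.base-preserved) ψ.base-preserved
  ; mark-preserved = λ u → trans (ψ.mark-preserved (φ.to u)) (φ.mark-preserved u)
  ; edge-preserved = λ u v → mk⇔
      (Equivalence.to (ψ.edge-preserved _ _) ∘ Equivalence.to (φ.edge-preserved u v))
      (Equivalence.from (φ.edge-preserved u v) ∘ Equivalence.from (ψ.edge-preserved _ _)) }
  where
  module φ = _≅_ φ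
  module ψ = _≅_ ψ

truth : Bool → ℚ
truth b = if b then 1ℚ else 0ℚ

opaque
  unfolding ι

  truth-close : ∀ a b → ℚ.∣ truth a ℚ.- truth b ∣ ℚ.≤ ι 1 ℚ.* 1ℚ
  truth-close true  true  = toWitness {a? = ℚ.∣ 1ℚ ℚ.- 1ℚ ∣ ℚₚ.≤? ι 1 ℚ.* 1ℚ} tt
  truth-close true  false = toWitness {a? = ℚ.∣ 1ℚ ℚ.- 0ℚ ∣ ℚₚ.≤? ι 1 ℚ.* 1ℚ} tt
  truth-close false true  = toWitness {a? = ℚ.∣ 0ℚ ℚ.- 1ℚ ∣ ℚₚ.≤? ι 1 ℚ.* 1ℚ} tt
  truth-close false false = toWitness {a? = ℚ.∣ 0ℚ ℚ.- 0ℚ ∣ ℚₚ.≤? ι 1 ℚ.* 1ℚ} tt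

  truth-equal : ∀ a b → a ≡ b → ℚ.∣ truth a ℚ.- truth b ∣ ℚ.≤ ι 0 ℚ.* 1ℚ
  truth-equal true  _ refl = toWitness {a? = ℚ.∣ 1ℚ ℚ.- 1ℚ ∣ ℚₚ.≤? ι 0 ℚ.* 1ℚ} tt
  truth-equal false _ refl = toWitness {a? = ℚ.∣ 0ℚ ℚ.- 0ℚ ∣ ℚₚ.≤? ι 0 ℚ.* 1ℚ} tt

sum-bits : {P : A → Set} (P? : ∀ x → Dec (P x)) (xs : List A) → ListAction.sum (map (λ x → bit (P? x)) xs) ≡ length (filter P? xs)
sum-bits P? [] = refl
sum-bits P? (x ∷ xs) with does (P? x)
... | true  = cong suc (sum-bits P? xs)
... | false = sum-bits P? xs

sum-lookup : (h : A → ℕ) (xs : List A) → ListAction.sum (map h xs) ≡ sum (λ i → h (List.lookup xs i))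
sum-lookup h []       = refl
sum-lookup h (x ∷ xs) = cong (h x +_) (sum-lookup h xs)

orElse-nonempty : (xs : List A) {a : A} → 0 < length xs → xs orElse a ≡ xs
orElse-nonempty (x ∷ xs) _ = refl

-- Far from the special vertices a ball is that of the decorated chain, so
-- its indicator has the value b there.
module _ (R : ℕ) (G : FiniteRootedGraph) (b : Bool)
         (limit : ∀ {n} (N : Network n) u → U R (FiniteGraph.⟦_⟧ (Network.graph N)) u ≅ U R 𝓛̂ p₀ →
                  does (U≅? R (Network.graph N) u G) ≡ b) where

  -- With m + 2 labels there are at least m + 1 tree vertices. So the default vertex is never drawn,
  -- and dividing by m + 1 instead of the number of tree vertices only enlarges the bound.
  tree-average : ∀ {m} (N : Network (suc (suc m))) (default : Fin (Network.order N)) →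
    ℚ.∣ mean (map (λ u → indicator (U≅? R (Network.graph N) u G)) (treeVertices N orElse default)) ℚ.- truth b ∣
      ℚ.≤ ι (Special.#near N R) ℚ.* inv m
  tree-average {m} N default = by #tree refl
    where
    open Structure N
    open Special N R
    trees : List V
    trees = treeVertices N
    1+m≤#tree : suc m ≤ #tree
    1+m≤#tree = ℕₚ.≤-pred n≤1+#tree
    f : V → ℚ
    f u = indicator (U≅? R graph u G)
    close : ∀ {u} → u ∈ trees → ℚ.∣ f u ℚ.- truth b ∣ ℚ.≤ ι (bit (near? u)) ℚ.* 1ℚ
    close {u} p = case-near (near? u)
      where
      case-near : (d : Dec (Near u)) → ℚ.∣ f u ℚ.- truth b ∣ ℚ.≤ ι (bit d) ℚ.* 1ℚ
      case-near (yes _) = truth-close (does (U≅? R graph u G)) b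
      case-near (no far) = truth-equal (does (U≅? R graph u G)) b
        (limit N u (Unfolding.LocalLimit.ball-≅ N u R (∈-select⁻ (of-mark? tree) p) (not-near⇒tame far)))
    near-trees : ListAction.sum (map (λ u → bit (near? u)) trees) ≤ #near
    near-trees = ℕₚ.≤-trans (ℕₚ.≤-reflexive (sum-bits near? trees))
      (length-⊆ (Uniqueₚ.filter⁺ near? (select-unique (of-mark? tree))) (λ p → ∈-select⁺ near? (proj₂ (∈-filter⁻ near? {xs = trees} p))))
    by : ∀ t → #tree ≡ t → ℚ.∣ mean (map f (trees orElse default)) ℚ.- truth b ∣ ℚ.≤ ι #near ℚ.* inv m
    by zero eq = case subst (suc m ≤_) eq 1+m≤#tree of λ ()
    by (suc t) eq = subst (λ us → ℚ.∣ mean (map f us) ℚ.- truth b ∣ ℚ.≤ ι #near ℚ.* inv m)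
      (sym (orElse-nonempty trees (subst (0 <_) (sym eq) (s≤s z≤n)))) (begin
      ℚ.∣ mean (map f trees) ℚ.- truth b ∣                               ≤⟨ average-bound trees t eq f (truth b) (λ u → bit (near? u)) 1ℚ close ⟩
      ι (ListAction.sum (map (λ u → bit (near? u)) trees)) ℚ.* 1ℚ ℚ.* inv t    ≡⟨ cong (ℚ._* inv t) (ℚₚ.*-identityʳ (ι (ListAction.sum (map (λ u → bit (near? u)) trees)))) ⟩
      ι (ListAction.sum (map (λ u → bit (near? u)) trees)) ℚ.* inv t           ≤⟨ ℚₚ.*-monoʳ-≤-nonNeg (inv t) {{ℚₚ.pos⇒nonNeg (inv t) {{inv-positive t}}}} (ι-mono-≤ near-trees) ⟩
      ι #near ℚ.* inv t                                                  ≤⟨ ℚₚ.*-monoˡ-≤-nonNeg (ι #near) {{ι-nonNegative #near}} (inv-antitone (ℕₚ.≤-pred (subst (suc m ≤_) eq 1+m≤#tree))) ⟩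
      ι #near ℚ.* inv m                                                  ∎)
      where open ℚₚ.≤-Reasoning

  converges : (reps : ∀ n → Representatives n) (default : ∀ n (N : Network n) → Fin (Network.order N)) →
    (λ n → ballProbability (reps n) (default n) R G) ⟶ truth b
  converges reps default ϵ ϵ>0 with inv-below ϵ ϵ>0
  -- `near-rare` is used with M = d + 1, which brings the error below 1 / (d + 1). The summand 2
  -- puts n in the form m + 2.
  ... | d , le = 2 + threshold′ , bound
    where
    threshold′ : ℕ
    threshold′ = Constants.threshold R (suc d)
    bound : ∀ n → 2 + threshold′ ≤ n → ℚ.∣ ballProbability (reps n) (default n) R G ℚ.- truth b ∣ ℚ.< ϵ
    bound (suc (suc m)) (s≤s (s≤s large)) = by #classes refl
      where
      open Classes (reps (suc (suc m)))
      open FewNear (reps (suc (suc m))) R using (near-total; near-rare)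
      open Representatives (reps (suc (suc m))) using (networks)
      by : ∀ c → #classes ≡ c → ℚ.∣ ballProbability (reps (suc (suc m))) (default (suc (suc m))) R G ℚ.- truth b ∣ ℚ.< ϵ
      -- The class of a caterpillar shows that the list of classes is not empty.
      by zero eq = case subst Fin eq (proj₁ (class (caterpillar (suc m)))) of λ ()
      by (suc c) eq = begin-strict
        ℚ.∣ ballProbability (reps (suc (suc m))) (default (suc (suc m))) R G ℚ.- truth b ∣
          ≤⟨ average-bound networks c eq (λ N → mean (map (λ u → indicator (U≅? R (Network.graph N) u G)) (treeVertices N orElse default (suc (suc m)) N))) (truth b) (λ N → Special.#near N R) (inv m) (λ {N} _ → tree-average N (default (suc (suc m)) N)) ⟩
        ι (ListAction.sum (map (λ N → Special.#near N R) networks)) ℚ.* inv m ℚ.* inv c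
          ≡⟨ cong (λ B → ι B ℚ.* inv m ℚ.* inv c) (sum-lookup (λ N → Special.#near N R) networks) ⟩
        ι near-total ℚ.* inv m ℚ.* inv c
          <⟨ small near-total m c d (subst (λ c → near-total * suc d < suc m * c) eq
               (near-rare (suc d) (suc m) refl (ℕₚ.m≤n⇒m≤1+n large) (subst (1 ≤_) (sym eq) (s≤s z≤n)))) ⟩
        inv d
          ≤⟨ le ⟩
        ϵ ∎
        where open ℚₚ.≤-Reasoning

-- The existence of systems of representatives keeps the convergence statement, which quantifies
-- over them, from being vacuous.
theorem1p7 : (∀ n → Representatives n) ×
    (∀ (reps : ∀ n → Representatives n)
    (default : ∀ n (N : Network n) → Fin (Network.order N)) →
    LocallyConverges (λ n → ballProbability (reps n) (default n)) 𝓛̂ p₀)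
theorem1p7 = representatives , λ reps default R G →
  (λ φ → converges R G true
    (λ N u κ → dec-true (U≅? R (Network.graph N) u G) (≅-trans κ φ)) reps default) ,
  (λ ¬φ → converges R G false
    (λ N u κ → dec-false (U≅? R (Network.graph N) u G) (λ φ → ¬φ (≅-trans (≅-sym κ) φ))) reps default)
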